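{- The translation $W:L_{LR}\to L_{name}$, which is the identity on expressions and contexts, is convergence equivalent and fully abstract: for all $s\in\mathbb{E}_{\mathcal L}$, $s\downarrow_{LR}\iff W(s)\downarrow_{name}$; and for all $s,t\in\mathbb{E}_{\mathcal L}$, $s\le_{LR}t\iff W(s)\le_{name}W(t)$.
   Context: **Syntax.** Fix a set of data constructors partitioned into types; each constructor $c$ has an arity $\mathrm{ar}(c)\ge 0$; the constructors of type $T$ are enumerated as $c_{T,1},\dots,c_{T,|T|}$; there is a type Bool with nullary constructors True, False. Constructors occur only fully saturated. Expressions $\mathbb{E}_{\mathcal L}$: $s,t ::= x \mid (s\ t)\mid (\lambda x.s)\mid (\mathtt{letrec}\ x_1=s_1,\dots,x_n=s_n\ \mathtt{in}\ t)\mid (c\ s_1\dots s_{\mathrm{ar}(c)})\mid(\mathtt{seq}\ s\ t)\mid(\mathtt{case}_T\ s\ \mathtt{of}\ alts)$, where $alts$ has exactly one alternative $((c\ y_1\dots y_{\mathrm{ar}(c)})\to r)$ for each constructor $c$ of type $T$ (the $y_i$ are distinct variables bound in $r$). In letrec, $n\ge1$, the $x_i$ are distinct, the bindings are recursive (the scope of each $x_j$ is $s_1,\dots,s_n,t$) and are identified up to reordering. Expressions are taken up to $\alpha$-equivalence; bound variables are assumed distinct from each other and from free variables, and reductions rename implicitly if necessary. $Env$ denotes a group of letrec-bindings (possibly empty if other bindings are displayed). Contexts $C$ are expressions with one hole $[\cdot]$ in place of a subexpression; $\mathbb{C}_{\mathcal L}$ is the set of all of them. A value $v$ is an abstraction or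 a constructor application. **The calculus $L_{LR}$.** A normal-order step $\xrightarrow{LR}$ on $\mathbb{E}_{\mathcal L}$ is defined in two stages. *Stage 1 (labelling)* with labels $S,T,V,W$: start with $s^T$ and no other labels, and exhaustively apply (subterms may carry more labels than displayed; $a^{S\vee T}$ means label $S$ or $T$; the fail rules take precedence): - $(\mathtt{letrec}\ Env\ \mathtt{in}\ s)^T\leadsto(\mathtt{letrec}\ Env\ \mathtt{in}\ s^S)^V$; - $(s\ t)^{S\vee T}\leadsto(s^S\ t)^V$; $(\mathtt{seq}\ s\ t)^{S\vee T}\leadsto(\mathtt{seq}\ s^S\ t)^V$; $(\mathtt{case}_T\ s\ \mathtt{of}\ alts)^{S\vee T}\leadsto(\mathtt{case}_T\ s^S\ \mathtt{of}\ alts)^V$; - $\mathtt{letrec}\ x=s,Env\ \mathtt{in}\ C[x^S]\leadsto\mathtt{letrec}\ x=s^S,Env\ \mathtt{in}\ C[x^V]$; - $\mathtt{letrec}\ x=s^{V\vee W},y=C[x^S],Env\ \mathtt{in}\ t\leadsto$ fail; $\mathtt{letrec}\ x=C[x^S],Env\ \mathtt{in}\ s\leadsto$ fail; - $\mathtt{letrec}\ x=s,y=C[x^S],Env\ \mathtt{in}\ t\leadsto\mathtt{letrec}\ x=s^S,y=C[x^V],Env\ \mathtt{in}\ t$ if $C[x]\neq x$; - $\mathtt{letrec}\ x=s,y=x^S,Env\ \mathtt{in}\ t\leadsto\mathtt{letrec}\ x=s^S,y=x^W,Env\ \mathtt{in}\ t$. *Stage 2*: if labelling does not fail, apply one of the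 following rules, if possible, where the displayed labels $S,V$ must match. $Ch$ denotes a chain $x_2=x_1,\dots,x_m=x_{m-1}$ (empty if $m=1$). - (lbeta) $C[((\lambda x.s)^S\ t)]\to C[\mathtt{letrec}\ x=t\ \mathtt{in}\ s]$. - (cp-in) $\mathtt{letrec}\ x_1=(\lambda x.s)^S,Ch,Env\ \mathtt{in}\ C[x_m^V]\to\mathtt{letrec}\ x_1=\lambda x.s,Ch,Env\ \mathtt{in}\ C[\lambda x.s]$. - (cp-e) $\mathtt{letrec}\ x_1=(\lambda x.s)^S,Ch,Env,y=C[x_m^V]\ \mathtt{in}\ t\to\mathtt{letrec}\ x_1=\lambda x.s,Ch,Env,y=C[\lambda x.s]\ \mathtt{in}\ t$. - (lapp) $C[((\mathtt{letrec}\ Env\ \mathtt{in}\ s)^S\ t)]\to C[\mathtt{letrec}\ Env\ \mathtt{in}\ (s\ t)]$; (lcase) $C[\mathtt{case}_T\ (\mathtt{letrec}\ Env\ \mathtt{in}\ s)^S\ \mathtt{of}\ alts]\to C[\mathtt{letrec}\ Env\ \mathtt{in}\ (\mathtt{case}_T\ s\ \mathtt{of}\ alts)]$; (lseq) $C[\mathtt{seq}\ (\mathtt{letrec}\ Env\ \mathtt{in}\ s)^S\ t]\to C[\mathtt{letrec}\ Env\ \mathtt{in}\ (\mathtt{seq}\ s\ t)]$. - (llet-in) $\mathtt{letrec}\ Env_1\ \mathtt{in}\ (\mathtt{letrec}\ Env_2\ \mathtt{in}\ s)^S\to\mathtt{letrec}\ Env_1,Env_2\ \mathtt{in}\ s$;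 (llet-e) $\mathtt{letrec}\ Env_1,x=(\mathtt{letrec}\ Env_2\ \mathtt{in}\ s)^S\ \mathtt{in}\ t\to\mathtt{letrec}\ Env_1,Env_2,x=s\ \mathtt{in}\ t$. - (seq-c) $C[(\mathtt{seq}\ v^S\ s)]\to C[s]$ for a value $v$; (seq-in) $\mathtt{letrec}\ x_1=v^S,Ch,Env\ \mathtt{in}\ C[(\mathtt{seq}\ x_m^V\ s)]\to\mathtt{letrec}\ x_1=v,Ch,Env\ \mathtt{in}\ C[s]$ and (seq-e) $\mathtt{letrec}\ x_1=v^S,Ch,Env,y=C[(\mathtt{seq}\ x_m^V\ s)]\ \mathtt{in}\ t\to\mathtt{letrec}\ x_1=v,Ch,Env,y=C[s]\ \mathtt{in}\ t$, both for a constructor application $v$. - (case-c) $C[\mathtt{case}_T\ (c\ s_1\dots s_k)^S\ \mathtt{of}\dots((c\ y_1\dots y_k)\to t)\dots]\to C[\mathtt{letrec}\ y_1=s_1,\dots,y_k=s_k\ \mathtt{in}\ t]$ if $k=\mathrm{ar}(c)\ge1$, and $\to C[t]$ if $k=0$. - (case-in) $\mathtt{letrec}\ x_1=(c\ s_1\dots s_k)^S,Ch,Env\ \mathtt{in}\ C[\mathtt{case}_T\ x_m^V\ \mathtt{of}\dots((c\ z_1\dots z_k)\to t)\dots]\to\mathtt{letrec}\ x_1=(c\ y_1\dots y_k),y_1=s_1,\dots,y_k=s_k,Ch,Env\ \mathtt{in}\ C[\mathtt{letrec}\ z_1=y_1,\dots,z_k=y_k\ \mathtt{in}\ t]$ with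 fresh $y_i$ if $k=\mathrm{ar}(c)\ge1$; if $k=0$ the result is $\mathtt{letrec}\ x_1=c,Ch,Env\ \mathtt{in}\ C[t]$. - (case-e) the same with the case-expression inside a binding: $\mathtt{letrec}\ x_1=(c\ s_1\dots s_k)^S,Ch,u=C[\mathtt{case}_T\ x_m^V\ \mathtt{of}\dots((c\ z_1\dots z_k)\to t)\dots],Env\ \mathtt{in}\ r\to\mathtt{letrec}\ x_1=(c\ y_1\dots y_k),y_1=s_1,\dots,y_k=s_k,Ch,u=C[\mathtt{letrec}\ z_1=y_1,\dots,z_k=y_k\ \mathtt{in}\ t],Env\ \mathtt{in}\ r$ with fresh $y_i$ if $k\ge1$; if $k=0$ the result is $\mathtt{letrec}\ x_1=c,Ch,u=C[t],Env\ \mathtt{in}\ r$. The $L_{LR}$-WHNFs (answers) are: abstractions; constructor applications; $\mathtt{letrec}\ Env\ \mathtt{in}\ v$ with $v$ a value; and $\mathtt{letrec}\ x_1=v,Ch,Env\ \mathtt{in}\ x_m$ with $v$ a constructor application. **The calculus $L_{name}$** on $\mathbb{E}_{\mathcal L}$: let $L::=[\cdot]\mid\mathtt{letrec}\ Env\ \mathtt{in}\ L$ and $A::=[\cdot]\mid(A\ s)\mid(\mathtt{case}_T\ A\ \mathtt{of}\ alts)\mid(\mathtt{seq}\ A\ s)$; reduction contexts are $R=L[A]$. $\xrightarrow{name}$ is given by: (beta) $R[(\lambda x.s)\ t]\to R[s[t/x]]$; (gcp) $L[\mathtt{letrec}\ Env,x=s\ \mathtt{in}\ R[x]]\to L[\mathtt{letrec}\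 Env,x=s\ \mathtt{in}\ R[s]]$ (with $x$ the displayed bound variable); (lapp) $R[((\mathtt{letrec}\ Env\ \mathtt{in}\ s)\ t)]\to R[\mathtt{letrec}\ Env\ \mathtt{in}\ (s\ t)]$; (lcase) $R[\mathtt{case}_T\ (\mathtt{letrec}\ Env\ \mathtt{in}\ s)\ \mathtt{of}\ alts]\to R[\mathtt{letrec}\ Env\ \mathtt{in}\ (\mathtt{case}_T\ s\ \mathtt{of}\ alts)]$; (lseq) $R[\mathtt{seq}\ (\mathtt{letrec}\ Env\ \mathtt{in}\ s)\ t]\to R[\mathtt{letrec}\ Env\ \mathtt{in}\ (\mathtt{seq}\ s\ t)]$; (seq) $R[\mathtt{seq}\ v\ s]\to R[s]$ for a value $v$; (case) $R[\mathtt{case}_T\ (c\ s_1\dots s_k)\ \mathtt{of}\dots((c\ x_1\dots x_k)\to t)\dots]\to R[t[s_1/x_1,\dots,s_k/x_k]]$. The $L_{name}$-WHNFs (answers) are the expressions $L[v]$ with $v$ a value. **Contextual preorders.** For $D\in\{LR,name\}$, $s\downarrow_D$ means $s\xrightarrow{D,*}v$ for some answer $v$ of the calculus, and $s\le_Dt$ iff for all $C\in\mathbb{C}_{\mathcal L}$: $C[s]\downarrow_D\Rightarrow C[t]\downarrow_D$. -}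

module Defs where

open import Data.Fin using (Fin; zero; suc; _↑ˡ_; _↑ʳ_; splitAt; join)
open import Data.Nat using (ℕ; zero; suc; _+_; NonZero)
open import Data.Product using (∃; ∃-syntax; _×_)
open import Data.Sum using (_⊎_; [_,_]′; map₂)
open import Data.Unit using (⊤; tt)
open import Data.Vec using (Vec; []; _∷_; _++_; lookup; tabulate; _[_]≔_)
open import Data.Vec.Relation.Unary.All using (All; []; _∷_)
open import Data.Vec.Relation.Unary.All.Properties using (lookup⁺)
open import Function using (_∘_)
open import Function.Definitions using (Injective)
open import Relation.Binary.Construct.Closure.ReflexiveTransitive using (Star)
open import Relation.Binary.PropositionalEquality using (_≡_; _≢_)
open import Relation.Nullary using (¬_)

-- A constructor is a pair of a type τ and an index i : Fin ∣ τ ∣; its arity is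
-- lookup (ar τ) i.
record Signature : Set₁ where
  field
    Ty           : Set
    ∣_∣          : Ty → ℕ
    ar           : (τ : Ty) → Vec ℕ ∣ τ ∣
    inhabited    : (τ : Ty) → NonZero ∣ τ ∣
    Bool         : Ty
    two-Bools    : ∣ Bool ∣ ≡ 2
    Bool-nullary : All (_≡ 0) (ar Bool)

module Calculus (Sig : Signature) where
  open Signature Sig

  -- Well-scoped de Bruijn terms represent α-equivalence classes.  Exp A n has
  -- its free variables in Fin n and carries an annotation from A at every
  -- subexpression: A = ⊤ gives the plain expressions, A = Label those handled
  -- by the labelling algorithm.
  --
  -- A binder of k variables extends the scope from n to k + n; the i-th bound
  -- variable is i ↑ˡ n.  In letrec bs t the i-th variable is bound to
  -- lookup bs i.  Every rule below addresses bindings by an arbitrary position,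
  -- so the order of the bindings of a letrec is irrelevant to reduction.
  mutual
    data Exp (A : Set) (n : ℕ) : Set where
      _^_ : Node A n → A → Exp A n

    data Node (A : Set) (n : ℕ) : Set where
      var    : Fin n → Node A n
      app    : Exp A n → Exp A n → Node A n
      lam    : Exp A (suc n) → Node A n
      letrec : ∀ {k} → Vec (Exp A (suc k + n)) (suc k) → Exp A (suc k + n) → Node A n
      con    : ∀ τ (i : Fin ∣ τ ∣) → Vec (Exp A n) (lookup (ar τ) i) → Node A n
      seq    : Exp A n → Exp A n → Node A n
      case   : ∀ τ → Exp A n → Alts A n (ar τ) → Node A n

    Alts : Set → ℕ → ∀ {k} → Vec ℕ k → Set
    Alts A n = All (λ a → Exp A (a + n))

  infix 8 _^_

  private variable
    A B     : Set
    k m n a : ℕ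
    as      : Vec ℕ k

  E : ℕ → Set
  E = Exp ⊤

  mutual
    mapᵃ : (A → B) → Exp A n → Exp B n
    mapᵃ f (var x ^ l)       = var x ^ f l
    mapᵃ f (app s t ^ l)     = app (mapᵃ f s) (mapᵃ f t) ^ f l
    mapᵃ f (lam s ^ l)       = lam (mapᵃ f s) ^ f l
    mapᵃ f (letrec bs t ^ l) = letrec (mapsᵃ f bs) (mapᵃ f t) ^ f l
    mapᵃ f (con τ i ss ^ l)  = con τ i (mapsᵃ f ss) ^ f l
    mapᵃ f (seq s t ^ l)     = seq (mapᵃ f s) (mapᵃ f t) ^ f l
    mapᵃ f (case τ s rs ^ l) = case τ (mapᵃ f s) (mapAltsᵃ f rs) ^ f l

    mapsᵃ : (A → B) → Vec (Exp A n) k → Vec (Exp B n) k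
    mapsᵃ f []       = []
    mapsᵃ f (s ∷ ss) = mapᵃ f s ∷ mapsᵃ f ss

    mapAltsᵃ : (A → B) → Alts A n as → Alts B n as
    mapAltsᵃ f []       = []
    mapAltsᵃ f (r ∷ rs) = mapᵃ f r ∷ mapAltsᵃ f rs

  erase : Exp A n → E n
  erase = mapᵃ (λ _ → tt)

  liftʳ : ∀ k → (Fin n → Fin m) → Fin (k + n) → Fin (k + m)
  liftʳ {n} {m} k ρ = join k m ∘ map₂ ρ ∘ splitAt k

  mutual
    ren : (Fin n → Fin m) → Exp A n → Exp A m
    ren ρ (var x ^ l)           = var (ρ x) ^ l
    ren ρ (app s t ^ l)         = app (ren ρ s) (ren ρ t) ^ l
    ren ρ (lam s ^ l)           = lam (ren (liftʳ 1 ρ) s) ^ l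
    ren ρ (letrec {k} bs t ^ l) = letrec (rens (liftʳ (suc k) ρ) bs) (ren (liftʳ (suc k) ρ) t) ^ l
    ren ρ (con τ i ss ^ l)      = con τ i (rens ρ ss) ^ l
    ren ρ (seq s t ^ l)         = seq (ren ρ s) (ren ρ t) ^ l
    ren ρ (case τ s rs ^ l)     = case τ (ren ρ s) (renAlts ρ rs) ^ l

    rens : (Fin n → Fin m) → Vec (Exp A n) k → Vec (Exp A m) k
    rens ρ []       = []
    rens ρ (s ∷ ss) = ren ρ s ∷ rens ρ ss

    renAlts : (Fin n → Fin m) → Alts A n as → Alts A m as
    renAlts ρ []                 = []
    renAlts ρ (_∷_ {x = a} r rs) = ren (liftʳ a ρ) r ∷ renAlts ρ rs

  liftˢ : ∀ k → (Fin n → E m) → Fin (k + n) → E (k + m)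
  liftˢ {n} {m} k σ = [ (λ i → var (i ↑ˡ m) ^ tt) , ren (k ↑ʳ_) ∘ σ ]′ ∘ splitAt k

  mutual
    sub : (Fin n → E m) → E n → E m
    sub σ (var x ^ _)           = σ x
    sub σ (app s t ^ l)         = app (sub σ s) (sub σ t) ^ l
    sub σ (lam s ^ l)           = lam (sub (liftˢ 1 σ) s) ^ l
    sub σ (letrec {k} bs t ^ l) = letrec (subs (liftˢ (suc k) σ) bs) (sub (liftˢ (suc k) σ) t) ^ l
    sub σ (con τ i ss ^ l)      = con τ i (subs σ ss) ^ l
    sub σ (seq s t ^ l)         = seq (sub σ s) (sub σ t) ^ l
    sub σ (case τ s rs ^ l)     = case τ (sub σ s) (subAlts σ rs) ^ l

    subs : (Fin n → E m) → Vec (E n) k → Vec (E m) k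
    subs σ []       = []
    subs σ (s ∷ ss) = sub σ s ∷ subs σ ss

    subAlts : (Fin n → E m) → Alts ⊤ n as → Alts ⊤ m as
    subAlts σ []                 = []
    subAlts σ (_∷_ {x = a} r rs) = sub (liftˢ a σ) r ∷ subAlts σ rs

  -- t[s₁/x₁,…,s_k/x_k], where x₁,…,x_k are the k innermost variables of t.
  instantiate : Vec (E n) k → E (k + n) → E n
  instantiate {k = k} ss = sub ([ lookup ss , (λ x → var x ^ tt) ]′ ∘ splitAt k)

  -- Ctx A m n: root in scope n, hole in scope m.  The m variables visible at
  -- the hole include those bound by the context on the way, so filling captures.
  mutual
    data Ctx (A : Set) (m : ℕ) : ℕ → Set where
      [·] : Ctx A m m
      _^_ : CNode A m n → A → Ctx A m n

    data CNode (A : Set) (m : ℕ) : ℕ → Set where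
      app₁     : Ctx A m n → Exp A n → CNode A m n
      app₂     : Exp A n → Ctx A m n → CNode A m n
      lam      : Ctx A m (suc n) → CNode A m n
      letrec-e : VecCtx A m (suc k + n) (suc k) → Exp A (suc k + n) → CNode A m n
      letrec-i : Vec (Exp A (suc k + n)) (suc k) → Ctx A m (suc k + n) → CNode A m n
      con      : ∀ τ (i : Fin ∣ τ ∣) → VecCtx A m n (lookup (ar τ) i) → CNode A m n
      seq₁     : Ctx A m n → Exp A n → CNode A m n
      seq₂     : Exp A n → Ctx A m n → CNode A m n
      case     : ∀ τ → Ctx A m n → Alts A n (ar τ) → CNode A m n
      alt      : ∀ τ → Exp A n → AltsCtx A m n (ar τ) → CNode A m n

    data VecCtx (A : Set) (m : ℕ) : ℕ → ℕ → Set where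
      here  : Ctx A m n → Vec (Exp A n) k → VecCtx A m n (suc k)
      there : Exp A n → VecCtx A m n k → VecCtx A m n (suc k)

    data AltsCtx (A : Set) (m : ℕ) : ℕ → Vec ℕ k → Set where
      here  : Ctx A m (a + n) → Alts A n as → AltsCtx A m n (a ∷ as)
      there : Exp A (a + n) → AltsCtx A m n as → AltsCtx A m n (a ∷ as)

  infix 9 _⟦_⟧

  mutual
    _⟦_⟧ : Ctx A m n → Exp A m → Exp A n
    [·] ⟦ u ⟧     = u
    (c ^ l) ⟦ u ⟧ = plug c u ^ l

    plug : CNode A m n → Exp A m → Node A n
    plug (app₁ C t)      u = app (C ⟦ u ⟧) t
    plug (app₂ s C)      u = app s (C ⟦ u ⟧)
    plug (lam C)         u = lam (C ⟦ u ⟧)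
    plug (letrec-e Cs t) u = letrec (plugs Cs u) t
    plug (letrec-i bs C) u = letrec bs (C ⟦ u ⟧)
    plug (con τ i Cs)    u = con τ i (plugs Cs u)
    plug (seq₁ C t)      u = seq (C ⟦ u ⟧) t
    plug (seq₂ s C)      u = seq s (C ⟦ u ⟧)
    plug (case τ C rs)   u = case τ (C ⟦ u ⟧) rs
    plug (alt τ s Cs)    u = case τ s (plugAlts Cs u)

    plugs : VecCtx A m n k → Exp A m → Vec (Exp A n) k
    plugs (here C ss)  u = C ⟦ u ⟧ ∷ ss
    plugs (there s Cs) u = s ∷ plugs Cs u

    plugAlts : AltsCtx A m n as → Exp A m → Alts A n as
    plugAlts (here C rs)  u = C ⟦ u ⟧ ∷ rs
    plugAlts (there r Cs) u = r ∷ plugAlts Cs u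

  -- The variable x of the root scope, as seen from the hole.
  mutual
    wk : Ctx A m n → Fin n → Fin m
    wk [·]     x = x
    wk (c ^ _) x = wkNode c x

    wkNode : CNode A m n → Fin n → Fin m
    wkNode (app₁ C _)             x = wk C x
    wkNode (app₂ _ C)             x = wk C x
    wkNode (lam C)                x = wk C (suc x)
    wkNode (letrec-e {k = k} Cs _) x = wkVec Cs (suc k ↑ʳ x)
    wkNode (letrec-i {k = k} _ C) x = wk C (suc k ↑ʳ x)
    wkNode (con _ _ Cs)           x = wkVec Cs x
    wkNode (seq₁ C _)             x = wk C x
    wkNode (seq₂ _ C)             x = wk C x
    wkNode (case _ C _)           x = wk C x
    wkNode (alt _ _ Cs)           x = wkAlts Cs x

    wkVec : VecCtx A m n k → Fin n → Fin m
    wkVec (here C _)   x = wk C x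
    wkVec (there _ Cs) x = wkVec Cs x

    wkAlts : AltsCtx A m n as → Fin n → Fin m
    wkAlts (here {a = a} C _) x = wk C (a ↑ʳ x)
    wkAlts (there _ Cs)       x = wkAlts Cs x

  data Value {A : Set} {n : ℕ} : Exp A n → Set where
    lam : ∀ {s l} → Value (lam s ^ l)
    con : ∀ {τ i ss l} → Value (con τ i ss ^ l)

  -- Chain P bs x₁ xₘ: bs contains bindings x₂ = x₁, …, xₘ = xₘ₋₁, and all of
  -- x₁,…,xₘ satisfy P.  (P excludes the variable y of a further displayed
  -- binding y = C[xₘ].)
  data Chain {A : Set} {k n : ℕ} (P : Fin k → Set) (bs : Vec (Exp A (k + n)) k)
             (x₁ : Fin k) : Fin k → Set where
    start : P x₁ → Chain P bs x₁ x₁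
    link  : ∀ {x y l} → Chain P bs x₁ x → P y → lookup bs y ≡ var (x ↑ˡ n) ^ l →
            Chain P bs x₁ y

  -- Merging a group of a bindings, whose scope is a + (k + n), into an enclosing
  -- group of k bindings, whose scope is k + n: the joint group lists the
  -- enclosing bindings first.
  outer : ∀ k a → Fin (k + n) → Fin ((k + a) + n)
  outer {n} k a = [ (λ i → (i ↑ˡ a) ↑ˡ n) , (k + a) ↑ʳ_ ]′ ∘ splitAt k

  added : ∀ k a → Fin a → Fin ((k + a) + n)
  added {n} k a j = (k ↑ʳ j) ↑ˡ n

  inner : ∀ k a → Fin (a + (k + n)) → Fin ((k + a) + n)
  inner k a = [ added k a , outer k a ]′ ∘ splitAt a

  data Label : Set where
    ∅ S T V W : Label

  -- The algorithm never puts two labels on one subexpression (a second visit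
  -- to a binding fails), so an optional label suffices; ∅ is its absence.
  LExp : ℕ → Set
  LExp = Exp Label

  LCtx : ℕ → ℕ → Set
  LCtx = Ctx Label

  infix 4 _▷_ _⇝_ _↦_ _⟶LR_ _⟶name_ _↓LR _↓name _≤LR_ _≤name_

  -- A label written as a variable is arbitrary: the rule displays none there.
  data _▷_ {n : ℕ} : LExp n → LExp n → Set where
    letrec-T : ∀ {k} {bs : Vec _ (suc k)} {e l} →
               letrec bs (e ^ l) ^ T ▷ letrec bs (e ^ S) ^ V
    app-ST   : ∀ {e l t l′} → l′ ≡ S ⊎ l′ ≡ T →
               app (e ^ l) t ^ l′ ▷ app (e ^ S) t ^ V
    seq-ST   : ∀ {e l t l′} → l′ ≡ S ⊎ l′ ≡ T →
               seq (e ^ l) t ^ l′ ▷ seq (e ^ S) t ^ V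
    case-ST  : ∀ {τ e l rs l′} → l′ ≡ S ⊎ l′ ≡ T →
               case τ (e ^ l) rs ^ l′ ▷ case τ (e ^ S) rs ^ V
    var-in   : ∀ {k m} {bs : Vec _ (suc k)} (C : LCtx m (suc k + n)) {x e l l′} →
               lookup bs x ≡ e ^ l →
               letrec bs (C ⟦ var (wk C (x ↑ˡ n)) ^ S ⟧) ^ l′ ▷
               letrec (bs [ x ]≔ e ^ S) (C ⟦ var (wk C (x ↑ˡ n)) ^ V ⟧) ^ l′
    -- the context is nonempty: C[x] ≠ x
    var-e    : ∀ {k m} {bs : Vec _ (suc k)} (c : CNode Label m (suc k + n)) {c-lab}
               (let C = c ^ c-lab) {x y e l t l′} → x ≢ y →
               lookup bs x ≡ e ^ l →
               lookup bs y ≡ C ⟦ var (wk C (x ↑ˡ n)) ^ S ⟧ →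
               letrec bs t ^ l′ ▷
               letrec ((bs [ x ]≔ e ^ S) [ y ]≔ C ⟦ var (wk C (x ↑ˡ n)) ^ V ⟧) t ^ l′
    var-var  : ∀ {k} {bs : Vec _ (suc k)} {x y e l t l′} → x ≢ y →
               lookup bs x ≡ e ^ l →
               lookup bs y ≡ var (x ↑ˡ n) ^ S →
               letrec bs t ^ l′ ▷
               letrec ((bs [ x ]≔ e ^ S) [ y ]≔ var (x ↑ˡ n) ^ W) t ^ l′

  data FailRule {n : ℕ} : LExp n → Set where
    visited : ∀ {k m} {bs : Vec _ (suc k)} (C : LCtx m (suc k + n)) {x y e l t l′} →
              x ≢ y → l ≡ V ⊎ l ≡ W →
              lookup bs x ≡ e ^ l →
              lookup bs y ≡ C ⟦ var (wk C (x ↑ˡ n)) ^ S ⟧ →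
              FailRule (letrec bs t ^ l′)
    self    : ∀ {k m} {bs : Vec _ (suc k)} (C : LCtx m (suc k + n)) {x t l′} →
              lookup bs x ≡ C ⟦ var (wk C (x ↑ˡ n)) ^ S ⟧ →
              FailRule (letrec bs t ^ l′)

  data _⇝_ {n : ℕ} : LExp n → LExp n → Set where
    inside : ∀ {m} (D : LCtx m n) {s t} → s ▷ t → D ⟦ s ⟧ ⇝ D ⟦ t ⟧

  data Fails {n : ℕ} : LExp n → Set where
    inside : ∀ {m} (D : LCtx m n) {s} → FailRule s → Fails (D ⟦ s ⟧)

  -- s^T with no other labels.
  initial : E n → LExp n
  initial s with mapᵃ (λ _ → ∅) s
  ... | e ^ _ = e ^ T

  -- Exhaustive labelling of s ends in l without failing.
  Labelling : E n → LExp n → Set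
  Labelling s l =
    Star (λ l₁ l₂ → ¬ Fails l₁ × l₁ ⇝ l₂) (initial s) l × ¬ Fails l × (∀ l′ → ¬ l ⇝ l′)

  -- letrec y₁ = s₁,…,y_k = s_k in t, or just t if k = 0.
  bind : Vec (LExp n) k → LExp (k + n) → LExp n
  bind {k = zero}  []       t = t
  bind {k = suc k} (s ∷ ss) t = letrec (rens (suc k ↑ʳ_) (s ∷ ss)) t ^ ∅

  data _↦_ {n : ℕ} : LExp n → LExp n → Set where
    lbeta   : ∀ {m} (C : LCtx m n) {s t l} →
              C ⟦ app (lam s ^ S) t ^ l ⟧ ↦ C ⟦ letrec (ren suc t ∷ []) s ^ ∅ ⟧

    cp-in   : ∀ {k m} {bs : Vec _ (suc k)} (C : LCtx m (suc k + n)) {x₁ xₘ s l} →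
              lookup bs x₁ ≡ lam s ^ S → Chain (λ _ → ⊤) bs x₁ xₘ →
              letrec bs (C ⟦ var (wk C (xₘ ↑ˡ n)) ^ V ⟧) ^ l ↦
              letrec bs (C ⟦ ren (wk C) (lam s ^ ∅) ⟧) ^ l
    cp-e    : ∀ {k m} {bs : Vec _ (suc k)} (C : LCtx m (suc k + n)) {x₁ xₘ y s t l} →
              lookup bs x₁ ≡ lam s ^ S → Chain (_≢ y) bs x₁ xₘ →
              lookup bs y ≡ C ⟦ var (wk C (xₘ ↑ˡ n)) ^ V ⟧ →
              letrec bs t ^ l ↦
              letrec (bs [ y ]≔ C ⟦ ren (wk C) (lam s ^ ∅) ⟧) t ^ l

    lapp    : ∀ {m k} (C : LCtx m n) {bs : Vec _ (suc k)} {s t l} →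
              C ⟦ app (letrec bs s ^ S) t ^ l ⟧ ↦
              C ⟦ letrec bs (app s (ren (suc k ↑ʳ_) t) ^ ∅) ^ ∅ ⟧
    lcase   : ∀ {m k} (C : LCtx m n) {bs : Vec _ (suc k)} {τ s rs l} →
              C ⟦ case τ (letrec bs s ^ S) rs ^ l ⟧ ↦
              C ⟦ letrec bs (case τ s (renAlts (suc k ↑ʳ_) rs) ^ ∅) ^ ∅ ⟧
    lseq    : ∀ {m k} (C : LCtx m n) {bs : Vec _ (suc k)} {s t l} →
              C ⟦ seq (letrec bs s ^ S) t ^ l ⟧ ↦
              C ⟦ letrec bs (seq s (ren (suc k ↑ʳ_) t) ^ ∅) ^ ∅ ⟧

    llet-in : ∀ {k a} {bs₁ : Vec _ (suc k)} {bs₂ : Vec _ (suc a)} {s l} →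
              letrec bs₁ (letrec bs₂ s ^ S) ^ l ↦
              letrec (rens (outer (suc k) (suc a)) bs₁ ++ rens (inner (suc k) (suc a)) bs₂)
                     (ren (inner (suc k) (suc a)) s) ^ l
    llet-e  : ∀ {k a} {bs₁ : Vec _ (suc k)} {bs₂ : Vec _ (suc a)} {x s t l} →
              lookup bs₁ x ≡ letrec bs₂ s ^ S →
              letrec bs₁ t ^ l ↦
              letrec ((rens (outer (suc k) (suc a)) bs₁ [ x ]≔ ren (inner (suc k) (suc a)) s)
                      ++ rens (inner (suc k) (suc a)) bs₂)
                     (ren (outer (suc k) (suc a)) t) ^ l

    seq-c   : ∀ {m} (C : LCtx m n) {e s l} → Value (e ^ S) →
              C ⟦ seq (e ^ S) s ^ l ⟧ ↦ C ⟦ s ⟧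
    seq-in  : ∀ {k m} {bs : Vec _ (suc k)} (C : LCtx m (suc k + n)) {x₁ xₘ τ i ss s l l′} →
              lookup bs x₁ ≡ con τ i ss ^ S → Chain (λ _ → ⊤) bs x₁ xₘ →
              letrec bs (C ⟦ seq (var (wk C (xₘ ↑ˡ n)) ^ V) s ^ l ⟧) ^ l′ ↦
              letrec bs (C ⟦ s ⟧) ^ l′
    seq-e   : ∀ {k m} {bs : Vec _ (suc k)} (C : LCtx m (suc k + n)) {x₁ xₘ y τ i ss s t l l′} →
              lookup bs x₁ ≡ con τ i ss ^ S → Chain (_≢ y) bs x₁ xₘ →
              lookup bs y ≡ C ⟦ seq (var (wk C (xₘ ↑ˡ n)) ^ V) s ^ l ⟧ →
              letrec bs t ^ l′ ↦ letrec (bs [ y ]≔ C ⟦ s ⟧) t ^ l′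

    case-c  : ∀ {m} (C : LCtx m n) {τ i ss rs l} →
              C ⟦ case τ (con τ i ss ^ S) rs ^ l ⟧ ↦ C ⟦ bind ss (lookup⁺ rs i) ⟧
    -- In case-in and case-e the fresh y₁,…,y_a are put in scope first: the
    -- redex is decomposed after weakening it along outer, so that C may
    -- mention them.  For a = 0 no binding is added and bind is trivial.
    case-in : ∀ {k m} {bs : Vec _ (suc k)} {t x₁ xₘ τ i l l′} →
              (let a = lookup (ar τ) i; w = outer (suc k) a; y = added (suc k) a)
              {ss : Vec _ a} (C : LCtx m ((suc k + a) + n)) {rs : Alts _ _ (ar τ)} →
              lookup bs x₁ ≡ con τ i ss ^ S → Chain (λ _ → ⊤) bs x₁ xₘ →
              ren w t ≡ C ⟦ case τ (var (wk C (w (xₘ ↑ˡ n))) ^ V) rs ^ l ⟧ →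
              letrec bs t ^ l′ ↦
              letrec ((rens w bs [ x₁ ]≔ con τ i (tabulate (λ j → var (y j) ^ ∅)) ^ ∅)
                      ++ rens w ss)
                     (C ⟦ bind (tabulate (λ j → var (wk C (y j)) ^ ∅)) (lookup⁺ rs i) ⟧) ^ l′
    case-e  : ∀ {k m} {bs : Vec _ (suc k)} {t x₁ xₘ u τ i l l′} →
              (let a = lookup (ar τ) i; w = outer (suc k) a; y = added (suc k) a)
              {ss : Vec _ a} (C : LCtx m ((suc k + a) + n)) {rs : Alts _ _ (ar τ)} →
              lookup bs x₁ ≡ con τ i ss ^ S → Chain (_≢ u) bs x₁ xₘ →
              ren w (lookup bs u) ≡ C ⟦ case τ (var (wk C (w (xₘ ↑ˡ n))) ^ V) rs ^ l ⟧ →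
              letrec bs t ^ l′ ↦
              letrec (((rens w bs [ x₁ ]≔ con τ i (tabulate (λ j → var (y j) ^ ∅)) ^ ∅)
                       [ u ]≔ C ⟦ bind (tabulate (λ j → var (wk C (y j)) ^ ∅)) (lookup⁺ rs i) ⟧)
                      ++ rens w ss)
                     (ren w t) ^ l′

  data _⟶LR_ {n : ℕ} (s : E n) : E n → Set where
    step : ∀ {l l′} → Labelling s l → l ↦ l′ → s ⟶LR erase l′

  data AnswerLR {n : ℕ} : E n → Set where
    value      : ∀ {s} → Value s → AnswerLR s
    letrec-val : ∀ {k} {bs : Vec _ (suc k)} {s l} → Value s → AnswerLR (letrec bs s ^ l)
    letrec-con : ∀ {k} {bs : Vec _ (suc k)} {x₁ xₘ τ i ss l l′ l″} →
                 lookup bs x₁ ≡ con τ i ss ^ l → Chain (λ _ → ⊤) bs x₁ xₘ →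
                 AnswerLR (letrec bs (var (xₘ ↑ˡ n) ^ l′) ^ l″)

  data IsL {m : ℕ} : ∀ {n} → Ctx ⊤ m n → Set where
    [·]    : IsL [·]
    letrec : ∀ {k n} {bs : Vec _ (suc k)} {L : Ctx ⊤ m (suc k + n)} {l} →
             IsL L → IsL (letrec-i bs L ^ l)

  data IsA {m : ℕ} : ∀ {n} → Ctx ⊤ m n → Set where
    [·]  : IsA [·]
    app  : ∀ {n} {C : Ctx ⊤ m n} {s l} → IsA C → IsA (app₁ C s ^ l)
    case : ∀ {n} {C : Ctx ⊤ m n} {τ rs l} → IsA C → IsA (case τ C rs ^ l)
    seq  : ∀ {n} {C : Ctx ⊤ m n} {s l} → IsA C → IsA (seq₁ C s ^ l)

  -- L[A], by recursion on L.
  data IsR {m : ℕ} : ∀ {n} → Ctx ⊤ m n → Set where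
    A-ctx  : ∀ {n} {C : Ctx ⊤ m n} → IsA C → IsR C
    letrec : ∀ {k n} {bs : Vec _ (suc k)} {R : Ctx ⊤ m (suc k + n)} {l} →
             IsR R → IsR (letrec-i bs R ^ l)

  data _⟶name_ {n : ℕ} : E n → E n → Set where
    beta  : ∀ {m} {R : Ctx ⊤ m n} {s t l l′} → IsR R →
            R ⟦ app (lam s ^ l) t ^ l′ ⟧ ⟶name R ⟦ instantiate (t ∷ []) s ⟧
    gcp   : ∀ {m m′ k} {L : Ctx ⊤ m n} {bs : Vec _ (suc k)} {R : Ctx ⊤ m′ (suc k + m)} {x l l′} →
            IsL L → IsR R →
            L ⟦ letrec bs (R ⟦ var (wk R (x ↑ˡ m)) ^ l ⟧) ^ l′ ⟧ ⟶name
            L ⟦ letrec bs (R ⟦ ren (wk R) (lookup bs x) ⟧) ^ l′ ⟧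
    lapp  : ∀ {m k} {R : Ctx ⊤ m n} {bs : Vec _ (suc k)} {s t l l′} → IsR R →
            R ⟦ app (letrec bs s ^ l) t ^ l′ ⟧ ⟶name
            R ⟦ letrec bs (app s (ren (suc k ↑ʳ_) t) ^ tt) ^ tt ⟧
    lcase : ∀ {m k} {R : Ctx ⊤ m n} {bs : Vec _ (suc k)} {τ s rs l l′} → IsR R →
            R ⟦ case τ (letrec bs s ^ l) rs ^ l′ ⟧ ⟶name
            R ⟦ letrec bs (case τ s (renAlts (suc k ↑ʳ_) rs) ^ tt) ^ tt ⟧
    lseq  : ∀ {m k} {R : Ctx ⊤ m n} {bs : Vec _ (suc k)} {s t l l′} → IsR R →
            R ⟦ seq (letrec bs s ^ l) t ^ l′ ⟧ ⟶name
            R ⟦ letrec bs (seq s (ren (suc k ↑ʳ_) t) ^ tt) ^ tt ⟧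
    seq   : ∀ {m} {R : Ctx ⊤ m n} {v s l} → IsR R → Value v →
            R ⟦ seq v s ^ l ⟧ ⟶name R ⟦ s ⟧
    case  : ∀ {m} {R : Ctx ⊤ m n} {τ i ss rs l l′} → IsR R →
            R ⟦ case τ (con τ i ss ^ l) rs ^ l′ ⟧ ⟶name
            R ⟦ instantiate ss (lookup⁺ rs i) ⟧

  data AnswerName {n : ℕ} : E n → Set where
    answer : ∀ {m} {L : Ctx ⊤ m n} {v} → IsL L → Value v → AnswerName (L ⟦ v ⟧)

  _↓LR : E n → Set
  s ↓LR = ∃[ v ] Star _⟶LR_ s v × AnswerLR v

  _↓name : E n → Set
  s ↓name = ∃[ v ] Star _⟶name_ s v × AnswerName v

  -- With named variables, the hole of a context for expressions over m free
  -- variables may lie under arbitrary further binders, and the context decides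
  -- which of the m variables are bound and by which binder; distinct names
  -- stay distinct.  Here this choice is the injection ρ of the m variables
  -- into the scope of the hole.
  ContextualPreorder : (∀ {n} → E n → Set) → E m → E m → Set
  ContextualPreorder {m} Conv s t =
    ∀ {h n} (ρ : Fin m → Fin h) → Injective _≡_ _≡_ ρ → (C : Ctx ⊤ h n) →
    Conv (C ⟦ ren ρ s ⟧) → Conv (C ⟦ ren ρ t ⟧)

  _≤LR_ : E m → E m → Set
  _≤LR_ = ContextualPreorder _↓LR

  _≤name_ : E m → E m → Set
  _≤name_ = ContextualPreorder _↓name

  W⟦_⟧ : E n → E n
  W⟦ s ⟧ = s

{-# OPTIONS --safe #-}
module Submission where

-- Both calculi are compared with a graph model, in which ⟪ s ⟫ ρ τ p says that s has the finite
-- type τ at cost at most p.  Every app, seq and case costs b and every look-up of a letrec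
-- variable costs c.  A function type records the costs of the argument and of the result, so a
-- variable that is used often is paid for at each use and no linearity is needed.
--
-- At b = c = 0 every type of the result of a reduction step, of either calculus and in any
-- context, is a type of its source, and answers have the type ⋆; so convergent expressions have
-- type ⋆ when the free variables have no type at all.  A logical relation between the models
-- carries a type at zero charges over to arbitrary charges.  Conversely, expressions of type ⋆
-- converge: at b = c = 1 every call-by-name step, and at b = 1, c = 0 every call-by-need step,
-- lowers the lexicographic pair of the cost and a syntactic weight.  For call-by-need, a shared
-- redex becomes cheaper in all of its uses, at least one of which is on the path of demands that
-- the labelling follows; this path has no cycle, because a variable demanding itself has no type.

open import Defs using (Signature; module Calculus)
open import Data.Empty using (⊥; ⊥-elim)
open import Data.Fin using (Fin; zero; suc; _↑ˡ_; _↑ʳ_; splitAt; _≟_)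
open import Data.Fin.Properties
  using (splitAt-↑ˡ; splitAt-↑ʳ; splitAt-join; splitAt⁻¹-↑ˡ; splitAt⁻¹-↑ʳ; ↑ˡ-injective)
open import Data.List using (List; []; _∷_; _++_)
open import Data.List.Membership.Propositional using (_∈_)
open import Data.List.Membership.Propositional.Properties using (∈-++⁺ˡ; ∈-++⁺ʳ; ∈-++⁻)
open import Data.List.Relation.Unary.Any using (here; there)
open import Data.Nat using (ℕ; zero; suc; _+_; _≤_; _<_; z≤n; s≤s)
open import Data.Nat.Induction using (<-wellFounded)
open import Data.Nat.Properties hiding (_≟_)
open import Data.Nat.Solver using (module +-*-Solver)
open import Data.Product using (Σ; ∃; _×_; _,_; proj₁; proj₂)
open import Data.Sum using (_⊎_; inj₁; inj₂; [_,_]′; map₂)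
open import Data.Unit using (⊤; tt)
open import Data.Vec using (Vec; []; _∷_; lookup; tabulate; _[_]≔_) renaming (_++_ to _++ᵛ_)
open import Data.Vec.Properties
  using (lookup∘update; lookup∘update′; lookup-++ˡ; lookup-++ʳ; lookup∘tabulate; []≔-commutes; []≔-idempotent)
open import Data.Vec.Relation.Unary.All using ([]; _∷_)
open import Data.Vec.Relation.Unary.All.Properties using (lookup⁺)
open import Function using (_∘_; id)
open import Function.Bundles using (_⇔_; mk⇔; module Equivalence)
open import Induction.WellFounded using (Acc; acc; acc⇒asym)
open import Level using (Lift; lift)
open import Relation.Binary.Construct.Closure.ReflexiveTransitive using (Star; ε; _◅_; _◅◅_; gmap)
open import Relation.Binary.Construct.Closure.Transitive using (TransClosure; [_]; _∷_; _∷ʳ_)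
open import Relation.Binary.PropositionalEquality using (_≡_; _≢_; refl; sym; trans; cong; cong₂; subst; subst₂)
open import Relation.Nullary using (¬_; yes; no)

-- The two look-up charges answer opposite obstacles. The call-by-name rule gcp copies an arbitrary
-- right-hand side, which may be heavier than the variable it replaces, so the step can only be paid
-- for by a charged look-up. Call-by-need copies abstractions alone, of weight 0, over variables of
-- weight 1; but its rules for application and case turn arguments into bindings and add
-- indirections through fresh variables, so a charged look-up would make their results dearer. At
-- `c = 0` indirections are free, and a heap satisfies its fixed point equation with equal costs on
-- both sides.
--
-- A typing cannot simply be recomputed for other charges, because types themselves contain costs: a
-- function type valid at zero charges may demand an argument more cheaply than the new charges
-- permit. The relation between the models therefore forgets the recorded costs and lets new ones be
-- chosen whenever a finite graph is needed.
--
-- Costs are attached to typings and not to reductions. One call-by-need step on a shared redex may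
-- lower the cost by more than one, and only the existence of some drop is ever shown.

module Convergence (Sig : Signature) where
  open Signature Sig
  open Calculus Sig

  private variable
    A A′    : Set
    k m n a : ℕ

  -- The costed graph model

  -- In fun Δ τ q, the list Δ is a finite part of the graph of the argument: entries (zero , σ , p)
  -- demand that the argument have the type σ at cost p.  Then the result has the type τ at cost q.
  data Type : Set where
    ⋆   : Type
    fun : List (Fin 1 × Type × ℕ) → Type → ℕ → Type
    con : ∀ κ (i : Fin ∣ κ ∣) → List (Fin (lookup (ar κ) i) × Type × ℕ) → Type


  private variable
    τ   : Type
    p q : ℕ

  D : Set₁
  D = Type → ℕ → Set

  Env : ℕ → Set₁
  Env n = Fin n → D

  Approx : ℕ → Set
  Approx n = List (Fin n × Type × ℕ)

  ⟨_⟩ : Approx n → Env n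
  ⟨ Δ ⟩ x τ p = (x , τ , p) ∈ Δ

  infix 4 _⊆_ _⊑_

  _⊆_ : D → D → Set
  d ⊆ d′ = ∀ {τ p} → d τ p → d′ τ p

  _⊑_ : Env n → Env n → Set
  ρ ⊑ ρ′ = ∀ x → ρ x ⊆ ρ′ x

  none : Env n
  none _ _ _ = ⊥

  ext : Env k → Env n → Env (k + n)
  ext {k} φ ρ = [ φ , ρ ]′ ∘ splitAt k

  ext-↑ˡ : ∀ (φ : Env k) (ρ : Env n) i → ext φ ρ (i ↑ˡ n) ≡ φ i
  ext-↑ˡ {k} {n} φ ρ i = cong [ φ , ρ ]′ (splitAt-↑ˡ k i n)

  ext-↑ʳ : ∀ (φ : Env k) (ρ : Env n) x → ext φ ρ (k ↑ʳ x) ≡ ρ x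
  ext-↑ʳ {k} {n} φ ρ x = cong [ φ , ρ ]′ (splitAt-↑ʳ k n x)

  ext-liftʳ : ∀ (φ : Env k) (ρ : Env m) (f : Fin n → Fin m) x →
              ext φ ρ (liftʳ k f x) ≡ ext φ (ρ ∘ f) x
  ext-liftʳ {k} {m} φ ρ f x
    rewrite splitAt-join k m (map₂ f (splitAt k x)) with splitAt k x
  ... | inj₁ _ = refl
  ... | inj₂ _ = refl

  ext-elim : ∀ {ℓ} {φ : Env k} {ρ : Env n} (P : Fin (k + n) → D → Set ℓ) →
             (∀ i → P (i ↑ˡ n) (φ i)) → (∀ x → P (k ↑ʳ x) (ρ x)) → ∀ x → P x (ext φ ρ x)
  ext-elim {k = zero}  P l r x       = r x
  ext-elim {k = suc k} P l r zero    = l zero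
  ext-elim {k = suc k} {n} {φ = φ} {ρ} P l r (suc x) =
    subst (P (suc x)) (eq (splitAt k x)) (ext-elim {φ = φ ∘ suc} {ρ} (P ∘ suc) (l ∘ suc) r x)
    where
    eq : ∀ y → [ φ ∘ suc , ρ ]′ y ≡ [ φ , ρ ]′ ([ inj₁ ∘ suc , inj₂ ]′ y)
    eq (inj₁ _) = refl
    eq (inj₂ _) = refl

  ext-mono : ∀ {φ φ′ : Env k} {ρ ρ′ : Env n} → φ ⊑ φ′ → ρ ⊑ ρ′ → ext φ ρ ⊑ ext φ′ ρ′
  ext-mono {k} h h′ x with splitAt k x
  ... | inj₁ i = h i
  ... | inj₂ y = h′ y

  ⊆-≡ : ∀ {d d′ : D} → d ≡ d′ → d ⊆ d′
  ⊆-≡ refl h = h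

  module Model (b c : ℕ) where

    -- The entries of a finite environment `⟨ Δ ⟩` carry exact costs. Closing them upwards at each
    -- variable makes `up` hold for expressions in every environment.
    record Up (d : D) (τ : Type) (p : ℕ) : Set where
      constructor up-to
      field
        {p′} : ℕ
        val  : d τ p′
        le   : p′ ≤ p

    -- The derivations in `arg` contribute no summand: the body adds the recorded cost of an entry
    -- wherever it uses that entry, and this is already part of `q₂`.
    record App (d e : D) (τ : Type) (p : ℕ) : Set where
      constructor app
      field
        {Δ}   : Approx 1
        {q₁ q₂} : ℕ
        fn    : d (fun Δ τ q₂) q₁
        arg   : ⟨ Δ ⟩ ⊑ λ _ → e
        pay   : b + (q₁ + q₂) ≤ p

    data Lam (f : Env 1 → D) : D where
      ⋆   : Lam f ⋆ p
      fun : ∀ {Δ} → f ⟨ Δ ⟩ τ q → Lam f (fun Δ τ q) p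

    data Con κ i (φ : Env (lookup (ar κ) i)) : D where
      ⋆   : Con κ i φ ⋆ p
      con : ∀ {Δ} → ⟨ Δ ⟩ ⊑ φ → Con κ i φ (con κ i Δ) p

    record Seq (d e : D) (τ : Type) (p : ℕ) : Set where
      constructor seq
      field
        {q₁ q₂} : ℕ
        fst   : d ⋆ q₁
        snd   : e τ q₂
        pay   : b + (q₁ + q₂) ≤ p

    record Case κ (d : D) (f : ∀ i → Env (lookup (ar κ) i) → D) (τ : Type) (p : ℕ) : Set where
      constructor case
      field
        {i}   : Fin ∣ κ ∣
        {Δ}   : Approx (lookup (ar κ) i)
        {q₁ q₂} : ℕ
        scrut  : d (con κ i Δ) q₁
        branch : f i ⟨ Δ ⟩ τ q₂
        pay   : b + (q₁ + q₂) ≤ p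

    -- A constructor taking `F (Lfp F) i τ p` would not be strictly positive for an arbitrary `F`.
    -- Applying `F` to a finite list of entries, each derived before, gives an inductive definition;
    -- its well-founded derivations are also what excludes self-demanding variables.
    data Lfp (F : Env k → Env k) : Env k where
      fold : ∀ {i} Δ → ⟨ Δ ⟩ ⊑ Lfp F → F ⟨ Δ ⟩ i τ p → c + p ≤ q → Lfp F i τ q

    ⟪_⟫  : Exp A n → Env n → D
    ⟪_⟫s : Vec (Exp A n) k → Env n → Env k
    ⟪_⟫a : {as : Vec ℕ k} → Alts A n as → (i : Fin k) → Env (lookup as i) → Env n → D

    heap : Vec (Exp A (k + n)) k → Env n → Env (k + n)
    heap bs ρ = ext (Lfp (λ φ → ⟪ bs ⟫s (ext φ ρ))) ρ

    ⟪ var x ^ _ ⟫       ρ = Up (ρ x)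
    ⟪ app s t ^ _ ⟫     ρ = App (⟪ s ⟫ ρ) (⟪ t ⟫ ρ)
    ⟪ lam s ^ _ ⟫       ρ = Lam (λ φ → ⟪ s ⟫ (ext φ ρ))
    ⟪ letrec bs t ^ _ ⟫ ρ = ⟪ t ⟫ (ext (Lfp (λ φ → ⟪ bs ⟫s (ext φ ρ))) ρ)
    ⟪ con κ i ss ^ _ ⟫  ρ = Con κ i (⟪ ss ⟫s ρ)
    ⟪ seq s t ^ _ ⟫     ρ = Seq (⟪ s ⟫ ρ) (⟪ t ⟫ ρ)
    ⟪ case κ s rs ^ _ ⟫ ρ = Case κ (⟪ s ⟫ ρ) (λ i φ → ⟪ rs ⟫a i φ ρ)

    ⟪ s ∷ _ ⟫s  ρ zero    = ⟪ s ⟫ ρ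
    ⟪ _ ∷ ss ⟫s ρ (suc i) = ⟪ ss ⟫s ρ i

    ⟪ r ∷ _ ⟫a  zero    φ ρ = ⟪ r ⟫ (ext φ ρ)
    ⟪ _ ∷ rs ⟫a (suc i) φ ρ = ⟪ rs ⟫a i φ ρ

    ⟪⟫s-lookup : ∀ (ss : Vec (Exp A n) k) ρ i → ⟪ ss ⟫s ρ i ≡ ⟪ lookup ss i ⟫ ρ
    ⟪⟫s-lookup (_ ∷ _)  ρ zero    = refl
    ⟪⟫s-lookup (_ ∷ ss) ρ (suc i) = ⟪⟫s-lookup ss ρ i

    ⟪⟫a-lookup : ∀ {as : Vec ℕ k} (rs : Alts A n as) i φ ρ → ⟪ rs ⟫a i φ ρ ≡ ⟪ lookup⁺ rs i ⟫ (ext φ ρ)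
    ⟪⟫a-lookup (_ ∷ _)  zero    φ ρ = refl
    ⟪⟫a-lookup (_ ∷ rs) (suc i) φ ρ = ⟪⟫a-lookup rs i φ ρ

    at-≡ : ∀ {s s′ : Exp A n} ρ → s ≡ s′ → ⟪ s ⟫ ρ ⊆ ⟪ s′ ⟫ ρ
    at-≡ ρ refl h = h

    -- Monotonicity, and invariance under renaming and relabelling

    up : ∀ (s : Exp A n) {ρ} → ⟪ s ⟫ ρ τ p → p ≤ q → ⟪ s ⟫ ρ τ q
    up (var _ ^ _)       (up-to h l)    l′ = up-to h (≤-trans l l′)
    up (app _ _ ^ _)     (app h h′ l)   l′ = app h h′ (≤-trans l l′)
    up (lam _ ^ _)       ⋆              l′ = ⋆
    up (lam _ ^ _)       (fun h)        l′ = fun h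
    up (letrec _ t ^ _)  h              l′ = up t h l′
    up (con _ _ _ ^ _)   ⋆              l′ = ⋆
    up (con _ _ _ ^ _)   (con h)        l′ = con h
    up (seq _ _ ^ _)     (seq h h′ l)   l′ = seq h h′ (≤-trans l l′)
    up (case _ _ _ ^ _)  (case h h′ l)  l′ = case h h′ (≤-trans l l′)

    Up-⟪⟫ : ∀ (s : Exp A n) {ρ} → Up (⟪ s ⟫ ρ) ⊆ ⟪ s ⟫ ρ
    Up-⟪⟫ s (up-to h l) = up s h l

    Up-mono : ∀ {d d′} → d ⊆ d′ → Up d ⊆ Up d′
    Up-mono h (up-to v l) = up-to (h v) l

    App-mono : ∀ {d d′ e e′} → d ⊆ d′ → e ⊆ e′ → App d e ⊆ App d′ e′
    App-mono h h′ (app f a l) = app (h f) (λ x y → h′ (a x y)) l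

    Lam-mono : ∀ {f f′} → (∀ Δ → f ⟨ Δ ⟩ ⊆ f′ ⟨ Δ ⟩) → Lam f ⊆ Lam f′
    Lam-mono h ⋆       = ⋆
    Lam-mono h (fun f) = fun (h _ f)

    Con-mono : ∀ {κ i φ φ′} → φ ⊑ φ′ → Con κ i φ ⊆ Con κ i φ′
    Con-mono h ⋆       = ⋆
    Con-mono h (con f) = con (λ x y → h x (f x y))

    Seq-mono : ∀ {d d′ e e′} → d ⊆ d′ → e ⊆ e′ → Seq d e ⊆ Seq d′ e′
    Seq-mono h h′ (seq f a l) = seq (h f) (h′ a) l

    Case-mono : ∀ {κ d d′ f f′} → d ⊆ d′ → (∀ i Δ → f i ⟨ Δ ⟩ ⊆ f′ i ⟨ Δ ⟩) → Case κ d f ⊆ Case κ d′ f′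
    Case-mono h h′ (case s a l) = case (h s) (h′ _ _ a) l

    Lfp-mono : ∀ {F F′ : Env k → Env k} → (∀ Δ → F ⟨ Δ ⟩ ⊑ F′ ⟨ Δ ⟩) → Lfp F ⊑ Lfp F′
    Lfp-mono h _ (fold Δ f g l) = fold Δ (λ x y → Lfp-mono h x (f x y)) (h Δ _ g) l

    mono  : ∀ (s : Exp A n) {ρ ρ′} → ρ ⊑ ρ′ → ⟪ s ⟫ ρ ⊆ ⟪ s ⟫ ρ′
    monos : ∀ (ss : Vec (Exp A n) k) {ρ ρ′} → ρ ⊑ ρ′ → ⟪ ss ⟫s ρ ⊑ ⟪ ss ⟫s ρ′
    monoa : ∀ {as : Vec ℕ k} (rs : Alts A n as) i {φ φ′ ρ ρ′} → φ ⊑ φ′ → ρ ⊑ ρ′ →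
            ⟪ rs ⟫a i φ ρ ⊆ ⟪ rs ⟫a i φ′ ρ′
    mono (var x ^ _)       h = Up-mono (h x)
    mono (app s t ^ _)     h = App-mono (mono s h) (mono t h)
    mono (lam s ^ _)       h = Lam-mono λ _ → mono s (ext-mono (λ _ → id) h)
    mono (letrec bs t ^ _) h =
      mono t (ext-mono (Lfp-mono λ _ → monos bs (ext-mono (λ _ → id) h)) h)
    mono (con _ _ ss ^ _)  h = Con-mono (monos ss h)
    mono (seq s t ^ _)     h = Seq-mono (mono s h) (mono t h)
    mono (case _ s rs ^ _) h = Case-mono (mono s h) λ i _ → monoa rs i (λ _ → id) h
    monos (s ∷ _)  h zero    = mono s h
    monos (_ ∷ ss) h (suc i) = monos ss h i
    monoa (r ∷ _)  zero    h h′ = mono r (ext-mono h h′)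
    monoa (_ ∷ rs) (suc i) h h′ = monoa rs i h h′

    heap-mono : ∀ (bs : Vec (Exp A (k + n)) k) {ρ ρ′} → ρ ⊑ ρ′ → heap bs ρ ⊑ heap bs ρ′
    heap-mono bs h = ext-mono (Lfp-mono λ _ → monos bs (ext-mono (λ _ → id) h)) h

    ext-lift→ : ∀ {φ φ′ : Env k} {ρ : Env n} {ρ′ : Env m} (f : Fin n → Fin m) → φ ⊑ φ′ →
                (∀ x → ρ x ⊆ ρ′ (f x)) → ∀ x → ext φ ρ x ⊆ ext φ′ ρ′ (liftʳ k f x)
    ext-lift→ {k = k} {φ′ = φ′} {ρ′ = ρ′} f h h′ x y =
      ⊆-≡ (sym (ext-liftʳ φ′ ρ′ f x)) (ext-mono h h′ x y)

    ext-lift← : ∀ {φ φ′ : Env k} {ρ : Env n} {ρ′ : Env m} (f : Fin n → Fin m) → φ′ ⊑ φ →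
                (∀ x → ρ′ (f x) ⊆ ρ x) → ∀ x → ext φ′ ρ′ (liftʳ k f x) ⊆ ext φ ρ x
    ext-lift← {k = k} {φ′ = φ′} {ρ′ = ρ′} f h h′ x y =
      ext-mono h h′ x (⊆-≡ (ext-liftʳ φ′ ρ′ f x) y)

    -- Environments are functions that agree only pointwise. One inclusion for each direction, with
    -- an inclusion as hypothesis, avoids function extensionality and passes under binders, where
    -- the fixed points on the two sides are comparable but not literally equal.
    ren→  : ∀ (s : Exp A n) (f : Fin n → Fin m) {ρ ρ′} → (∀ x → ρ x ⊆ ρ′ (f x)) →
            ⟪ s ⟫ ρ ⊆ ⟪ ren f s ⟫ ρ′
    rens→ : ∀ (ss : Vec (Exp A n) k) (f : Fin n → Fin m) {ρ ρ′} → (∀ x → ρ x ⊆ ρ′ (f x)) →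
            ⟪ ss ⟫s ρ ⊑ ⟪ rens f ss ⟫s ρ′
    rena→ : ∀ {as : Vec ℕ k} (rs : Alts A n as) (f : Fin n → Fin m) i {φ ρ ρ′} →
            (∀ x → ρ x ⊆ ρ′ (f x)) → ⟪ rs ⟫a i φ ρ ⊆ ⟪ renAlts f rs ⟫a i φ ρ′
    ren→ (var x ^ _)       f h = Up-mono (h x)
    ren→ (app s t ^ _)     f h = App-mono (ren→ s f h) (ren→ t f h)
    ren→ (lam s ^ _)       f h = Lam-mono λ _ → ren→ s (liftʳ 1 f) (ext-lift→ f (λ _ → id) h)
    ren→ (letrec bs t ^ _) f h =
      ren→ t _ (ext-lift→ f (Lfp-mono λ _ → rens→ bs _ (ext-lift→ f (λ _ → id) h)) h)
    ren→ (con _ _ ss ^ _)  f h = Con-mono (rens→ ss f h)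
    ren→ (seq s t ^ _)     f h = Seq-mono (ren→ s f h) (ren→ t f h)
    ren→ (case _ s rs ^ _) f h = Case-mono (ren→ s f h) λ i _ → rena→ rs f i h
    rens→ (s ∷ _)  f h zero    = ren→ s f h
    rens→ (_ ∷ ss) f h (suc i) = rens→ ss f h i
    rena→ (r ∷ _)  f zero    h = ren→ r _ (ext-lift→ f (λ _ → id) h)
    rena→ (_ ∷ rs) f (suc i) h = rena→ rs f i h

    ren←  : ∀ (s : Exp A n) (f : Fin n → Fin m) {ρ ρ′} → (∀ x → ρ′ (f x) ⊆ ρ x) →
            ⟪ ren f s ⟫ ρ′ ⊆ ⟪ s ⟫ ρ
    rens← : ∀ (ss : Vec (Exp A n) k) (f : Fin n → Fin m) {ρ ρ′} → (∀ x → ρ′ (f x) ⊆ ρ x) →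
            ⟪ rens f ss ⟫s ρ′ ⊑ ⟪ ss ⟫s ρ
    rena← : ∀ {as : Vec ℕ k} (rs : Alts A n as) (f : Fin n → Fin m) i {φ ρ ρ′} →
            (∀ x → ρ′ (f x) ⊆ ρ x) → ⟪ renAlts f rs ⟫a i φ ρ′ ⊆ ⟪ rs ⟫a i φ ρ
    ren← (var x ^ _)       f h = Up-mono (h x)
    ren← (app s t ^ _)     f h = App-mono (ren← s f h) (ren← t f h)
    ren← (lam s ^ _)       f h = Lam-mono λ _ → ren← s (liftʳ 1 f) (ext-lift← f (λ _ → id) h)
    ren← (letrec bs t ^ _) f h =
      ren← t _ (ext-lift← f (Lfp-mono λ _ → rens← bs _ (ext-lift← f (λ _ → id) h)) h)
    ren← (con _ _ ss ^ _)  f h = Con-mono (rens← ss f h)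
    ren← (seq s t ^ _)     f h = Seq-mono (ren← s f h) (ren← t f h)
    ren← (case _ s rs ^ _) f h = Case-mono (ren← s f h) λ i _ → rena← rs f i h
    rens← (s ∷ _)  f h zero    = ren← s f h
    rens← (_ ∷ ss) f h (suc i) = rens← ss f h i
    rena← (r ∷ _)  f zero    h = ren← r _ (ext-lift← f (λ _ → id) h)
    rena← (_ ∷ rs) f (suc i) h = rena← rs f i h

    map→  : ∀ (f : A → A′) (s : Exp A n) {ρ ρ′} → ρ ⊑ ρ′ → ⟪ s ⟫ ρ ⊆ ⟪ mapᵃ f s ⟫ ρ′
    maps→ : ∀ (f : A → A′) (ss : Vec (Exp A n) k) {ρ ρ′} → ρ ⊑ ρ′ → ⟪ ss ⟫s ρ ⊑ ⟪ mapsᵃ f ss ⟫s ρ′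
    mapa→ : ∀ (f : A → A′) {as : Vec ℕ k} (rs : Alts A n as) i {φ ρ ρ′} → ρ ⊑ ρ′ →
            ⟪ rs ⟫a i φ ρ ⊆ ⟪ mapAltsᵃ f rs ⟫a i φ ρ′
    map→ f (var x ^ _)       h = Up-mono (h x)
    map→ f (app s t ^ _)     h = App-mono (map→ f s h) (map→ f t h)
    map→ f (lam s ^ _)       h = Lam-mono λ _ → map→ f s (ext-mono (λ _ → id) h)
    map→ f (letrec bs t ^ _) h =
      map→ f t (ext-mono (Lfp-mono λ _ → maps→ f bs (ext-mono (λ _ → id) h)) h)
    map→ f (con _ _ ss ^ _)  h = Con-mono (maps→ f ss h)
    map→ f (seq s t ^ _)     h = Seq-mono (map→ f s h) (map→ f t h)
    map→ f (case _ s rs ^ _) h = Case-mono (map→ f s h) λ i _ → mapa→ f rs i h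
    maps→ f (s ∷ _)  h zero    = map→ f s h
    maps→ f (_ ∷ ss) h (suc i) = maps→ f ss h i
    mapa→ f (r ∷ _)  zero    h = map→ f r (ext-mono (λ _ → id) h)
    mapa→ f (_ ∷ rs) (suc i) h = mapa→ f rs i h

    map←  : ∀ (f : A → A′) (s : Exp A n) {ρ ρ′} → ρ ⊑ ρ′ → ⟪ mapᵃ f s ⟫ ρ ⊆ ⟪ s ⟫ ρ′
    maps← : ∀ (f : A → A′) (ss : Vec (Exp A n) k) {ρ ρ′} → ρ ⊑ ρ′ → ⟪ mapsᵃ f ss ⟫s ρ ⊑ ⟪ ss ⟫s ρ′
    mapa← : ∀ (f : A → A′) {as : Vec ℕ k} (rs : Alts A n as) i {φ ρ ρ′} → ρ ⊑ ρ′ →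
            ⟪ mapAltsᵃ f rs ⟫a i φ ρ ⊆ ⟪ rs ⟫a i φ ρ′
    map← f (var x ^ _)       h = Up-mono (h x)
    map← f (app s t ^ _)     h = App-mono (map← f s h) (map← f t h)
    map← f (lam s ^ _)       h = Lam-mono λ _ → map← f s (ext-mono (λ _ → id) h)
    map← f (letrec bs t ^ _) h =
      map← f t (ext-mono (Lfp-mono λ _ → maps← f bs (ext-mono (λ _ → id) h)) h)
    map← f (con _ _ ss ^ _)  h = Con-mono (maps← f ss h)
    map← f (seq s t ^ _)     h = Seq-mono (map← f s h) (map← f t h)
    map← f (case _ s rs ^ _) h = Case-mono (map← f s h) λ i _ → mapa← f rs i h
    maps← f (s ∷ _)  h zero    = map← f s h
    maps← f (_ ∷ ss) h (suc i) = maps← f ss h i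
    mapa← f (r ∷ _)  zero    h = map← f r (ext-mono (λ _ → id) h)
    mapa← f (_ ∷ rs) (suc i) h = mapa← f rs i h

    -- Together with `Monotone` this is Scott continuity. It lets the dependence of a body on its
    -- argument be cut down to the finite graph in a function type, and likewise lets a recursive
    -- binding be folded.
    Compact : (Env n → D) → Set₁
    Compact F = ∀ {ρ τ p} → F ρ τ p → ∃ λ Δ → ⟨ Δ ⟩ ⊑ ρ × F ⟨ Δ ⟩ τ p

    Monotone : (Env n → D) → Set₁
    Monotone F = ∀ {ρ ρ′} → ρ ⊑ ρ′ → F ρ ⊆ F ρ′

    ++-⊑ : ∀ {Δ Δ′ : Approx n} {ρ : Env n} → ⟨ Δ ⟩ ⊑ ρ → ⟨ Δ′ ⟩ ⊑ ρ → ⟨ Δ ++ Δ′ ⟩ ⊑ ρ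
    ++-⊑ {Δ = Δ} h h′ x y with ∈-++⁻ Δ y
    ... | inj₁ z = h x z
    ... | inj₂ z = h′ x z

    ⊑-++ˡ : ∀ {Δ Δ′ : Approx n} → ⟨ Δ ⟩ ⊑ ⟨ Δ ++ Δ′ ⟩
    ⊑-++ˡ _ = ∈-++⁺ˡ

    ⊑-++ʳ : ∀ (Δ : Approx n) {Δ′} → ⟨ Δ′ ⟩ ⊑ ⟨ Δ ++ Δ′ ⟩
    ⊑-++ʳ Δ _ = ∈-++⁺ʳ Δ

    -- The hypothesis speaks only of the entries of `Δ`, so that `lfp-compact` can pass its
    -- recursive calls on the smaller derivations of exactly these entries.
    support : ∀ {Ψ : Env n → Env k} → (∀ x → Monotone (λ ρ → Ψ ρ x)) → ∀ {ρ} Δ →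
              (∀ x {τ p} → ⟨ Δ ⟩ x τ p → ∃ λ Δ′ → ⟨ Δ′ ⟩ ⊑ ρ × Ψ ⟨ Δ′ ⟩ x τ p) →
              ∃ λ Δ′ → ⟨ Δ′ ⟩ ⊑ ρ × ⟨ Δ ⟩ ⊑ Ψ ⟨ Δ′ ⟩
    support mon []      h = [] , (λ _ ()) , λ _ ()
    support mon (z ∷ Δ) h with h _ (here refl) | support mon Δ (λ x y → h x (there y))
    ... | Δ₁ , h₁ , g₁ | Δ₂ , h₂ , g₂ = Δ₁ ++ Δ₂ , ++-⊑ h₁ h₂ , λ where
      x (here refl) → mon _ (⊑-++ˡ {Δ = Δ₁}) g₁
      x (there y)   → mon _ (⊑-++ʳ Δ₁) (g₂ x y)

    compact-⊑ : ∀ {Ψ : Env n → Env k} → (∀ x → Monotone (λ ρ → Ψ ρ x)) → (∀ x → Compact (λ ρ → Ψ ρ x)) →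
                ∀ {ρ} Δ → ⟨ Δ ⟩ ⊑ Ψ ρ → ∃ λ Δ′ → ⟨ Δ′ ⟩ ⊑ ρ × ⟨ Δ ⟩ ⊑ Ψ ⟨ Δ′ ⟩
    compact-⊑ mon com Δ h = support mon Δ λ x y → com x (h x y)

    compact-∘ : ∀ {Ψ : Env n → Env k} {F : Env k → D} → Monotone F → Compact F →
                (∀ x → Monotone (λ ρ → Ψ ρ x)) → (∀ x → Compact (λ ρ → Ψ ρ x)) →
                Compact (λ ρ → F (Ψ ρ))
    compact-∘ mon com mon′ com′ h with com h
    ... | Δ , g , h′ with compact-⊑ mon′ com′ Δ g
    ... | Δ′ , g′ , g″ = Δ′ , g′ , mon g″ h′

    ext-mono₂ : ∀ {Ψ : Env n → Env k} → (∀ x → Monotone (λ ρ → Ψ ρ x)) →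
                ∀ x → Monotone (λ ρ → ext (Ψ ρ) ρ x)
    ext-mono₂ mon x h = ext-mono (λ i → mon i h) h x

    ext-compact : ∀ {Ψ : Env n → Env k} → (∀ x → Compact (λ ρ → Ψ ρ x)) →
                  ∀ x → Compact (λ ρ → ext (Ψ ρ) ρ x)
    ext-compact {k = k} com x h with splitAt k x
    ... | inj₁ i = com i h
    ... | inj₂ y = (y , _ , _) ∷ [] , (λ { _ (here refl) → h }) , here refl

    lfp-compact : ∀ {F : Env n → Env k → Env k} → (∀ φ x → Monotone (λ ρ → F ρ φ x)) →
                  (∀ φ x → Compact (λ ρ → F ρ φ x)) → ∀ x → Compact (λ ρ → Lfp (F ρ) x)
    lfp-compact {F = F} mon com x (fold Δ f g l) with com ⟨ Δ ⟩ x g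
    ... | Δ₁ , h₁ , g₁ =
        let Δ₂ , h₂ , g₂ = support mon′ Δ (λ y z → lfp-compact mon com y (f y z))
        in  Δ₁ ++ Δ₂ , ++-⊑ h₁ h₂ ,
            fold Δ (λ y z → mon′ y (⊑-++ʳ Δ₁) (g₂ y z)) (mon _ _ (⊑-++ˡ {Δ = Δ₁}) g₁) l
      where
      mon′ : ∀ x → Monotone (λ ρ → Lfp (F ρ) x)
      mon′ x h = Lfp-mono (λ Δ i → mon _ i h) x

    compact  : ∀ (s : Exp A n) → Compact ⟪ s ⟫
    compact-under : ∀ (s : Exp A (k + n)) {φ : Env k} → Compact (λ ρ → ⟪ s ⟫ (ext φ ρ))
    compacts-under : ∀ (ss : Vec (Exp A (k + n)) a) (φ : Env k) i → Compact (λ ρ → ⟪ ss ⟫s (ext φ ρ) i)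
    compacts : ∀ (ss : Vec (Exp A n) k) i → Compact (λ ρ → ⟪ ss ⟫s ρ i)
    compacta : ∀ {as : Vec ℕ k} (rs : Alts A n as) i φ → Compact (⟪ rs ⟫a i φ)
    compact (var x ^ _) (up-to v l) = (x , _ , _) ∷ [] , (λ { _ (here refl) → v }) , up-to (here refl) l
    compact (app s t ^ _) (app {Δ} f a l) with compact s f | compact-⊑ (λ _ → mono t) (λ _ → compact t) Δ a
    ... | Δ₁ , h₁ , g₁ | Δ₂ , h₂ , g₂ =
      Δ₁ ++ Δ₂ , ++-⊑ h₁ h₂ , app (mono s (⊑-++ˡ {Δ = Δ₁}) g₁) (λ x y → mono t (⊑-++ʳ Δ₁) (g₂ x y)) l
    compact (lam s ^ _) ⋆ = [] , (λ _ ()) , ⋆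
    compact (lam s ^ _) (fun f) with compact-under s f
    ... | Δ , h , g = Δ , h , fun g
    compact (letrec bs t ^ _) =
      compact-∘ (mono t) (compact t)
        (λ x h → heap-mono bs h x)
        (ext-compact (lfp-compact (λ _ i h → monos bs (ext-mono (λ _ → id) h) i) (compacts-under bs)))
    compact (con κ i ss ^ _) ⋆ = [] , (λ _ ()) , ⋆
    compact (con κ i ss ^ _) (con {Δ = Δ} f) with compact-⊑ (λ i h → monos ss h i) (compacts ss) Δ f
    ... | Δ₁ , h₁ , g₁ = Δ₁ , h₁ , con g₁
    compact (seq s t ^ _) (seq f a l) with compact s f | compact t a
    ... | Δ₁ , h₁ , g₁ | Δ₂ , h₂ , g₂ =
      Δ₁ ++ Δ₂ , ++-⊑ h₁ h₂ , seq (mono s (⊑-++ˡ {Δ = Δ₁}) g₁) (mono t (⊑-++ʳ Δ₁) g₂) l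
    compact (case κ s rs ^ _) (case {i} {Δ} f a l) with compact s f | compacta rs i ⟨ Δ ⟩ a
    ... | Δ₁ , h₁ , g₁ | Δ₂ , h₂ , g₂ =
      Δ₁ ++ Δ₂ , ++-⊑ h₁ h₂ ,
      case (mono s (⊑-++ˡ {Δ = Δ₁}) g₁) (monoa rs i (λ _ → id) (⊑-++ʳ Δ₁) g₂) l
    compacts (s ∷ _)  zero    = compact s
    compacts (_ ∷ ss) (suc i) = compacts ss i
    compacta (r ∷ _)  zero    φ = compact-under r
    compacta (_ ∷ rs) (suc i) φ = compacta rs i φ
    compact-under s {φ} = compact-∘ (mono s) (compact s) (λ x h → ext-mono (λ _ → id) h x)
      (ext-compact {Ψ = λ _ → φ} λ _ h → [] , (λ _ ()) , h)
    compacts-under (s ∷ _)  φ zero    = compact-under s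
    compacts-under (_ ∷ ss) φ (suc i) = compacts-under ss φ i

    ext-monoˡ : ∀ {ρ : Env n} (x : Fin (k + n)) → Monotone (λ φ → ext φ ρ x)
    ext-monoˡ x h = ext-mono h (λ _ → id) x

    -- Only the entries for the k inner variables need to be finite.
    compactˡ : ∀ (s : Exp A (k + n)) {ρ : Env n} → Compact (λ φ → ⟪ s ⟫ (ext φ ρ))
    compactˡ {k = k} s {ρ} = compact-∘ (mono s) (compact s) ext-monoˡ com
      where
      com : ∀ x → Compact (λ φ → ext φ ρ x)
      com x h with splitAt k x
      ... | inj₁ i = (i , _ , _) ∷ [] , (λ { _ (here refl) → h }) , here refl
      ... | inj₂ y = [] , (λ _ ()) , h

    compactsˡ : ∀ (ss : Vec (Exp A (k + n)) a) {ρ : Env n} i → Compact (λ φ → ⟪ ss ⟫s (ext φ ρ) i)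
    compactsˡ (s ∷ _)  zero    = compactˡ s
    compactsˡ (_ ∷ ss) (suc i) = compactsˡ ss i

    compactaˡ : ∀ {as : Vec ℕ k} (rs : Alts A n as) i {ρ} → Compact (λ φ → ⟪ rs ⟫a i φ ρ)
    compactaˡ (r ∷ _)  zero    = compactˡ r
    compactaˡ (_ ∷ rs) (suc i) = compactaˡ rs i

    -- `Lfp` applies `F` to finite environments only. Monotonicity yields one half of the fixed
    -- point equation and compactness the other; the charge `c` separates the two sides.
    Lfp-unfold : ∀ {F : Env k → Env k} → (∀ i → Monotone (λ φ → F φ i)) → ∀ i → Lfp F i τ q →
                 ∃ λ p → c + p ≤ q × F (Lfp F) i τ p
    Lfp-unfold mon i (fold Δ f g l) = _ , l , mon i f g

    Lfp-fold : ∀ {F : Env k → Env k} → (∀ i → Compact (λ φ → F φ i)) → ∀ i → F (Lfp F) i τ p → c + p ≤ q →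
               Lfp F i τ q
    Lfp-fold com i h l with com i h
    ... | Δ , f , g = fold Δ f g l

    -- Park's fixed point induction, with the look-up charge built into the notion of a prefixed
    -- point.
    Lfp-least : ∀ {F : Env k → Env k} {φ} → (∀ i → Monotone (λ φ → F φ i)) →
                (∀ i {τ p q} → F φ i τ p → c + p ≤ q → φ i τ q) → Lfp F ⊑ φ
    Lfp-least mon h i (fold Δ f g l) = h i (mon i (λ x y → Lfp-least mon h x (f x y)) g) l

    rec : Vec (Exp A (k + n)) k → Env n → Env k
    rec bs ρ = Lfp (λ φ → ⟪ bs ⟫s (ext φ ρ))

    rec-unfold : ∀ (bs : Vec (Exp A (k + n)) k) {ρ} i → rec bs ρ i τ q →
                 ∃ λ p → c + p ≤ q × ⟪ lookup bs i ⟫ (heap bs ρ) τ p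
    rec-unfold bs i h with Lfp-unfold (λ i h → monos bs (ext-mono h (λ _ → id)) i) i h
    ... | p , l , h′ = p , l , ⊆-≡ (⟪⟫s-lookup bs _ i) h′

    rec-fold : ∀ (bs : Vec (Exp A (k + n)) k) {ρ} i → ⟪ lookup bs i ⟫ (heap bs ρ) τ p → c + p ≤ q →
               rec bs ρ i τ q
    rec-fold bs {ρ} i h l = Lfp-fold (compactsˡ bs) i (⊆-≡ (sym (⟪⟫s-lookup bs (heap bs ρ) i)) h) l

    rec-least : ∀ (bs : Vec (Exp A (k + n)) k) {ρ φ} →
                (∀ i {τ p q} → ⟪ lookup bs i ⟫ (ext φ ρ) τ p → c + p ≤ q → φ i τ q) → rec bs ρ ⊑ φ
    rec-least bs {ρ} {φ} h = Lfp-least (λ i h → monos bs (ext-mono h (λ _ → id)) i)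
      λ i h′ → h i (⊆-≡ (⟪⟫s-lookup bs (ext φ ρ) i) h′)

    -- The binders between root and hole can have any denotation, so the environments at the hole
    -- are constrained only on the variables coming from the root. This suffices for rules whose
    -- redex refers to a binding outside the context.
    record Locally (f : Fin n → Fin m) (ρ ρ′ : Env n) (u u′ : Exp A m) : Set₁ where
      constructor local
      field
        at-hole : ∀ {θ θ′} → θ ⊑ θ′ → (∀ x → θ (f x) ≡ ρ x) → (∀ x → θ′ (f x) ≡ ρ′ x) →
                  ⟪ u ⟫ θ ⊆ ⟪ u′ ⟫ θ′
    open Locally

    under : ∀ {f : Fin (k + n) → Fin m} {ρ ρ′ : Env n} {u u′ : Exp A m} {φ φ′} →
            Locally (f ∘ (k ↑ʳ_)) ρ ρ′ u u′ → Locally f (ext φ ρ) (ext φ′ ρ′) u u′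
    under {ρ = ρ} {ρ′} {φ = φ} {φ′} h .at-hole l e e′ =
      at-hole h l (λ x → trans (e _) (ext-↑ʳ φ ρ x)) (λ x → trans (e′ _) (ext-↑ʳ φ′ ρ′ x))

    ctx  : ∀ (C : Ctx A m n) {u u′ ρ ρ′} → ρ ⊑ ρ′ → Locally (wk C) ρ ρ′ u u′ →
           ⟪ C ⟦ u ⟧ ⟫ ρ ⊆ ⟪ C ⟦ u′ ⟧ ⟫ ρ′
    ctxs : ∀ (C : VecCtx A m n k) {u u′ ρ ρ′} → ρ ⊑ ρ′ → Locally (wkVec C) ρ ρ′ u u′ →
           ⟪ plugs C u ⟫s ρ ⊑ ⟪ plugs C u′ ⟫s ρ′
    ctxa : ∀ {as : Vec ℕ k} (C : AltsCtx A m n as) {u u′ ρ ρ′} → ρ ⊑ ρ′ →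
           Locally (wkAlts C) ρ ρ′ u u′ → ∀ i {φ} →
           ⟪ plugAlts C u ⟫a i φ ρ ⊆ ⟪ plugAlts C u′ ⟫a i φ ρ′
    ctx [·]                    l h = at-hole h l (λ _ → refl) (λ _ → refl)
    ctx (app₁ C t ^ _)         l h = App-mono (ctx C l h) (mono t l)
    ctx (app₂ s C ^ _)         l h = App-mono (mono s l) (ctx C l h)
    ctx (lam C ^ _)            l h = Lam-mono λ _ → ctx C (ext-mono (λ _ → id) l) (under h)
    ctx (letrec-e {k = k} Cs t ^ _) l h =
      mono t (ext-mono (Lfp-mono λ _ → ctxs Cs (ext-mono (λ _ → id) l) (under {k = suc k} h)) l)
    ctx (letrec-i {k = k} bs C ^ _) l h = ctx C (heap-mono bs l) (under {k = suc k} h)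
    ctx (con _ _ Cs ^ _)       l h = Con-mono (ctxs Cs l h)
    ctx (seq₁ C t ^ _)         l h = Seq-mono (ctx C l h) (mono t l)
    ctx (seq₂ s C ^ _)         l h = Seq-mono (mono s l) (ctx C l h)
    ctx (case _ C rs ^ _)      l h = Case-mono (ctx C l h) λ i _ → monoa rs i (λ _ → id) l
    ctx (alt _ s Cs ^ _)       l h = Case-mono (mono s l) λ i _ → ctxa Cs l h i
    ctxs (here C ss)  l h zero    = ctx C l h
    ctxs (here C ss)  l h (suc i) = monos ss l i
    ctxs (there s Cs) l h zero    = mono s l
    ctxs (there s Cs) l h (suc i) = ctxs Cs l h i
    ctxa (here {a = a} C rs) l h zero = ctx C (ext-mono (λ _ → id) l) (under {k = a} h)
    ctxa (here C rs)  l h (suc i) = monoa rs i (λ _ → id) l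
    ctxa (there r Cs) l h zero    = mono r (ext-mono (λ _ → id) l)
    ctxa (there r Cs) l h (suc i) = ctxa Cs l h i

    -- Substitution

    sub-lift→ : ∀ {φ : Env k} {ρ : Env n} {ρ′ : Env m} (σ : Fin n → E m) →
                (∀ x → Up (ρ x) ⊆ ⟪ σ x ⟫ ρ′) → ∀ x → Up (ext φ ρ x) ⊆ ⟪ liftˢ k σ x ⟫ (ext φ ρ′)
    sub-lift→ {k = k} {φ = φ} {ρ′ = ρ′} σ h x with splitAt k x
    ... | inj₁ i = Up-mono (⊆-≡ (sym (ext-↑ˡ φ ρ′ i)))
    ... | inj₂ y = λ z → ren→ (σ y) (k ↑ʳ_) (λ x → ⊆-≡ (sym (ext-↑ʳ φ ρ′ x))) (h y z)

    sub-lift← : ∀ {φ : Env k} {ρ : Env n} {ρ′ : Env m} (σ : Fin n → E m) →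
                (∀ x → ⟪ σ x ⟫ ρ′ ⊆ Up (ρ x)) → ∀ x → ⟪ liftˢ k σ x ⟫ (ext φ ρ′) ⊆ Up (ext φ ρ x)
    sub-lift← {k = k} {φ = φ} {ρ′ = ρ′} σ h x with splitAt k x
    ... | inj₁ i = Up-mono (⊆-≡ (ext-↑ˡ φ ρ′ i))
    ... | inj₂ y = λ z → h y (ren← (σ y) (k ↑ʳ_) (λ x → ⊆-≡ (ext-↑ʳ φ ρ′ x)) z)

    sub→  : ∀ (s : E n) (σ : Fin n → E m) {ρ ρ′} → (∀ x → Up (ρ x) ⊆ ⟪ σ x ⟫ ρ′) →
            ⟪ s ⟫ ρ ⊆ ⟪ sub σ s ⟫ ρ′
    subs→ : ∀ (ss : Vec (E n) k) (σ : Fin n → E m) {ρ ρ′} → (∀ x → Up (ρ x) ⊆ ⟪ σ x ⟫ ρ′) →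
            ⟪ ss ⟫s ρ ⊑ ⟪ subs σ ss ⟫s ρ′
    suba→ : ∀ {as : Vec ℕ k} (rs : Alts ⊤ n as) (σ : Fin n → E m) i {φ ρ ρ′} →
            (∀ x → Up (ρ x) ⊆ ⟪ σ x ⟫ ρ′) → ⟪ rs ⟫a i φ ρ ⊆ ⟪ subAlts σ rs ⟫a i φ ρ′
    sub→ (var x ^ _)       σ h = h x
    sub→ (app s t ^ _)     σ h = App-mono (sub→ s σ h) (sub→ t σ h)
    sub→ (lam s ^ _)       σ h = Lam-mono λ _ → sub→ s _ (sub-lift→ σ h)
    sub→ (letrec {k} bs t ^ _) σ {ρ} {ρ′} h x =
      -- `sub-lift→` has the same inner environment `φ` on both sides, so the body is substituted
      -- under the old heap first and the two heaps are compared afterwards.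
      mono (sub (liftˢ (suc k) σ) t)
        (ext-mono (Lfp-mono λ _ → subs→ bs _ (sub-lift→ σ h)) (λ _ → id))
        (sub→ t _ (sub-lift→ σ h) x)
    sub→ (con _ _ ss ^ _)  σ h = Con-mono (subs→ ss σ h)
    sub→ (seq s t ^ _)     σ h = Seq-mono (sub→ s σ h) (sub→ t σ h)
    sub→ (case _ s rs ^ _) σ h = Case-mono (sub→ s σ h) λ i _ → suba→ rs σ i h
    subs→ (s ∷ _)  σ h zero    = sub→ s σ h
    subs→ (_ ∷ ss) σ h (suc i) = subs→ ss σ h i
    suba→ (r ∷ _)  σ zero    h = sub→ r _ (sub-lift→ σ h)
    suba→ (_ ∷ rs) σ (suc i) h = suba→ rs σ i h

    sub←  : ∀ (s : E n) (σ : Fin n → E m) {ρ ρ′} → (∀ x → ⟪ σ x ⟫ ρ′ ⊆ Up (ρ x)) →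
            ⟪ sub σ s ⟫ ρ′ ⊆ ⟪ s ⟫ ρ
    subs← : ∀ (ss : Vec (E n) k) (σ : Fin n → E m) {ρ ρ′} → (∀ x → ⟪ σ x ⟫ ρ′ ⊆ Up (ρ x)) →
            ⟪ subs σ ss ⟫s ρ′ ⊑ ⟪ ss ⟫s ρ
    suba← : ∀ {as : Vec ℕ k} (rs : Alts ⊤ n as) (σ : Fin n → E m) i {φ ρ ρ′} →
            (∀ x → ⟪ σ x ⟫ ρ′ ⊆ Up (ρ x)) → ⟪ subAlts σ rs ⟫a i φ ρ′ ⊆ ⟪ rs ⟫a i φ ρ
    sub← (var x ^ _)       σ h = h x
    sub← (app s t ^ _)     σ h = App-mono (sub← s σ h) (sub← t σ h)
    sub← (lam s ^ _)       σ h = Lam-mono λ _ → sub← s _ (sub-lift← σ h)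
    sub← (letrec {k} bs t ^ _) σ {ρ} {ρ′} h x =
      mono t (ext-mono (Lfp-mono λ _ → subs← bs _ (sub-lift← σ h)) (λ _ → id))
        (sub← t _ (sub-lift← σ h) x)
    sub← (con _ _ ss ^ _)  σ h = Con-mono (subs← ss σ h)
    sub← (seq s t ^ _)     σ h = Seq-mono (sub← s σ h) (sub← t σ h)
    sub← (case _ s rs ^ _) σ h = Case-mono (sub← s σ h) λ i _ → suba← rs σ i h
    subs← (s ∷ _)  σ h zero    = sub← s σ h
    subs← (_ ∷ ss) σ h (suc i) = subs← ss σ h i
    suba← (r ∷ _)  σ zero    h = sub← r _ (sub-lift← σ h)
    suba← (_ ∷ rs) σ (suc i) h = suba← rs σ i h

  -- Changing the charges

  module Recharge (b c : ℕ) where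
    private module M₀ = Model 0 0
    open Model b c

    infix 4 _⊩_ _⊩*_ _⊪_ _≼_

    -- A reducibility relation: a denotation at charges `b`, `c` realises a type derived at zero
    -- charges, whose recorded costs are ignored. For constructors it supplies an environment of
    -- argument denotations, since a case branch may demand other finite parts of the arguments than
    -- those in `Δ`. `_⊩*_` runs through the list so that the definition is structurally recursive
    -- in the type.
    _⊩_  : D → Type → Set₁
    _⊩*_ : Env k → Approx k → Set₁
    d ⊩ ⋆         = Lift _ (∃ λ p → d ⋆ p)
    d ⊩ fun Δ τ _ = ∀ (e : D) → (λ _ → e) ⊩* Δ → App d e ⊩ τ
    d ⊩ con κ i Δ = Σ (Env (lookup (ar κ) i)) λ φ → φ ⊩* Δ ×
                    (∀ Δ′ → ⟨ Δ′ ⟩ ⊑ φ → ∃ λ p → d (con κ i Δ′) p)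
    φ ⊩* []              = Lift _ ⊤
    φ ⊩* ((x , τ , _) ∷ Δ) = (φ x ⊩ τ) × (φ ⊩* Δ)

    _⊪_ : Env k → Env k → Set₁
    ρ₀ ⊪ ρ = ∀ x {τ p} → ρ₀ x τ p → ρ x ⊩ τ

    ⊪⇒⊩* : ∀ (Δ : Approx k) {φ} → ⟨ Δ ⟩ ⊪ φ → φ ⊩* Δ
    ⊪⇒⊩* []      h = lift tt
    ⊪⇒⊩* (_ ∷ Δ) h = h _ (here refl) , ⊪⇒⊩* Δ (λ x y → h x (there y))

    ⊩*⇒⊪ : ∀ (Δ : Approx k) {φ} → φ ⊩* Δ → ⟨ Δ ⟩ ⊪ φ
    ⊩*⇒⊪ (_ ∷ Δ) (h , _) x (here refl) = h
    ⊩*⇒⊪ (_ ∷ Δ) (_ , h) x (there y)   = ⊩*⇒⊪ Δ h x y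

    _≼_ : D → D → Set
    d ≼ d′ = ∀ {τ p} → d τ p → ∃ λ q → d′ τ q

    ⊩-mono : ∀ {d d′} τ → d ≼ d′ → d ⊩ τ → d′ ⊩ τ
    ⊩-mono ⋆           l (lift (_ , h)) = lift (l h)
    ⊩-mono (fun Δ τ _) l h e g          =
      ⊩-mono τ (λ { (app f a _) → _ , app (proj₂ (l f)) a ≤-refl }) (h e g)
    ⊩-mono (con κ i Δ) l (φ , g , h)    = φ , g , λ Δ′ g′ → l (proj₂ (h Δ′ g′))

    ext-⊪ : ∀ {φ₀ φ : Env k} {ρ₀ ρ : Env n} → φ₀ ⊪ φ → ρ₀ ⊪ ρ → ext φ₀ ρ₀ ⊪ ext φ ρ
    ext-⊪ {k} h h′ x with splitAt k x
    ... | inj₁ i = h i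
    ... | inj₂ y = h′ y

    -- The fundamental lemma of the relation. Every case ends with `⊩-mono`, or directly with the
    -- clause of the relation, because some cost in the new model is all that has to be found.
    transfer  : ∀ (s : Exp A n) {ρ₀ ρ} → ρ₀ ⊪ ρ → M₀.⟪ s ⟫ ρ₀ τ p → ⟪ s ⟫ ρ ⊩ τ
    transfers : ∀ (ss : Vec (Exp A n) k) {ρ₀ ρ} → ρ₀ ⊪ ρ → M₀.⟪ ss ⟫s ρ₀ ⊪ ⟪ ss ⟫s ρ
    transfera : ∀ {as : Vec ℕ k} (rs : Alts A n as) i {φ₀ φ ρ₀ ρ} → φ₀ ⊪ φ → ρ₀ ⊪ ρ →
                M₀.⟪ rs ⟫a i φ₀ ρ₀ τ p → ⟪ rs ⟫a i φ ρ ⊩ τ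
    transfer-rec : ∀ (bs : Vec (Exp A (k + n)) k) {ρ₀ ρ} → ρ₀ ⊪ ρ → M₀.rec bs ρ₀ ⊪ rec bs ρ
    transfer {τ = τ} (var x ^ _) h (M₀.up-to v _) = ⊩-mono τ (λ z → _ , up-to z ≤-refl) (h x v)
    transfer (app s t ^ _) {ρ = ρ} h (M₀.app {Δ} f a _) =
      transfer s h f (⟪ t ⟫ ρ) (⊪⇒⊩* Δ λ x y → transfer t h (a x y))
    transfer (lam s ^ _) h M₀.⋆ = lift (0 , ⋆)
    transfer {τ = fun Δ τ _} (lam s ^ _) h (M₀.fun f) e g =
      -- The old graph `Δ` is discarded: compactness selects a graph `Δ′` of the actual argument,
      -- with costs valid under the new charges.
      ⊩-mono τ (λ z → let Δ′ , l , z′ = compactˡ s z in _ , app {q₁ = 0} (fun z′) l ≤-refl)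
               (transfer s (ext-⊪ (⊩*⇒⊪ Δ g) h) f)
    transfer (letrec bs t ^ _) h = transfer t (ext-⊪ (transfer-rec bs h) h)
    transfer (con κ i ss ^ _) h M₀.⋆ = lift (0 , ⋆)
    transfer (con κ i ss ^ _) {ρ = ρ} h (M₀.con {Δ = Δ} f) =
      ⟪ ss ⟫s ρ , ⊪⇒⊩* Δ (λ x y → transfers ss h x (f x y)) , λ Δ′ g → 0 , con g
    transfer {τ = τ} (seq s t ^ _) h (M₀.seq f a _) with transfer s h f
    ... | lift (_ , f′) = ⊩-mono τ (λ z → _ , seq f′ z ≤-refl) (transfer t h a)
    transfer {τ = τ} (case κ s rs ^ _) h (M₀.case {i} {Δ} f a _) with transfer s h f
    ... | φ , g , f′ =
      ⊩-mono τ (λ z → let Δ′ , l , z′ = compactaˡ rs i z in _ , case (proj₂ (f′ Δ′ l)) z′ ≤-refl)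
               (transfera rs i (⊩*⇒⊪ Δ g) h a)
    transfers (s ∷ _)  h zero    = transfer s h
    transfers (_ ∷ ss) h (suc i) = transfers ss h i
    transfera (r ∷ _)  zero    h h′ = transfer r (ext-⊪ h h′)
    transfera (_ ∷ rs) (suc i) h h′ = transfera rs i h h′
    -- Induction on the derivation at zero charges: the entries of `Δ` have smaller derivations, and
    -- once transferred they form the environment in which the binding is transferred.
    transfer-rec bs h i {τ} (M₀.fold Δ f g _) =
      ⊩-mono τ (λ z → _ , Lfp-fold (compactsˡ bs) i z ≤-refl)
        (transfers bs (ext-⊪ (λ x y → transfer-rec bs h x (f x y)) h) i g)

    recharge : ∀ (s : E n) → M₀.⟪ s ⟫ none ⋆ p → ∃ λ q → ⟪ s ⟫ none ⋆ q
    recharge s h with transfer s (λ _ ()) h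
    ... | lift h′ = h′

  -- Weights, spines and local reductions

  -- Tuned to the steps that leave the cost unchanged. Copying an abstraction trades a variable of
  -- weight 1 for weight 0, merging two `letrec`s loses one unit, and the doubling in frames pays
  -- for floating a `letrec` out. Arguments and alternatives do not count; bindings do, as
  -- call-by-need also reduces inside them.
  weight  : Exp A n → ℕ
  weights : Vec (Exp A n) k → ℕ
  weight (var _ ^ _)       = 1
  weight (app s _ ^ _)     = weight s + weight s
  weight (lam _ ^ _)       = 0
  weight (letrec bs t ^ _) = suc (weights bs + weight t)
  weight (con _ _ _ ^ _)   = 0
  weight (seq s _ ^ _)     = weight s + weight s
  weight (case _ s _ ^ _)  = weight s + weight s
  weights []       = 0
  weights (s ∷ ss) = weight s + weights ss

  data Frame (A : Set) (n : ℕ) : Set where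
    app  : Exp A n → Frame A n
    seq  : Exp A n → Frame A n
    case : ∀ κ → Alts A n (ar κ) → Frame A n

  infixr 5 _∙_◂_

  -- Evaluation contexts as lists of frames, outermost first. Frames bind nothing, so hole and root
  -- have the same scope.
  data Spine (A : Set) (n : ℕ) : Set where
    []    : Spine A n
    _∙_◂_ : Frame A n → A → Spine A n → Spine A n

  _⊙_ : Frame A n → Exp A n → Node A n
  app t     ⊙ s = app s t
  seq t     ⊙ s = seq s t
  case κ rs ⊙ s = case κ s rs

  frameCtx : Frame A n → Ctx A m n → CNode A m n
  frameCtx (app t)     C = app₁ C t
  frameCtx (seq t)     C = seq₁ C t
  frameCtx (case κ rs) C = case κ C rs

  toCtx : Spine A n → Ctx A n n
  toCtx []          = [·]
  toCtx (f ∙ l ◂ X) = frameCtx f (toCtx X) ^ l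

  wk-frameCtx : ∀ (f : Frame A n) (C : Ctx A m n) x → wkNode (frameCtx f C) x ≡ wk C x
  wk-frameCtx (app _)    C x = refl
  wk-frameCtx (seq _)    C x = refl
  wk-frameCtx (case _ _) C x = refl

  wk-toCtx : ∀ (X : Spine A n) x → wk (toCtx X) x ≡ x
  wk-toCtx []          x = refl
  wk-toCtx (f ∙ _ ◂ X) x = trans (wk-frameCtx f (toCtx X) x) (wk-toCtx X x)

  IsA-toCtx : ∀ (X : Spine ⊤ n) → IsA (toCtx X)
  IsA-toCtx []                 = [·]
  IsA-toCtx (app _ ∙ _ ◂ X)    = app (IsA-toCtx X)
  IsA-toCtx (seq _ ∙ _ ◂ X)    = seq (IsA-toCtx X)
  IsA-toCtx (case _ _ ∙ _ ◂ X) = case (IsA-toCtx X)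

  data Head {A : Set} {n : ℕ} : Node A n → Set where
    var    : ∀ {x} → Head (var x)
    lam    : ∀ {s} → Head (lam s)
    con    : ∀ {κ i ss} → Head (con κ i ss)
    letrec : ∀ {k} {bs : Vec _ (suc k)} {t} → Head (letrec bs t)

  -- The innermost frame `f` is kept apart from the spine, because `f` and the head together form
  -- the potential redex.
  data Framed {A : Set} {n : ℕ} : Exp A n → Set where
    framed : ∀ (X : Spine A n) f {h l l′} → Head h → Framed (toCtx X ⟦ (f ⊙ (h ^ l)) ^ l′ ⟧)

  data View {A : Set} {n : ℕ} : Exp A n → Set where
    bare   : ∀ {h : Node A n} {l} → Head h → View (h ^ l)
    framed : ∀ {s} → Framed s → View s

  view-⊙ : ∀ (f : Frame A n) {s} l → View s → Framed ((f ⊙ s) ^ l)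
  view-⊙ f           l (bare h)                = framed [] f h
  view-⊙ (app t)     l (framed (framed X f h)) = framed (app t ∙ l ◂ X) f h
  view-⊙ (seq t)     l (framed (framed X f h)) = framed (seq t ∙ l ◂ X) f h
  view-⊙ (case κ rs) l (framed (framed X f h)) = framed (case κ rs ∙ l ◂ X) f h

  view : (s : Exp A n) → View s
  view (var _ ^ _)       = bare var
  view (lam _ ^ _)       = bare lam
  view (con _ _ _ ^ _)   = bare con
  view (letrec _ _ ^ _)  = bare letrec
  view (app s t ^ l)     = framed (view-⊙ (app t) l (view s))
  view (seq s t ^ l)     = framed (view-⊙ (seq t) l (view s))
  view (case κ s rs ^ l) = framed (view-⊙ (case κ rs) l (view s))

  _▹_∙_ : Spine A n → Frame A n → A → Spine A n
  []          ▹ g ∙ l′ = g ∙ l′ ◂ []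
  (f ∙ l ◂ X) ▹ g ∙ l′ = f ∙ l ◂ (X ▹ g ∙ l′)

  weight-⊙ : ∀ (f : Frame A n) {s s′ : Exp A n} {l l′} → weight s′ < weight s →
             weight ((f ⊙ s′) ^ l′) < weight ((f ⊙ s) ^ l)
  weight-⊙ (app _)    h = +-mono-< h h
  weight-⊙ (seq _)    h = +-mono-< h h
  weight-⊙ (case _ _) h = +-mono-< h h

  toCtx-◂ : ∀ f {l} (X : Spine A n) u → toCtx (f ∙ l ◂ X) ⟦ u ⟧ ≡ (f ⊙ (toCtx X ⟦ u ⟧)) ^ l
  toCtx-◂ (app _)    X u = refl
  toCtx-◂ (seq _)    X u = refl
  toCtx-◂ (case _ _) X u = refl

  toCtx-▹ : ∀ (X : Spine A n) f l u → toCtx (X ▹ f ∙ l) ⟦ u ⟧ ≡ toCtx X ⟦ (f ⊙ u) ^ l ⟧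
  toCtx-▹ []                  f l u = toCtx-◂ f [] u
  toCtx-▹ (app t ∙ l′ ◂ X)     f l u = cong (λ s → app s t ^ l′) (toCtx-▹ X f l u)
  toCtx-▹ (seq t ∙ l′ ◂ X)     f l u = cong (λ s → seq s t ^ l′) (toCtx-▹ X f l u)
  toCtx-▹ (case κ rs ∙ l′ ◂ X) f l u = cong (λ s → case κ s rs ^ l′) (toCtx-▹ X f l u)

  weight-spine : ∀ (X : Spine A n) {s s′} → weight s′ < weight s →
                 weight (toCtx X ⟦ s′ ⟧) < weight (toCtx X ⟦ s ⟧)
  weight-spine []          h = h
  weight-spine (f ∙ l ◂ X) {s} {s′} h rewrite toCtx-◂ f {l} X s | toCtx-◂ f {l} X s′ =
    weight-⊙ f (weight-spine X h)

  -- Moving a letrec out of a frame pays since frames double the weight.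
  weight-float : ∀ a w → suc (a + (w + w)) < suc (a + w) + suc (a + w)
  weight-float a w = s≤s (subst (suc (a + (w + w)) ≤_)
    (solve 2 (λ a w → con 1 :+ (a :+ (w :+ w)) :+ a := a :+ w :+ (con 1 :+ (a :+ w))) refl a w) (m≤m+n _ a))
    where open +-*-Solver

  infix 4 _↘[_]_

  _↘[_]_ : D → ℕ → D → Set
  d ↘[ k ] d′ = ∀ {τ p} → d τ p → ∃ λ p′ → k + p′ ≤ p × d′ τ p′

  module Local (b c : ℕ) where
    open Model b c

    ⊆⇒↘ : ∀ {d d′} → d ⊆ d′ → d ↘[ 0 ] d′
    ⊆⇒↘ h x = _ , ≤-refl , h x

    ↘⇒⊆ : ∀ (s s′ : Exp A n) {ρ ρ′} → ⟪ s ⟫ ρ ↘[ k ] ⟪ s′ ⟫ ρ′ → ⟪ s ⟫ ρ ⊆ ⟪ s′ ⟫ ρ′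
    ↘⇒⊆ {k = k} s s′ h x with h x
    ... | p′ , l , y = up s′ y (≤-trans (m≤n+m p′ k) l)

    ↘-⊆ : ∀ {d d′ d″} → d ↘[ k ] d′ → d′ ⊆ d″ → d ↘[ k ] d″
    ↘-⊆ h g x with h x
    ... | p′ , l , y = p′ , l , g y

    charge : ∀ k {q q′ r} → k + q′ ≤ q → b + (q + r) ≤ p → k + (b + (q′ + r)) ≤ p
    charge k {q} {q′} {r} h l = ≤-trans (≤-reflexive
      (solve 4 (λ k b q r → k :+ (b :+ (q :+ r)) := b :+ ((k :+ q) :+ r)) refl k b q′ r))
      (≤-trans (+-monoʳ-≤ b (+-monoˡ-≤ r h)) l)
      where open +-*-Solver

    ⊙-↘ : ∀ (f : Frame A n) {l l′} {s s′ ρ ρ′} → ρ ⊑ ρ′ → ⟪ s ⟫ ρ ↘[ k ] ⟪ s′ ⟫ ρ′ →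
          ⟪ (f ⊙ s) ^ l ⟫ ρ ↘[ k ] ⟪ (f ⊙ s′) ^ l′ ⟫ ρ′
    ⊙-↘ {k = k} (app t) i h (app f a l) with h f
    ... | _ , l′ , f′ = _ , charge k l′ l , app f′ (λ x y → mono t i (a x y)) ≤-refl
    ⊙-↘ {k = k} (seq t) i h (seq f a l) with h f
    ... | _ , l′ , f′ = _ , charge k l′ l , seq f′ (mono t i a) ≤-refl
    ⊙-↘ {k = k} (case _ rs) i h (case f a l) with h f
    ... | _ , l′ , f′ = _ , charge k l′ l , case f′ (monoa rs _ (λ _ → id) i a) ≤-refl

    -- In an evaluation position the cost of the hole is a summand of the cost of the whole, so a
    -- drop is passed on undiminished.
    spine-↘ : ∀ (X : Spine A n) {s s′ ρ ρ′} → ρ ⊑ ρ′ → ⟪ s ⟫ ρ ↘[ k ] ⟪ s′ ⟫ ρ′ →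
              ⟪ toCtx X ⟦ s ⟧ ⟫ ρ ↘[ k ] ⟪ toCtx X ⟦ s′ ⟧ ⟫ ρ′
    spine-↘ []          i h = h
    spine-↘ (f ∙ l ◂ X) {s} {s′} i h rewrite toCtx-◂ f {l} X s | toCtx-◂ f {l} X s′ =
      ⊙-↘ f i (spine-↘ X i h)

    ⊙-typed : ∀ (f : Frame A n) {l} {s ρ} → ⟪ (f ⊙ s) ^ l ⟫ ρ τ p → ∃ λ τ′ → ∃ λ p′ → ⟪ s ⟫ ρ τ′ p′
    ⊙-typed (app _)    (app f _ _)  = _ , _ , f
    ⊙-typed (seq _)    (seq f _ _)  = _ , _ , f
    ⊙-typed (case _ _) (case f _ _) = _ , _ , f

    spine-typed : ∀ (X : Spine A n) {s ρ} → ⟪ toCtx X ⟦ s ⟧ ⟫ ρ τ p → ∃ λ τ′ → ∃ λ p′ → ⟪ s ⟫ ρ τ′ p′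
    spine-typed []          h = _ , _ , h
    spine-typed (f ∙ l ◂ X) {s} h rewrite toCtx-◂ f {l} X s = spine-typed X (proj₂ (proj₂ (⊙-typed f h)))

    lam-app→ : ∀ (s : Exp A (suc n)) t {l l′ ρ} →
               ⟪ app (lam s ^ l) t ^ l′ ⟫ ρ ↘[ b ] ⟪ s ⟫ (ext (⟪ t ∷ [] ⟫s ρ) ρ)
    lam-app→ s t (app {q₁ = q₁} (fun f) a l) =
      _ , ≤-trans (+-monoʳ-≤ b (m≤n+m _ q₁)) l ,
      mono s (ext-mono {k = 1} (λ { zero y → a zero y }) (λ _ → id)) f

    -- Compactness collects what the body uses of the argument into a graph `Δ`, which provides the
    -- function type; the abstraction itself costs 0.
    lam-app← : ∀ (s : Exp A (suc n)) t {l l′ ρ} → ⟪ s ⟫ (ext (⟪ t ∷ [] ⟫s ρ) ρ) τ p →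
               ⟪ app (lam s ^ l) t ^ l′ ⟫ ρ τ (b + p)
    lam-app← s t h with compactˡ s h
    ... | Δ , g , f = app {q₁ = 0} (fun f) (λ { zero y → g zero y }) ≤-refl

    case-con→ : ∀ {κ i} ss (rs : Alts A n (ar κ)) {l l′ ρ} →
                ⟪ case κ (con κ i ss ^ l) rs ^ l′ ⟫ ρ ↘[ b ] ⟪ lookup⁺ rs i ⟫ (ext (⟪ ss ⟫s ρ) ρ)
    case-con→ {i = i} ss rs {ρ = ρ} (case {q₁ = q₁} (con {Δ = Δ} f) a l) =
      _ , ≤-trans (+-monoʳ-≤ b (m≤n+m _ q₁)) l ,
      ⊆-≡ (⟪⟫a-lookup rs i (⟪ ss ⟫s ρ) ρ) (monoa rs i f (λ _ → id) a)

    case-con← : ∀ {κ i} ss (rs : Alts A n (ar κ)) {l l′ ρ} →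
                ⟪ lookup⁺ rs i ⟫ (ext (⟪ ss ⟫s ρ) ρ) τ p →
                ⟪ case κ (con κ i ss ^ l) rs ^ l′ ⟫ ρ τ (b + p)
    case-con← {i = i} ss rs {ρ = ρ} h with compactaˡ rs i (⊆-≡ (sym (⟪⟫a-lookup rs i (⟪ ss ⟫s ρ) ρ)) h)
    ... | Δ , g , f = case {q₁ = 0} (con g) f ≤-refl

    seq→ : ∀ (s t : Exp A n) {l ρ} → ⟪ seq s t ^ l ⟫ ρ ↘[ b ] ⟪ t ⟫ ρ
    seq→ s t (seq {q₁ = q₁} _ a l) = _ , ≤-trans (+-monoʳ-≤ b (m≤n+m _ q₁)) l , a

    value-⋆ : ∀ {v : Exp A n} {ρ} → Value v → ⟪ v ⟫ ρ ⋆ 0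
    value-⋆ lam = ⋆
    value-⋆ con = ⋆

    seq← : ∀ {v : Exp A n} t {l ρ} → Value v → ⟪ t ⟫ ρ τ p → ⟪ seq v t ^ l ⟫ ρ τ (b + p)
    seq← t v h = seq (value-⋆ v) h ≤-refl

    instantiate→ : ∀ (ss : Vec (E n) k) t {ρ} → ⟪ t ⟫ (ext (⟪ ss ⟫s ρ) ρ) ⊆ ⟪ instantiate ss t ⟫ ρ
    instantiate→ {k = k} ss t {ρ} = sub→ t _ var-case
      where
      var-case : ∀ x → Up (ext (⟪ ss ⟫s ρ) ρ x) ⊆ ⟪ [ lookup ss , (λ x → var x ^ tt) ]′ (splitAt k x) ⟫ ρ
      var-case x with splitAt k x
      ... | inj₁ i = λ y → Up-⟪⟫ (lookup ss i) (Up-mono (⊆-≡ (⟪⟫s-lookup ss ρ i)) y)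
      ... | inj₂ _ = id

    instantiate← : ∀ (ss : Vec (E n) k) t {ρ} → ⟪ instantiate ss t ⟫ ρ ⊆ ⟪ t ⟫ (ext (⟪ ss ⟫s ρ) ρ)
    instantiate← {k = k} ss t {ρ} = sub← t _ var-case
      where
      var-case : ∀ x → ⟪ [ lookup ss , (λ x → var x ^ tt) ]′ (splitAt k x) ⟫ ρ ⊆ Up (ext (⟪ ss ⟫s ρ) ρ x)
      var-case x with splitAt k x
      ... | inj₁ i = λ y → up-to (⊆-≡ (sym (⟪⟫s-lookup ss ρ i)) y) ≤-refl
      ... | inj₂ _ = id

    renᵏ→ : ∀ (s : Exp A n) {φ : Env k} {ρ} → ⟪ s ⟫ ρ ⊆ ⟪ ren (k ↑ʳ_) s ⟫ (ext φ ρ)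
    renᵏ→ s {φ} {ρ} = ren→ s _ (λ x → ⊆-≡ (sym (ext-↑ʳ φ ρ x)))

    renᵏ← : ∀ (s : Exp A n) {φ : Env k} {ρ} → ⟪ ren (k ↑ʳ_) s ⟫ (ext φ ρ) ⊆ ⟪ s ⟫ ρ
    renᵏ← s {φ} {ρ} = ren← s _ (λ x → ⊆-≡ (ext-↑ʳ φ ρ x))

    renFrame : (Fin n → Fin m) → Frame A n → Frame A m
    renFrame f (app t)     = app (ren f t)
    renFrame f (seq t)     = seq (ren f t)
    renFrame f (case κ rs) = case κ (renAlts f rs)

    float→ : ∀ (f : Frame A n) (bs : Vec (Exp A (suc k + n)) (suc k)) s {l l′ l₁ l₂ ρ} →
             ⟪ (f ⊙ (letrec bs s ^ l)) ^ l′ ⟫ ρ ⊆ ⟪ letrec bs ((renFrame (suc k ↑ʳ_) f ⊙ s) ^ l₁) ^ l₂ ⟫ ρ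
    float→ {k = k} (app t) bs s (app f a l) = app f (λ x y → renᵏ→ {k = suc k} t (a x y)) l
    float→ {k = k} (seq t) bs s (seq f a l) = seq f (renᵏ→ {k = suc k} t a) l
    float→ {k = k} (case κ rs) bs s {ρ = ρ} (case f a l) =
      case f (rena→ rs _ _ (λ x → ⊆-≡ (sym (ext-↑ʳ (rec bs ρ) ρ x))) a) l

    float← : ∀ (f : Frame A n) (bs : Vec (Exp A (suc k + n)) (suc k)) s {l l′ l₁ l₂ ρ} →
             ⟪ letrec bs ((renFrame (suc k ↑ʳ_) f ⊙ s) ^ l₁) ^ l₂ ⟫ ρ ⊆ ⟪ (f ⊙ (letrec bs s ^ l)) ^ l′ ⟫ ρ
    float← {k = k} (app t) bs s (app f a l) = app f (λ x y → renᵏ← {k = suc k} t (a x y)) l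
    float← {k = k} (seq t) bs s (seq f a l) = seq f (renᵏ← {k = suc k} t a) l
    float← {k = k} (case κ rs) bs s {ρ = ρ} (case f a l) =
      case f (rena← rs _ _ (λ x → ⊆-≡ (ext-↑ʳ (rec bs ρ) ρ x)) a) l

    Smaller : E n → ℕ → E n → Set
    Smaller s p s′ = (∃ λ q → q < p × ⟪ s′ ⟫ none ⋆ q) ⊎ (⟪ s′ ⟫ none ⋆ p × weight s′ < weight s)

    terminates : ∀ {Step : E n → E n → Set} {Answer : E n → Set} →
                 (∀ {s p} → ⟪ s ⟫ none ⋆ p → Answer s ⊎ ∃ λ s′ → Step s s′ × Smaller s p s′) →
                 ∀ s → ⟪ s ⟫ none ⋆ p → ∃ λ v → Star Step s v × Answer v
    terminates {n = n} {Step = Step} {Answer} progress s h = go h (<-wellFounded _) (<-wellFounded _)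
      where
      Result : E n → Set
      Result s = ∃ λ v → Star Step s v × Answer v
      go   : ∀ {s p} → ⟪ s ⟫ none ⋆ p → Acc _<_ p → Acc _<_ (weight s) → Result s
      next : ∀ {s p} → Acc _<_ p → Acc _<_ (weight s) →
             (Answer s ⊎ ∃ λ s′ → Step s s′ × Smaller s p s′) → Result s
      go h a a′ = next a a′ (progress h)
      next a       a′       (inj₁ v) = _ , ε , v
      -- The weight may grow arbitrarily when the cost drops, so its accessibility is started
      -- afresh.
      next (acc a) a′       (inj₂ (_ , st , inj₁ (_ , l , h))) =
        let v , sts , w = go h (a l) (<-wellFounded _) in v , st ◅ sts , w
      next a       (acc a′) (inj₂ (_ , st , inj₂ (h , l))) =
        let v , sts , w = go h a (a′ l) in v , st ◅ sts , w

  -- Call-by-name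

  module NameSoundness where
    open Model 0 0
    open Local 0 0

    anywhere : ∀ (C : Ctx A m n) {u u′ ρ} → (∀ {θ} → ⟪ u ⟫ θ ⊆ ⟪ u′ ⟫ θ) → ⟪ C ⟦ u ⟧ ⟫ ρ ⊆ ⟪ C ⟦ u′ ⟧ ⟫ ρ
    anywhere C {u} h = ctx C (λ _ → id) (local λ l _ _ x → h (mono u l x))

    name-sound : ∀ {s s′ : E n} {ρ} → s ⟶name s′ → ⟪ s′ ⟫ ρ ⊆ ⟪ s ⟫ ρ
    name-sound (beta {R = R} {s} {t} _) = anywhere R λ x → lam-app← s t (instantiate← (t ∷ []) s x)
    -- At the hole of `R` both environments agree with the heap on the `letrec` variables. A typing
    -- of the copy is thus one of the binding itself and folds back into `x`, at no charge.
    name-sound (gcp {m} {L = L} {bs} {R} {x} _ _) = anywhere L λ {θ} →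
      ctx R (λ _ → id) (local λ {θ₁} {θ₂} l e e′ y →
        up-to (⊆-≡ (sym (trans (e′ (x ↑ˡ m)) (ext-↑ˡ _ _ x)))
                (rec-fold bs x (ren← (lookup bs x) (wk R) (λ z → ⊆-≡ (e z)) y) ≤-refl)) ≤-refl)
    name-sound (lapp {R = R} {bs} {s} {t} _)   = anywhere R (float← (app t) bs s)
    name-sound (lcase {R = R} {bs} {τ} {s} {rs} _) = anywhere R (float← (case τ rs) bs s)
    name-sound (lseq {R = R} {bs} {s} {t} _)   = anywhere R (float← (seq t) bs s)
    name-sound (seq {R = R} {s = s} _ v)       = anywhere R (seq← s v)
    name-sound (case {R = R} {i = i} {ss} {rs} _) =
      anywhere R λ x → case-con← ss rs (instantiate← ss (lookup⁺ rs i) x)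

    answer-⋆ : ∀ {s : E n} {ρ} → AnswerName s → ⟪ s ⟫ ρ ⋆ 0
    answer-⋆ (answer [·] v)        = value-⋆ v
    answer-⋆ (answer (letrec L) v) = answer-⋆ (answer L v)

    ↓name⇒⋆ : ∀ {s : E n} → s ↓name → ⟪ s ⟫ none ⋆ 0
    ↓name⇒⋆ (_ , ε , a)        = answer-⋆ a
    ↓name⇒⋆ (_ , st ◅ sts , a) = name-sound st (↓name⇒⋆ (_ , sts , a))

  module NameAdequacy where
    open Model 1 1
    open Local 1 1

    infix 4 _≻_

    _≻_ : E n → E n → Set₁
    s ≻ s′ = (∀ {ρ} → ⟪ s ⟫ ρ ↘[ 1 ] ⟪ s′ ⟫ ρ) ⊎ (∀ {ρ} → ⟪ s ⟫ ρ ⊆ ⟪ s′ ⟫ ρ) × weight s′ < weight s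

    -- `need` says that evaluation waits for a variable of the surrounding scope. An enclosing
    -- `letrec` either binds it, and gcp applies, or hands the demand further out.
    data Progress (s : E n) : Set₁ where
      done : AnswerName s → Progress s
      next : ∀ {s′} → s ⟶name s′ → s ≻ s′ → Progress s
      need : ∀ {m} (R : Ctx ⊤ m n) x {l} → IsR R → s ≡ R ⟦ var (wk R x) ^ l ⟧ → Progress s

    A-↘ : ∀ {C : Ctx ⊤ m n} → IsA C → ∀ u u′ {ρ} →
          (∀ θ → (∀ x → θ (wk C x) ≡ ρ x) → ⟪ u ⟫ θ ↘[ k ] ⟪ u′ ⟫ θ) →
          ⟪ C ⟦ u ⟧ ⟫ ρ ↘[ k ] ⟪ C ⟦ u′ ⟧ ⟫ ρ
    A-↘ [·] u u′ h = h _ (λ _ → refl)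
    A-↘ (app {C = C} {t} a) u u′ h =
      ⊙-↘ (app t) {s = C ⟦ u ⟧} {C ⟦ u′ ⟧} (λ _ → id) (A-↘ a u u′ h)
    A-↘ (seq {C = C} {t} a) u u′ h =
      ⊙-↘ (seq t) {s = C ⟦ u ⟧} {C ⟦ u′ ⟧} (λ _ → id) (A-↘ a u u′ h)
    A-↘ (case {C = C} {κ} {rs} a) u u′ h =
      ⊙-↘ (case κ rs) {s = C ⟦ u ⟧} {C ⟦ u′ ⟧} (λ _ → id) (A-↘ a u u′ h)

    R-↘ : ∀ {R : Ctx ⊤ m n} → IsR R → ∀ u u′ {ρ} →
          (∀ θ → (∀ x → θ (wk R x) ≡ ρ x) → ⟪ u ⟫ θ ↘[ k ] ⟪ u′ ⟫ θ) →
          ⟪ R ⟦ u ⟧ ⟫ ρ ↘[ k ] ⟪ R ⟦ u′ ⟧ ⟫ ρ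
    R-↘ (A-ctx a) u u′ h = A-↘ a u u′ h
    R-↘ (letrec {bs = bs} r) u u′ {ρ} h =
      R-↘ r u u′ λ θ e → h θ (λ x → trans (e _) (ext-↑ʳ (rec bs ρ) ρ x))

    -- The typing excludes heads of the wrong kind, such as an applied constructor. A `letrec` head
    -- floats out at equal cost and smaller weight; the other redexes release the charge `b`.
    contract : ∀ (f : Frame ⊤ n) {h l l′ ρ} → Head h → ⟪ (f ⊙ (h ^ l)) ^ l′ ⟫ ρ τ p →
               (∃ λ x → h ≡ var x) ⊎
               ∃ λ s′ → (∀ {m} {R : Ctx ⊤ n m} → IsR R → R ⟦ (f ⊙ (h ^ l)) ^ l′ ⟧ ⟶name R ⟦ s′ ⟧) ×
                        ((f ⊙ (h ^ l)) ^ l′ ≻ s′)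
    contract f var _ = inj₁ (_ , refl)
    contract (app t) (lam {s}) _ =
      inj₂ (_ , beta , inj₁ λ {ρ} → ↘-⊆ {d′ = ⟪ s ⟫ (ext (⟪ t ∷ [] ⟫s ρ) ρ)} (lam-app→ s t)
        (instantiate→ (t ∷ []) s))
    contract (seq t) (lam {s}) _ = inj₂ (_ , (λ r → seq r lam) , inj₁ (seq→ (lam s ^ tt) t))
    contract (case _ _) lam (case () _ _)
    contract (app _) con (app () _ _)
    contract (seq t) (con {ss = ss}) _ = inj₂ (_ , (λ r → seq r con) , inj₁ (seq→ (con _ _ ss ^ tt) t))
    contract (case κ rs) (con {i = i} {ss}) (case (con _) _ _) =
      inj₂ (_ , case , inj₁ λ {ρ} → ↘-⊆ {d′ = ⟪ lookup⁺ rs i ⟫ (ext (⟪ ss ⟫s ρ) ρ)} (case-con→ ss rs)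
        (instantiate→ ss (lookup⁺ rs i)))
    contract f@(app t) (letrec {bs = bs} {s}) _ =
      inj₂ (_ , lapp , inj₂ (float→ f bs s , weight-float (weights bs) (weight s)))
    contract f@(seq t) (letrec {bs = bs} {s}) _ =
      inj₂ (_ , lseq , inj₂ (float→ f bs s , weight-float (weights bs) (weight s)))
    contract f@(case κ rs) (letrec {bs = bs} {s}) _ =
      inj₂ (_ , lcase , inj₂ (float→ f bs s , weight-float (weights bs) (weight s)))

    progress-framed : ∀ {s : E n} {ρ} → Framed s → ⟪ s ⟫ ρ τ p → Progress s
    progress-framed {ρ = ρ} (framed X f {l = l} {l′} h) t with spine-typed X {(f ⊙ _) ^ _} {ρ} t
    ... | _ , _ , t′ with contract f h t′
    ...   | inj₁ (x , refl) =
      need (toCtx (X ▹ f ∙ l′)) x (A-ctx (IsA-toCtx (X ▹ f ∙ l′)))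
        (trans (sym (toCtx-▹ X f l′ _))
               (cong (λ y → toCtx (X ▹ f ∙ l′) ⟦ var y ^ l ⟧) (sym (wk-toCtx (X ▹ f ∙ l′) x))))
    ...   | inj₂ (s′ , st , inj₁ d) = next (st (A-ctx (IsA-toCtx X)))
      (inj₁ (spine-↘ X {s′ = s′} (λ _ → id) d))
    ...   | inj₂ (s′ , st , inj₂ (d , w)) =
      next (st (A-ctx (IsA-toCtx X)))
           (inj₂ ((λ {ρ} → ↘⇒⊆ (toCtx X ⟦ _ ⟧) (toCtx X ⟦ s′ ⟧) (spine-↘ X {s′ = s′} (λ _ → id)
             (⊆⇒↘ {d′ = ⟪ s′ ⟫ ρ} d))) , weight-spine X w))

    under-letrec : ∀ {k} {bs : Vec (E (suc k + n)) (suc k)} {l s s′} → s ⟶name s′ →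
                   letrec bs s ^ l ⟶name letrec bs s′ ^ l
    under-letrec {bs = bs} {l} (beta {R = R} r)  = beta {R = letrec-i bs R ^ l} (letrec r)
    under-letrec {bs = bs} {l} (gcp {L = L} a r) = gcp {L = letrec-i bs L ^ l} (letrec a) r
    under-letrec {bs = bs} {l} (lapp {R = R} r)  = lapp {R = letrec-i bs R ^ l} (letrec r)
    under-letrec {bs = bs} {l} (lcase {R = R} r) = lcase {R = letrec-i bs R ^ l} (letrec r)
    under-letrec {bs = bs} {l} (lseq {R = R} r)  = lseq {R = letrec-i bs R ^ l} (letrec r)
    under-letrec {bs = bs} {l} (seq {R = R} r v) = seq {R = letrec-i bs R ^ l} (letrec r) v
    under-letrec {bs = bs} {l} (case {R = R} r)  = case {R = letrec-i bs R ^ l} (letrec r)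

    -- The look-up charge is released here: unfolding the binding gives a typing of the copy that is
    -- cheaper by one than the use of the variable.
    gcp-↘ : ∀ (bs : Vec (E (suc k + n)) (suc k)) {R : Ctx ⊤ m (suc k + n)} {x l l′ ρ} → IsR R →
            ⟪ letrec bs (R ⟦ var (wk R (x ↑ˡ n)) ^ l ⟧) ^ l′ ⟫ ρ ↘[ 1 ]
            ⟪ letrec bs (R ⟦ ren (wk R) (lookup bs x) ⟧) ^ l′ ⟫ ρ
    gcp-↘ bs {R} {x} {ρ = ρ} r = R-↘ r (var (wk R (x ↑ˡ _)) ^ _) (ren (wk R) (lookup bs x))
      λ { θ e (up-to v le) →
      let q , le′ , v′ = rec-unfold bs x (⊆-≡ (trans (e _) (ext-↑ˡ (rec bs ρ) ρ x)) v)
      in  q , ≤-trans le′ le , ren→ (lookup bs x) (wk R) (λ z → ⊆-≡ (sym (e z))) v′ }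

    progress : ∀ (s : E n) {ρ} → ⟪ s ⟫ ρ τ p → Progress s
    progress (var x ^ _)       h = need [·] x (A-ctx [·]) refl
    progress (app s t ^ l)     h = progress-framed (view-⊙ (app t) l (view s)) h
    progress (lam s ^ _)       h = done (answer [·] lam)
    progress (con κ i ss ^ _)  h = done (answer [·] con)
    progress (seq s t ^ l)     h = progress-framed (view-⊙ (seq t) l (view s)) h
    progress (case κ s rs ^ l) h = progress-framed (view-⊙ (case κ rs) l (view s)) h
    progress {n} (letrec {k} bs t ^ l) h with progress t h
    ... | done (answer L v)     = done (answer (letrec L) v)
    ... | next st (inj₁ d)      = next (under-letrec st) (inj₁ d)
    ... | next st (inj₂ (d , w)) =
      next (under-letrec st) (inj₂ (d , s≤s (+-monoʳ-< (weights bs) w)))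
    ... | need R x r refl with splitAt (suc k) x in eq
    ...   | inj₁ i with splitAt⁻¹-↑ˡ {suc k} {n} {x} {i} eq
    ...     | refl = next (gcp {L = [·]} [·] r) (inj₁ (gcp-↘ bs r))
    progress {n} (letrec {k} bs t ^ l) h | need R x r refl | inj₂ y with splitAt⁻¹-↑ʳ {suc k} {n} {x} {y} eq
    ...     | refl = need (letrec-i bs R ^ l) y (letrec r) refl

    name-adequate : ∀ (s : E n) → ⟪ s ⟫ none ⋆ p → s ↓name
    name-adequate = terminates λ {s} {p} h → classify s h (progress s h)
      where
      classify : ∀ {p} s → ⟪ s ⟫ none ⋆ p → Progress s → AnswerName s ⊎ ∃ λ s′ → s ⟶name s′ × Smaller s p s′
      classify s h (done a)               = inj₁ a
      classify s h (next st (inj₁ d))     = let q , l , h′ = d h in inj₂ (_ , st , inj₁ (q , l , h′))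
      classify s h (next st (inj₂ (d , w))) = inj₂ (_ , st , inj₂ (d h , w))
      -- A variable without any type drops by every amount vacuously. A drop by `suc p`, more than
      -- the entire cost, refutes the typing.
      classify {p} s h (need R x {l} r refl) with R-↘ {k = suc p} r (var (wk R x) ^ l)
        (var (wk R x) ^ l) nothing h
        where
        nothing : ∀ θ → (∀ x → θ (wk R x) ≡ none x) → ⟪ var (wk R x) ^ l ⟫ θ ↘[ suc p ] ⟪ var (wk R x) ^ l ⟫ θ
        nothing θ e (up-to v _) = ⊥-elim (subst (λ d → d _ _) (e x) v)
      ... | q , le , _ = ⊥-elim (<-irrefl refl (≤-trans (s≤s (m≤m+n p q)) le))

  -- Heaps

  lookup-rens : ∀ (f : Fin n → Fin m) (ss : Vec (Exp A n) k) i → lookup (rens f ss) i ≡ ren f (lookup ss i)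
  lookup-rens f (_ ∷ _)  zero    = refl
  lookup-rens f (_ ∷ ss) (suc i) = lookup-rens f ss i

  lookup-maps : ∀ (f : A → A′) (ss : Vec (Exp A n) k) i → lookup (mapsᵃ f ss) i ≡ mapᵃ f (lookup ss i)
  lookup-maps f (_ ∷ _)  zero    = refl
  lookup-maps f (_ ∷ ss) (suc i) = lookup-maps f ss i

  update-elim : ∀ {X : Set} {ℓ} (xs : Vec X k) y {e} (P : Fin k → X → Set ℓ) → P y e →
                (∀ i → i ≢ y → P i (lookup xs i)) → ∀ i → P i (lookup (xs [ y ]≔ e) i)
  update-elim xs y {e} P h h′ i with i ≟ y
  ... | yes refl = subst (P i) (sym (lookup∘update i xs e)) h
  ... | no i≢y   = subst (P i) (sym (lookup∘update′ i≢y xs e)) (h′ i i≢y)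

  outer-↑ˡ : ∀ (i : Fin k) → outer {n} k a (i ↑ˡ n) ≡ (i ↑ˡ a) ↑ˡ n
  outer-↑ˡ {k} {n} {a} i = cong [ (λ i → (i ↑ˡ a) ↑ˡ n) , (k + a) ↑ʳ_ ]′ (splitAt-↑ˡ k i n)

  ext-outer : ∀ (ψ : Env (k + a)) (ρ : Env n) x → ext ψ ρ (outer k a x) ≡ ext (ψ ∘ (_↑ˡ a)) ρ x
  ext-outer {k} {a} {n} ψ ρ x with splitAt k x
  ... | inj₁ i = ext-↑ˡ ψ ρ (i ↑ˡ a)
  ... | inj₂ y = ext-↑ʳ ψ ρ y

  ext-added : ∀ (ψ : Env (k + a)) (ρ : Env n) j → ext ψ ρ (added k a j) ≡ ψ (k ↑ʳ j)
  ext-added {k} {a} {n} ψ ρ j = ext-↑ˡ ψ ρ (k ↑ʳ j)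

  ext-inner : ∀ (ψ : Env (k + a)) (ρ : Env n) x →
              ext ψ ρ (inner k a x) ≡ ext (ψ ∘ (k ↑ʳ_)) (ext (ψ ∘ (_↑ˡ a)) ρ) x
  ext-inner {k} {a} {n} ψ ρ x with splitAt a x
  ... | inj₁ j = ext-added ψ ρ j
  ... | inj₂ y = ext-outer ψ ρ y

  ext-ext-outer : ∀ (φ : Env k) (χ : Env a) (ρ : Env n) x → ext (ext φ χ) ρ (outer k a x) ≡ ext φ ρ x
  ext-ext-outer {k} φ χ ρ x with splitAt k x
  ... | inj₁ i = trans (ext-↑ˡ (ext φ χ) ρ _) (ext-↑ˡ φ χ i)
  ... | inj₂ y = ext-↑ʳ (ext φ χ) ρ y

  ext-ext-added : ∀ (φ : Env k) (χ : Env a) (ρ : Env n) j → ext (ext φ χ) ρ (added k a j) ≡ χ j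
  ext-ext-added {k} φ χ ρ j = trans (ext-added {k} (ext φ χ) ρ j) (ext-↑ʳ φ χ j)

  ext-ext-inner : ∀ (φ : Env k) (χ : Env a) (ρ : Env n) x →
                  ext (ext φ χ) ρ (inner k a x) ≡ ext χ (ext φ ρ) x
  ext-ext-inner {k} {a} φ χ ρ x with splitAt a x
  ... | inj₁ j = ext-ext-added φ χ ρ j
  ... | inj₂ y = ext-ext-outer φ χ ρ y

  chain-map : ∀ {P Q : Fin k → Set} {bs : Vec (Exp A (k + n)) k} {bs′ : Vec (Exp A′ (k + n)) k} {x₁ x} →
              (∀ {i} → P i → Q i) → (∀ {i z l} → P i → lookup bs i ≡ var z ^ l → ∃ λ l′ →
                lookup bs′ i ≡ var z ^ l′) →
              Chain P bs x₁ x → Chain Q bs′ x₁ x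
  chain-map f g (start p)      = start (f p)
  chain-map f g (link ch p eq) = link (chain-map f g ch) (f p) (proj₂ (g p eq))

  -- With free look-ups a variable has the same types at the same costs as its right-hand side.
  -- Aliases in a chain thus become interchangeable, and heaps can be rearranged without touching
  -- costs.
  module Uncharged (b : ℕ) where
    open Model b 0
    open Local b 0

    private variable
      ρ : Env n

    fold← : ∀ (bs : Vec (Exp A (k + n)) k) i → ⟪ lookup bs i ⟫ (heap bs ρ) ⊆ rec bs ρ i
    fold← bs i h = rec-fold bs i h ≤-refl

    unfold→ : ∀ (bs : Vec (Exp A (k + n)) k) i → rec bs ρ i ⊆ ⟪ lookup bs i ⟫ (heap bs ρ)
    unfold→ bs i h with rec-unfold bs i h
    ... | _ , l , h′ = up (lookup bs i) h′ l

    least : ∀ (bs : Vec (Exp A (k + n)) k) {φ} → (∀ i → ⟪ lookup bs i ⟫ (ext φ ρ) ⊆ φ i) → rec bs ρ ⊑ φ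
    least bs h = rec-least bs λ i h′ l → h i (up (lookup bs i) h′ l)

    -- By leastness of the first heap, the second one only has to be a prefixed point of the first
    -- group of bindings; both right-hand sides are compared in the second heap.
    rec-⊑ : ∀ (bs : Vec (Exp A (k + n)) k) (bs′ : Vec (Exp A′ (k + n)) k) →
            (∀ i → ⟪ lookup bs i ⟫ (heap bs′ ρ) ⊆ ⟪ lookup bs′ i ⟫ (heap bs′ ρ)) → rec bs ρ ⊑ rec bs′ ρ
    rec-⊑ bs bs′ h = least bs λ i x → fold← bs′ i (h i x)

    heap-⊑ : ∀ (bs : Vec (Exp A (k + n)) k) (bs′ : Vec (Exp A′ (k + n)) k) →
             rec bs ρ ⊑ rec bs′ ρ → heap bs ρ ⊑ heap bs′ ρ
    heap-⊑ bs bs′ h = ext-mono h (λ _ → id)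

    heap-rec→ : ∀ (bs : Vec (Exp A (k + n)) k) x → ⟪ lookup bs x ⟫ (heap bs ρ) ⊆ heap bs ρ (x ↑ˡ n)
    heap-rec→ {ρ = ρ} bs x h = ⊆-≡ (sym (ext-↑ˡ (rec bs ρ) ρ x)) (fold← bs x h)

    heap-rec← : ∀ (bs : Vec (Exp A (k + n)) k) x → heap bs ρ (x ↑ˡ n) ⊆ ⟪ lookup bs x ⟫ (heap bs ρ)
    heap-rec← {ρ = ρ} bs x h = unfold→ bs x (⊆-≡ (ext-↑ˡ (rec bs ρ) ρ x) h)

    chain→ : ∀ {P} {bs : Vec (Exp A (k + n)) k} {x₁ x} → Chain P bs x₁ x →
             heap bs ρ (x₁ ↑ˡ n) ⊆ heap bs ρ (x ↑ˡ n)
    chain→ (start _)              h = h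
    chain→ {bs = bs} (link {y = y} ch _ eq) h =
      heap-rec→ bs y (at-≡ _ (sym eq) (up-to (chain→ ch h) ≤-refl))

    chain← : ∀ {P} {bs : Vec (Exp A (k + n)) k} {x₁ x} → Chain P bs x₁ x →
             heap bs ρ (x ↑ˡ n) ⊆ heap bs ρ (x₁ ↑ˡ n)
    chain← (start _)              h = h
    chain← {ρ = ρ} {bs = bs} {x₁} (link {y = y} ch _ eq) h with at-≡ _ eq (heap-rec← bs y h)
    ... | up-to v l = heap-rec→ bs x₁ (up (lookup bs x₁) (heap-rec← bs x₁ (chain← ch v)) l)

    chain-value→ : ∀ {P} {bs : Vec (Exp A (k + n)) k} {x₁ x v} → lookup bs x₁ ≡ v → Chain P bs x₁ x →
                   ⟪ v ⟫ (heap bs ρ) ⊆ heap bs ρ (x ↑ˡ n)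
    chain-value→ {bs = bs} {x₁} refl ch h = chain→ ch (heap-rec→ bs x₁ h)

    chain-value← : ∀ {P} {bs : Vec (Exp A (k + n)) k} {x₁ x v} → lookup bs x₁ ≡ v → Chain P bs x₁ x →
                   heap bs ρ (x ↑ˡ n) ⊆ ⟪ v ⟫ (heap bs ρ)
    chain-value← {bs = bs} {x₁} refl ch h = heap-rec← bs x₁ (chain← ch h)

    -- The bindings made by `bind` do not refer to one another, so their fixed point is reached
    -- after a single unfolding.
    bind-rec→ : ∀ (ss : Vec (LExp n) (suc k)) → ⟪ ss ⟫s ρ ⊑ rec (rens (suc k ↑ʳ_) ss) ρ
    bind-rec→ {k = k} {ρ} ss i h = fold← (rens (suc k ↑ʳ_) ss) i
      (at-≡ _ (sym (lookup-rens (suc k ↑ʳ_) ss i))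
        (renᵏ→ {k = suc k} (lookup ss i) (⊆-≡ (⟪⟫s-lookup ss ρ i) h)))

    bind-rec← : ∀ (ss : Vec (LExp n) (suc k)) → rec (rens (suc k ↑ʳ_) ss) ρ ⊑ ⟪ ss ⟫s ρ
    bind-rec← {k = k} {ρ} ss i h = ⊆-≡ (sym (⟪⟫s-lookup ss ρ i))
      (renᵏ← {k = suc k} (lookup ss i)
        (at-≡ _ (lookup-rens (suc k ↑ʳ_) ss i) (unfold→ (rens (suc k ↑ʳ_) ss) i h)))

    bind→ : ∀ (ss : Vec (LExp n) k) t → ⟪ t ⟫ (ext (⟪ ss ⟫s ρ) ρ) ⊆ ⟪ bind ss t ⟫ ρ
    bind→ []          t h = h
    bind→ ss@(_ ∷ _)  t h = mono t (ext-mono (bind-rec→ ss) (λ _ → id)) h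

    bind← : ∀ (ss : Vec (LExp n) k) t → ⟪ bind ss t ⟫ ρ ⊆ ⟪ t ⟫ (ext (⟪ ss ⟫s ρ) ρ)
    bind← []          t h = h
    bind← ss@(_ ∷ _)  t h = mono t (ext-mono (bind-rec← ss) (λ _ → id)) h

    vars : (Fin k → Fin n) → Vec (LExp n) k
    vars v = tabulate λ j → var (v j) ^ ∅

    vars→ : ∀ (v : Fin k → Fin n) j → Up (ρ (v j)) ⊆ ⟪ vars v ⟫s ρ j
    vars→ {ρ = ρ} v j h = ⊆-≡ (sym (⟪⟫s-lookup (vars v) ρ j))
      (at-≡ _ (sym (lookup∘tabulate (λ j → var (v j) ^ ∅) j)) h)

    vars← : ∀ (v : Fin k → Fin n) j → ⟪ vars v ⟫s ρ j ⊆ Up (ρ (v j))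
    vars← {ρ = ρ} v j h =
      at-≡ _ (lookup∘tabulate (λ j → var (v j) ^ ∅) j) (⊆-≡ (⟪⟫s-lookup (vars v) ρ j) h)

    vars-⊑ : ∀ (v : Fin k → Fin n) (v′ : Fin k → Fin m) {ρ ρ′} → (∀ j → ρ (v j) ⊆ ρ′ (v′ j)) →
             ⟪ vars v ⟫s ρ ⊑ ⟪ vars v′ ⟫s ρ′
    vars-⊑ v v′ h j x = vars→ v′ j (Up-mono (h j) (vars← v j x))

    case-var→ : ∀ {κ i} (rs : Alts Label n (ar κ)) {z l l′} v → ρ z ⊆ Con κ i (⟪ vars v ⟫s ρ) →
                ⟪ case κ (var z ^ l) rs ^ l′ ⟫ ρ ↘[ b ] ⟪ bind (vars v) (lookup⁺ rs i) ⟫ ρ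
    case-var→ {i = i} rs {l = l} {l′} v h (case (up-to f le) al pay)
      with case-con→ (vars v) rs {l} {l′} (case (h f) al (≤-trans (+-monoʳ-≤ b (+-monoˡ-≤ _ le)) pay))
    ... | q , le′ , x = q , le′ , bind→ (vars v) (lookup⁺ rs i) x

    case-var← : ∀ {κ i} (rs : Alts Label n (ar κ)) {z l l′} v → Con κ i (⟪ vars v ⟫s ρ) ⊆ ρ z →
                ⟪ bind (vars v) (lookup⁺ rs i) ⟫ ρ τ p → ⟪ case κ (var z ^ l) rs ^ l′ ⟫ ρ τ (b + p)
    case-var← {i = i} rs {l = l} {l′} v h x with case-con← (vars v) rs {l} {l′}
      (bind← (vars v) (lookup⁺ rs i) x)
    ... | case f al pay = case (up-to (h f) ≤-refl) al pay

    -- Effect of case-in and case-e on the heap: the arguments ss of the constructor at x₁ become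
    -- bindings of their own.
    module Share {k n κ i} (bs : Vec (LExp (suc k + n)) (suc k))
      (ss : Vec (LExp (suc k + n)) (lookup (ar κ) i))
                 {x₁} {l} (eq₁ : lookup bs x₁ ≡ con κ i ss ^ l)
                 (B : Vec (LExp ((suc k + lookup (ar κ) i) + n)) (suc k)) (ρ : Env n) where
      α : ℕ
      α = lookup (ar κ) i

      w : Fin (suc k + n) → Fin ((suc k + α) + n)
      w = outer (suc k) α

      y : Fin α → Fin ((suc k + α) + n)
      y = added (suc k) α

      -- `B` stands for the old bindings after the step. It is a parameter because case-e, unlike
      -- case-in, also rewrites the binding that contains the redex.
      bs′ : Vec (LExp ((suc k + α) + n)) (suc k + α)
      bs′ = B ++ᵛ rens w ss

      φ : Env (suc k)
      φ = rec bs ρ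

      χ : Env α
      χ = ⟪ ss ⟫s (heap bs ρ)

      ψ : Env (suc k + α)
      ψ = rec bs′ ρ

      -- `ψ₁` interprets the old scope by the new heap, and `ψ′` the new scope by the old heap.
      -- These are the candidates for fixed point induction, used by `rec→` and `rec←` respectively.
      ψ₁ : Env (suc k + n)
      ψ₁ = ext (ψ ∘ (_↑ˡ α)) ρ

      ψ′ : Env ((suc k + α) + n)
      ψ′ = ext (ext φ χ) ρ

      ren-w→ : ∀ (e : LExp (suc k + n)) → ⟪ e ⟫ ψ₁ ⊆ ⟪ ren w e ⟫ (heap bs′ ρ)
      ren-w→ e = ren→ e w λ x → ⊆-≡ (sym (ext-outer ψ ρ x))

      ren-w← : ∀ (e : LExp (suc k + n)) → ⟪ ren w e ⟫ ψ′ ⊆ ⟪ e ⟫ (heap bs ρ)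
      ren-w← e = ren← e w λ x → ⊆-≡ (ext-ext-outer φ χ ρ x)

      added-eq : ∀ j → lookup bs′ (suc k ↑ʳ j) ≡ ren w (lookup ss j)
      added-eq j = trans (lookup-++ʳ B (rens w ss) j) (lookup-rens w ss j)

      con-y→ : ⟪ lookup bs x₁ ⟫ ψ₁ ⊆ ⟪ con κ i (vars y) ^ ∅ ⟫ (heap bs′ ρ)
      con-y→ h = Con-mono
        (λ j x → vars→ y j (up-to (heap-rec→ bs′ (suc k ↑ʳ j)
          (at-≡ _ (sym (added-eq j)) (ren-w→ (lookup ss j) (⊆-≡ (⟪⟫s-lookup ss ψ₁ j) x)))) ≤-refl))
        (at-≡ ψ₁ eq₁ h)

      Up-χ : ∀ j → Up (χ j) ⊆ χ j
      Up-χ j (up-to v le) = ⊆-≡ (sym (⟪⟫s-lookup ss (heap bs ρ) j))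
        (up (lookup ss j) (⊆-≡ (⟪⟫s-lookup ss (heap bs ρ) j) v) le)

      con-y← : ∀ {θ : Env m} (v : Fin α → Fin m) → (∀ j → θ (v j) ≡ ψ′ (y j)) →
               Con κ i (⟪ vars v ⟫s θ) ⊆ ⟪ lookup bs x₁ ⟫ (heap bs ρ)
      con-y← v e h = at-≡ _ (sym eq₁) (Con-mono
        (λ j x → Up-χ j (Up-mono (⊆-≡ (trans (e j) (ext-ext-added {suc k} φ χ ρ j))) (vars← v j x))) h)

      rec→ : (∀ i → ⟪ lookup bs i ⟫ ψ₁ ⊆ ⟪ lookup B i ⟫ (heap bs′ ρ)) → φ ⊑ ψ ∘ (_↑ˡ α)
      rec→ h = least bs λ i x → fold← bs′ (i ↑ˡ α)
        (at-≡ _ (sym (lookup-++ˡ B (rens w ss) i)) (h i x))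

      rec← : (∀ i → ⟪ lookup B i ⟫ ψ′ ⊆ ⟪ lookup bs i ⟫ (heap bs ρ)) → ψ ⊑ ext φ χ
      rec← h = least bs′ (ext-elim {φ = φ} {χ} (λ z d → ⟪ lookup bs′ z ⟫ ψ′ ⊆ d)
        (λ i x → fold← bs i (h i (at-≡ _ (lookup-++ˡ B (rens w ss) i) x)))
        (λ j x → ⊆-≡ (sym (⟪⟫s-lookup ss (heap bs ρ) j))
                   (ren-w← (lookup ss j) (at-≡ _ (added-eq j) x))))

      chain-bs′ : ∀ {P x} → (∀ {z} → P z → z ≢ x₁ → lookup B z ≡ ren w (lookup bs z)) →
                  Chain P bs x₁ x → Chain (λ _ → ⊤) bs′ (x₁ ↑ˡ α) (x ↑ˡ α)
      chain-bs′ h (start _)       = start tt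
      chain-bs′ h (link {x} {z} ch p eq) = link (chain-bs′ h ch) tt
        (trans (lookup-++ˡ B (rens w ss) z) (trans (h p z≢x₁)
          (trans (cong (ren w) eq) (cong (λ z → var z ^ _) (outer-↑ˡ {suc k} x)))))
        where
        z≢x₁ : z ≢ x₁
        z≢x₁ refl with trans (sym eq₁) eq
        ... | ()

      hole→ : ∀ {x v} (f : Fin ((suc k + α) + n) → Fin m) (rs : Alts Label m (ar κ)) {l l′} →
              lookup B x₁ ≡ con κ i (vars y) ^ v → Chain (λ _ → ⊤) bs′ (x₁ ↑ˡ α) (x ↑ˡ α) →
              ∀ {θ} → (∀ z → θ (f z) ≡ heap bs′ ρ z) →
              ⟪ case κ (var (f (w (x ↑ˡ n))) ^ l) rs ^ l′ ⟫ θ ↘[ b ] ⟪ bind (vars (f ∘ y)) (lookup⁺ rs i) ⟫ θ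
      hole→ {x = x} f rs {l} {l′} eq ch e = case-var→ rs {l = l} {l′} (f ∘ y) λ h →
        Con-mono (vars-⊑ y (f ∘ y) λ j → ⊆-≡ (sym (e (y j))))
          (chain-value← {bs = bs′} (trans (lookup-++ˡ B (rens w ss) x₁) eq) ch
            (⊆-≡ (trans (e _) (cong (heap bs′ ρ) (outer-↑ˡ {suc k} x))) h))

      hole← : ∀ {P x} (f : Fin ((suc k + α) + n) → Fin m) (rs : Alts Label m (ar κ)) {l l′} →
              Chain P bs x₁ x → ∀ {θ} → (∀ z → θ (f z) ≡ ψ′ z) →
              ⟪ bind (vars (f ∘ y)) (lookup⁺ rs i) ⟫ θ τ p →
              ⟪ case κ (var (f (w (x ↑ˡ n))) ^ l) rs ^ l′ ⟫ θ τ (b + p)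
      hole← {x = x} f rs {l} {l′} ch e = case-var← rs {l = l} {l′} (f ∘ y) λ h →
        ⊆-≡ (sym (trans (e _) (ext-ext-outer φ χ ρ (x ↑ˡ n))))
          (chain-value→ {bs = bs} refl ch (con-y← (f ∘ y) (λ j → e (y j)) h))

    -- Effect of llet-in and llet-e on the heap.
    module Merge {k a n} (bs₁ : Vec (LExp (suc k + n)) (suc k))
      (bs₂ : Vec (LExp (suc a + (suc k + n))) (suc a))
                 (bs₁′ : Vec (LExp ((suc k + suc a) + n)) (suc k)) (ρ : Env n) where
      w : Fin (suc k + n) → Fin ((suc k + suc a) + n)
      w = outer (suc k) (suc a)

      v : Fin (suc a + (suc k + n)) → Fin ((suc k + suc a) + n)
      v = inner (suc k) (suc a)

      bs′ : Vec (LExp ((suc k + suc a) + n)) (suc k + suc a)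
      bs′ = bs₁′ ++ᵛ rens v bs₂

      φ : Env (suc k)
      φ = rec bs₁ ρ

      χ : Env (suc a)
      χ = rec bs₂ (heap bs₁ ρ)

      ψ : Env (suc k + suc a)
      ψ = rec bs′ ρ

      ψ₁ : Env (suc k + n)
      ψ₁ = ext (ψ ∘ (_↑ˡ suc a)) ρ

      ren-w→ : ∀ (e : LExp (suc k + n)) → ⟪ e ⟫ ψ₁ ⊆ ⟪ ren w e ⟫ (heap bs′ ρ)
      ren-w→ e = ren→ e w λ x → ⊆-≡ (sym (ext-outer ψ ρ x))

      ren-w← : ∀ (e : LExp (suc k + n)) → ⟪ ren w e ⟫ (ext (ext φ χ) ρ) ⊆ ⟪ e ⟫ (heap bs₁ ρ)
      ren-w← e = ren← e w λ x → ⊆-≡ (ext-ext-outer φ χ ρ x)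

      rec₂→ : rec bs₂ ψ₁ ⊑ ψ ∘ (suc k ↑ʳ_)
      rec₂→ = least bs₂ λ j x → fold← bs′ (suc k ↑ʳ j)
        (at-≡ _ (sym (trans (lookup-++ʳ bs₁′ (rens v bs₂) j) (lookup-rens v bs₂ j)))
          (ren→ (lookup bs₂ j) v (λ z → ⊆-≡ (sym (ext-inner {suc k} {suc a} ψ ρ z))) x))

      body→ : ∀ (s : LExp (suc a + (suc k + n))) → ⟪ s ⟫ (heap bs₂ ψ₁) ⊆ ⟪ ren v s ⟫ (heap bs′ ρ)
      body→ s x = ren→ s v (λ z → ⊆-≡ (sym (ext-inner {suc k} {suc a} ψ ρ z)))
        (mono s (ext-mono rec₂→ (λ _ → id)) x)

      body← : ∀ (s : LExp (suc a + (suc k + n))) →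
              ⟪ ren v s ⟫ (ext (ext φ χ) ρ) ⊆ ⟪ s ⟫ (heap bs₂ (heap bs₁ ρ))
      body← s = ren← s v λ z → ⊆-≡ (ext-ext-inner {suc k} {suc a} φ χ ρ z)

      rec→ : (∀ i → ⟪ lookup bs₁ i ⟫ ψ₁ ⊆ ⟪ lookup bs₁′ i ⟫ (heap bs′ ρ)) → φ ⊑ ψ ∘ (_↑ˡ suc a)
      rec→ h = least bs₁ λ i x → fold← bs′ (i ↑ˡ suc a)
        (at-≡ _ (sym (lookup-++ˡ bs₁′ (rens v bs₂) i)) (h i x))

      rec← : (∀ i → ⟪ lookup bs₁′ i ⟫ (ext (ext φ χ) ρ) ⊆ ⟪ lookup bs₁ i ⟫ (heap bs₁ ρ)) → ψ ⊑ ext φ χ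
      rec← h = least bs′ (ext-elim {φ = φ} {χ} (λ z d → ⟪ lookup bs′ z ⟫ (ext (ext φ χ) ρ) ⊆ d)
        (λ i x → fold← bs₁ i (h i (at-≡ _ (lookup-++ˡ bs₁′ (rens v bs₂) i) x)))
        (λ j x → fold← bs₂ j (body← (lookup bs₂ j)
          (at-≡ _ (trans (lookup-++ʳ bs₁′ (rens v bs₂) j) (lookup-rens v bs₂ j)) x))))

  -- Call-by-need: soundness

  map-∘  : ∀ {X Y Z : Set} {g : Y → Z} {f : X → Y} {h : X → Z} → (∀ x → g (f x) ≡ h x) →
           ∀ (s : Exp X n) → mapᵃ g (mapᵃ f s) ≡ mapᵃ h s
  maps-∘ : ∀ {X Y Z : Set} {g : Y → Z} {f : X → Y} {h : X → Z} → (∀ x → g (f x) ≡ h x) →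
           ∀ (ss : Vec (Exp X n) k) → mapsᵃ g (mapsᵃ f ss) ≡ mapsᵃ h ss
  mapa-∘ : ∀ {X Y Z : Set} {g : Y → Z} {f : X → Y} {h : X → Z} → (∀ x → g (f x) ≡ h x) →
           ∀ {as : Vec ℕ k} (rs : Alts X n as) → mapAltsᵃ g (mapAltsᵃ f rs) ≡ mapAltsᵃ h rs
  map-∘ e (var x ^ l)       = cong (var x ^_) (e l)
  map-∘ e (app s t ^ l)     = cong₂ _^_ (cong₂ app (map-∘ e s) (map-∘ e t)) (e l)
  map-∘ e (lam s ^ l)       = cong₂ _^_ (cong lam (map-∘ e s)) (e l)
  map-∘ e (letrec bs t ^ l) = cong₂ _^_ (cong₂ letrec (maps-∘ e bs) (map-∘ e t)) (e l)
  map-∘ e (con κ i ss ^ l)  = cong₂ _^_ (cong (con κ i) (maps-∘ e ss)) (e l)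
  map-∘ e (seq s t ^ l)     = cong₂ _^_ (cong₂ seq (map-∘ e s) (map-∘ e t)) (e l)
  map-∘ e (case κ s rs ^ l) = cong₂ _^_ (cong₂ (case κ) (map-∘ e s) (mapa-∘ e rs)) (e l)
  maps-∘ e []       = refl
  maps-∘ e (s ∷ ss) = cong₂ _∷_ (map-∘ e s) (maps-∘ e ss)
  mapa-∘ e []       = refl
  mapa-∘ e (r ∷ rs) = cong₂ _∷_ (map-∘ e r) (mapa-∘ e rs)

  map-id  : ∀ (s : E n) → erase s ≡ s
  maps-id : ∀ (ss : Vec (E n) k) → mapsᵃ (λ _ → tt) ss ≡ ss
  mapa-id : ∀ {as : Vec ℕ k} (rs : Alts ⊤ n as) → mapAltsᵃ (λ _ → tt) rs ≡ rs
  map-id (var x ^ l)       = refl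
  map-id (app s t ^ l)     = cong (_^ tt) (cong₂ app (map-id s) (map-id t))
  map-id (lam s ^ l)       = cong (_^ tt) (cong lam (map-id s))
  map-id (letrec bs t ^ l) = cong (_^ tt) (cong₂ letrec (maps-id bs) (map-id t))
  map-id (con κ i ss ^ l)  = cong (_^ tt) (cong (con κ i) (maps-id ss))
  map-id (seq s t ^ l)     = cong (_^ tt) (cong₂ seq (map-id s) (map-id t))
  map-id (case κ s rs ^ l) = cong (_^ tt) (cong₂ (case κ) (map-id s) (mapa-id rs))
  maps-id []       = refl
  maps-id (s ∷ ss) = cong₂ _∷_ (map-id s) (maps-id ss)
  mapa-id []       = refl
  mapa-id (r ∷ rs) = cong₂ _∷_ (map-id r) (mapa-id rs)

  unlabelled : E n → LExp n
  unlabelled = mapᵃ (λ _ → ∅)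

  erase-unlabelled : ∀ (s : E n) → erase (unlabelled s) ≡ s
  erase-unlabelled s = trans (map-∘ (λ _ → refl) s) (map-id s)

  erase-initial : ∀ (s : E n) → erase (initial s) ≡ s
  erase-initial s@(var _ ^ _)      = erase-unlabelled s
  erase-initial s@(app _ _ ^ _)    = erase-unlabelled s
  erase-initial s@(lam _ ^ _)      = erase-unlabelled s
  erase-initial s@(letrec _ _ ^ _) = erase-unlabelled s
  erase-initial s@(con _ _ _ ^ _)  = erase-unlabelled s
  erase-initial s@(seq _ _ ^ _)    = erase-unlabelled s
  erase-initial s@(case _ _ _ ^ _) = erase-unlabelled s

  erase-plug  : ∀ (C : LCtx m n) {u u′} → erase u ≡ erase u′ → erase (C ⟦ u ⟧) ≡ erase (C ⟦ u′ ⟧)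
  erase-plugs : ∀ (C : VecCtx Label m n k) {u u′} → erase u ≡ erase u′ →
                mapsᵃ (λ _ → tt) (plugs C u) ≡ mapsᵃ (λ _ → tt) (plugs C u′)
  erase-pluga : ∀ {as : Vec ℕ k} (C : AltsCtx Label m n as) {u u′} → erase u ≡ erase u′ →
                mapAltsᵃ (λ _ → tt) (plugAlts C u) ≡ mapAltsᵃ (λ _ → tt) (plugAlts C u′)
  erase-plug [·]                  h = h
  erase-plug (app₁ C t ^ _)       h = cong (λ s → app s _ ^ _) (erase-plug C h)
  erase-plug (app₂ s C ^ _)       h = cong (λ t → app _ t ^ _) (erase-plug C h)
  erase-plug (lam C ^ _)          h = cong (λ s → lam s ^ _) (erase-plug C h)
  erase-plug (letrec-e Cs t ^ _)  h = cong (λ bs → letrec bs _ ^ _) (erase-plugs Cs h)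
  erase-plug (letrec-i bs C ^ _)  h = cong (λ t → letrec _ t ^ _) (erase-plug C h)
  erase-plug (con κ i Cs ^ _)     h = cong (λ ss → con κ i ss ^ _) (erase-plugs Cs h)
  erase-plug (seq₁ C t ^ _)       h = cong (λ s → seq s _ ^ _) (erase-plug C h)
  erase-plug (seq₂ s C ^ _)       h = cong (λ t → seq _ t ^ _) (erase-plug C h)
  erase-plug (case κ C rs ^ _)    h = cong (λ s → case κ s _ ^ _) (erase-plug C h)
  erase-plug (alt κ s Cs ^ _)     h = cong (λ rs → case κ _ rs ^ _) (erase-pluga Cs h)
  erase-plugs (here C ss)  h = cong (_∷ _) (erase-plug C h)
  erase-plugs (there s Cs) h = cong (_ ∷_) (erase-plugs Cs h)
  erase-pluga (here C rs)  h = cong (_∷ _) (erase-plug C h)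
  erase-pluga (there r Cs) h = cong (_ ∷_) (erase-pluga Cs h)

  erase-update : ∀ (bs : Vec (LExp n) k) x {e e′} → lookup bs x ≡ e → erase e ≡ erase e′ →
                 mapsᵃ (λ _ → tt) bs ≡ mapsᵃ (λ _ → tt) (bs [ x ]≔ e′)
  erase-update (_ ∷ _)  zero    refl h = cong (_∷ _) h
  erase-update (_ ∷ bs) (suc x) eq   h = cong (_ ∷_) (erase-update bs x eq h)

  erase-^ : ∀ (e : Node Label n) {l l′} → erase (e ^ l) ≡ erase (e ^ l′)
  erase-^ (var _)      = refl
  erase-^ (app _ _)    = refl
  erase-^ (lam _)      = refl
  erase-^ (letrec _ _) = refl
  erase-^ (con _ _ _)  = refl
  erase-^ (seq _ _)    = refl
  erase-^ (case _ _ _) = refl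

  erase-▷ : ∀ {s t : LExp n} → s ▷ t → erase s ≡ erase t
  erase-▷ (letrec-T {e = e})   = cong (λ s → letrec _ s ^ _) (erase-^ e)
  erase-▷ (app-ST {e = e} _)   = cong (λ s → app s _ ^ _) (erase-^ e)
  erase-▷ (seq-ST {e = e} _)   = cong (λ s → seq s _ ^ _) (erase-^ e)
  erase-▷ (case-ST {e = e} _)  = cong (λ s → case _ s _ ^ _) (erase-^ e)
  erase-▷ (var-in {bs = bs} C {x} {e} eq) =
    cong₂ (λ bs t → letrec bs t ^ _) (erase-update bs x eq (erase-^ e)) (erase-plug C refl)
  erase-▷ (var-e {bs = bs} c {lab} {x} {y} {e} x≢y eq eq′) =
    cong (λ bs → letrec bs _ ^ _) (trans (erase-update bs x eq (erase-^ e))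
      (erase-update (bs [ x ]≔ _) y (trans (lookup∘update′ (x≢y ∘ sym) bs _) eq′)
        (erase-plug (c ^ lab) refl)))
  erase-▷ (var-var {bs = bs} {x} {y} {e} x≢y eq eq′) =
    cong (λ bs → letrec bs _ ^ _) (trans (erase-update bs x eq (erase-^ e))
      (erase-update (bs [ x ]≔ _) y (trans (lookup∘update′ (x≢y ∘ sym) bs _) eq′) refl))

  erase-Labelling : ∀ {s : E n} {l} → Labelling s l → erase l ≡ s
  erase-Labelling {n} {s} (sts , _) = trans (sym (go sts)) (erase-initial s)
    where
    go : ∀ {l₁ l₂ : LExp n} → Star (λ l₁ l₂ → _ × l₁ ⇝ l₂) l₁ l₂ → erase l₁ ≡ erase l₂
    go ε                         = refl
    go ((_ , inside D st) ◅ sts) = trans (erase-plug D (erase-▷ st)) (go sts)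

  module LRSoundness where
    open Model 0 0
    open Local 0 0
    open Uncharged 0

    in-heap : ∀ (C : LCtx m n) {u u′ ρ} →
              (∀ {θ} → (∀ x → θ (wk C x) ≡ ρ x) → ⟪ u ⟫ θ ⊆ ⟪ u′ ⟫ θ) → ⟪ C ⟦ u ⟧ ⟫ ρ ⊆ ⟪ C ⟦ u′ ⟧ ⟫ ρ
    in-heap C {u} {u′} h = ctx C (λ _ → id) (local λ l e _ x → mono u′ l (h e x))

    rec-⊑-update : ∀ (bs : Vec (LExp (k + n)) k) y {e ρ} →
                   ⟪ e ⟫ (heap bs ρ) ⊆ ⟪ lookup bs y ⟫ (heap bs ρ) → rec (bs [ y ]≔ e) ρ ⊑ rec bs ρ
    rec-⊑-update bs y {e} {ρ} h = rec-⊑ (bs [ y ]≔ e) bs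
      (update-elim bs y (λ i e → ⟪ e ⟫ (heap bs ρ) ⊆ ⟪ lookup bs i ⟫ (heap bs ρ)) h (λ _ _ → id))

    -- Where a rule changes bindings, leastness of the new heap reduces the claim to one inclusion
    -- per binding, with the variables interpreted by the old heap.
    ↦-sound : ∀ {l l′ : LExp n} {ρ} → l ↦ l′ → ⟪ l′ ⟫ ρ ⊆ ⟪ l ⟫ ρ
    ↦-sound (lbeta C {s} {t} {l}) = in-heap C λ _ x → lam-app← s t {S} {l} (bind← (t ∷ []) s x)
    ↦-sound {ρ = ρ} (cp-in {bs = bs} C {s = s} eq ch) = in-heap C λ e x → up-to
      (⊆-≡ (sym (e _)) (chain-value→ {bs = bs} eq ch (ren← (lam s ^ ∅) (wk C) (λ z → ⊆-≡ (e z)) x))) ≤-refl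
    ↦-sound {ρ = ρ} (cp-e {bs = bs} C {y = y} {s = s} {t} eq ch eq′) =
      mono t (heap-⊑ (bs [ y ]≔ _) bs (rec-⊑-update bs y
        (subst (λ e → _ ⊆ ⟪ e ⟫ _) (sym eq′) (in-heap C λ e x → up-to
          (⊆-≡ (sym (e _)) (chain-value→ {bs = bs} eq ch
            (ren← (lam s ^ ∅) (wk C) (λ z → ⊆-≡ (e z)) x))) ≤-refl))))
    ↦-sound (lapp C {bs} {s} {t} {l})       = in-heap C λ _ → float← (app t) bs s {S} {l} {∅} {∅}
    ↦-sound (lcase C {bs} {κ} {s} {rs} {l}) = in-heap C λ _ → float← (case κ rs) bs s {S} {l} {∅} {∅}
    ↦-sound (lseq C {bs} {s} {t} {l})       = in-heap C λ _ → float← (seq t) bs s {S} {l} {∅} {∅}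
    ↦-sound {ρ = ρ} (llet-in {k} {a} {bs₁} {bs₂} {s}) x =
      body← s (mono (ren v s) (ext-mono (rec← λ i →
        subst (λ e → ⟪ e ⟫ _ ⊆ _) (sym (lookup-rens w bs₁ i)) (ren-w← (lookup bs₁ i))) (λ _ → id)) x)
      where open Merge bs₁ bs₂ (rens (outer (suc k) (suc a)) bs₁) ρ
    ↦-sound {ρ = ρ} (llet-e {k} {a} {bs₁} {bs₂} {x} {s} {t} eq) h =
      ren-w← t (mono (ren w t) (ext-mono (rec←
        (update-elim (rens w bs₁) x (λ i e → ⟪ e ⟫ (ext (ext φ χ) ρ) ⊆ ⟪ lookup bs₁ i ⟫ (heap bs₁ ρ))
        (λ y → at-≡ (heap bs₁ ρ) (sym eq) (body← s y))
        (λ i _ → subst (λ e → ⟪ e ⟫ _ ⊆ _) (sym (lookup-rens w bs₁ i)) (ren-w← (lookup bs₁ i)))))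
          (λ _ → id)) h)
      where open Merge bs₁ bs₂ (rens (outer (suc k) (suc a)) bs₁ [ x ]≔ ren (inner (suc k) (suc a)) s) ρ
    ↦-sound (seq-c C {e} {s} {l} v) = in-heap C λ _ → seq← s {l = l} v
    ↦-sound (seq-in {bs = bs} C eq ch) = in-heap C λ e x →
      seq (up-to (⊆-≡ (sym (e _)) (chain-value→ {bs = bs} eq ch {p = 0} ⋆)) ≤-refl) x ≤-refl
    ↦-sound (seq-e {bs = bs} C {y = y} {t = t} eq ch eq′) =
      mono t (heap-⊑ (bs [ y ]≔ _) bs (rec-⊑-update bs y
        (subst (λ e → _ ⊆ ⟪ e ⟫ _) (sym eq′) (in-heap C λ e x →
           seq (up-to (⊆-≡ (sym (e _)) (chain-value→ {bs = bs} eq ch {p = 0} ⋆)) ≤-refl) x ≤-refl))))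
    ↦-sound (case-c C {i = i} {ss} {rs} {l}) = in-heap C λ _ x →
      case-con← ss rs {S} {l} (bind← ss (lookup⁺ rs i) x)
    ↦-sound {ρ = ρ} (case-in {k} {bs = bs} {t} {x₁} {τ = κ} {i} {l} {ss = ss} C {rs} eq ch eq′) h =
      ren-w← t (at-≡ _ (sym eq′) (in-heap C (λ e → hole← (wk C) rs {V} {l} ch e)
        (mono (C ⟦ bind (vars (wk C ∘ y)) (lookup⁺ rs i) ⟧)
          (ext-mono (rec← (update-elim (rens w bs) x₁ (λ i e → ⟪ e ⟫ ψ′ ⊆ ⟪ lookup bs i ⟫ (heap bs ρ))
          (con-y← y (λ _ → refl))
          (λ i _ → subst (λ e → ⟪ e ⟫ _ ⊆ _) (sym (lookup-rens w bs i)) (ren-w← (lookup bs i)))))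
            (λ _ → id)) h)))
      where
      open Share bs ss eq
        (rens (outer (suc k) (lookup (ar κ) i)) bs
          [ x₁ ]≔ con κ i (vars (added (suc k) (lookup (ar κ) i))) ^ ∅) ρ
    ↦-sound {ρ = ρ} (case-e {k} {bs = bs} {t} {x₁} {u = u} {κ} {i} {l} {ss = ss} C {rs} eq ch eq′) h =
      ren-w← t (mono (ren w t) (ext-mono (rec←
        (update-elim (rens w bs [ x₁ ]≔ _) u (λ i e → ⟪ e ⟫ ψ′ ⊆ ⟪ lookup bs i ⟫ (heap bs ρ))
          (λ x → ren-w← (lookup bs u) (at-≡ _ (sym eq′) (in-heap C (λ e → hole← (wk C) rs {V} {l} ch e) x)))
          (λ i _ → update-elim (rens w bs) x₁ (λ i e → ⟪ e ⟫ ψ′ ⊆ ⟪ lookup bs i ⟫ (heap bs ρ))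
            (con-y← y (λ _ → refl))
            (λ i _ → subst (λ e → ⟪ e ⟫ _ ⊆ _) (sym (lookup-rens w bs i)) (ren-w← (lookup bs i))) i)))
              (λ _ → id)) h)
      where
      open Share bs ss eq
        ((rens (outer (suc k) (lookup (ar κ) i)) bs
          [ x₁ ]≔ con κ i (vars (added (suc k) (lookup (ar κ) i))) ^ ∅)
          [ u ]≔ C ⟦ bind (vars (wk C ∘ added (suc k) (lookup (ar κ) i))) (lookup⁺ rs i) ⟧) ρ

    ⟶LR-sound : ∀ {s s′ : E n} {ρ} → s ⟶LR s′ → ⟪ s′ ⟫ ρ ⊆ ⟪ s ⟫ ρ
    ⟶LR-sound {s = s} {ρ = ρ} (step {l} {l′} lab st) h =
      subst (λ s → ⟪ s ⟫ ρ _ _) (erase-Labelling lab)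
        (map→ (λ _ → tt) l (λ _ → id) (↦-sound st (map← (λ _ → tt) l′ (λ _ → id) h)))

    answerLR-⋆ : ∀ {s : E n} {ρ} → AnswerLR s → ⟪ s ⟫ ρ ⋆ 0
    answerLR-⋆ (value v)      = value-⋆ v
    answerLR-⋆ (letrec-val v) = value-⋆ v
    answerLR-⋆ (letrec-con {bs = bs} eq ch) = up-to (chain-value→ {bs = bs} eq ch ⋆) ≤-refl

    ↓LR⇒⋆ : ∀ {s : E n} → s ↓LR → ⟪ s ⟫ none ⋆ 0
    ↓LR⇒⋆ (_ , ε , a)        = answerLR-⋆ a
    ↓LR⇒⋆ (_ , st ◅ sts , a) = ⟶LR-sound st (↓LR⇒⋆ (_ , sts , a))

  -- The labelling algorithm

  module Everywhere (P : ∀ {n} → Node Label n → Label → Set) where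
    every  : LExp n → Set
    everys : Vec (LExp n) k → Set
    everya : {as : Vec ℕ k} → Alts Label n as → Set
    every (var x ^ l)           = P (var x) l
    every (e@(app s t) ^ l)     = P e l × every s × every t
    every (e@(lam s) ^ l)       = P e l × every s
    every (e@(letrec bs t) ^ l) = P e l × everys bs × every t
    every (e@(con _ _ ss) ^ l)  = P e l × everys ss
    every (e@(seq s t) ^ l)     = P e l × every s × every t
    every (e@(case _ s rs) ^ l) = P e l × every s × everya rs
    everys []       = ⊤
    everys (s ∷ ss) = every s × everys ss
    everya []       = ⊤
    everya (r ∷ rs) = every r × everya rs

    every-top : ∀ (e : Node Label n) {l} → every (e ^ l) → P e l
    every-top (var x)      h       = h
    every-top (app _ _)    (h , _) = h
    every-top (lam _)      (h , _) = h
    every-top (letrec _ _) (h , _) = h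
    every-top (con _ _ _)  (h , _) = h
    every-top (seq _ _)    (h , _) = h
    every-top (case _ _ _) (h , _) = h

    everys-lookup : ∀ (ss : Vec (LExp n) k) i → everys ss → every (lookup ss i)
    everys-lookup (_ ∷ _)  zero    (h , _) = h
    everys-lookup (_ ∷ ss) (suc i) (_ , h) = everys-lookup ss i h

    every-hole  : ∀ (C : LCtx m n) {u} → every (C ⟦ u ⟧) → every u
    everys-hole : ∀ (C : VecCtx Label m n k) {u} → everys (plugs C u) → every u
    everya-hole : ∀ {as : Vec ℕ k} (C : AltsCtx Label m n as) {u} → everya (plugAlts C u) → every u
    every-hole [·]                h           = h
    every-hole (app₁ C _ ^ _)     (_ , h , _) = every-hole C h
    every-hole (app₂ _ C ^ _)     (_ , _ , h) = every-hole C h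
    every-hole (lam C ^ _)        (_ , h)     = every-hole C h
    every-hole (letrec-e C _ ^ _) (_ , h , _) = everys-hole C h
    every-hole (letrec-i _ C ^ _) (_ , _ , h) = every-hole C h
    every-hole (con _ _ C ^ _)    (_ , h)     = everys-hole C h
    every-hole (seq₁ C _ ^ _)     (_ , h , _) = every-hole C h
    every-hole (seq₂ _ C ^ _)     (_ , _ , h) = every-hole C h
    every-hole (case _ C _ ^ _)   (_ , h , _) = every-hole C h
    every-hole (alt _ _ C ^ _)    (_ , _ , h) = everya-hole C h
    everys-hole (here C _)  (h , _) = every-hole C h
    everys-hole (there _ C) (_ , h) = everys-hole C h
    everya-hole (here C _)  (h , _) = every-hole C h
    everya-hole (there _ C) (_ , h) = everya-hole C h

    module _ (P-∅ : ∀ {n} (e : Node Label n) → P e ∅) where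
      every-unlabelled  : ∀ (s : E n) → every (unlabelled s)
      everys-unlabelled : ∀ (ss : Vec (E n) k) → everys (mapsᵃ (λ _ → ∅) ss)
      everya-unlabelled : ∀ {as : Vec ℕ k} (rs : Alts ⊤ n as) → everya (mapAltsᵃ (λ _ → ∅) rs)
      every-unlabelled (var x ^ _)       = P-∅ (var x)
      every-unlabelled (app s t ^ _)     = P-∅ _ , every-unlabelled s , every-unlabelled t
      every-unlabelled (lam s ^ _)       = P-∅ _ , every-unlabelled s
      every-unlabelled (letrec bs t ^ _) = P-∅ _ , everys-unlabelled bs , every-unlabelled t
      every-unlabelled (con _ _ ss ^ _)  = P-∅ _ , everys-unlabelled ss
      every-unlabelled (seq s t ^ _)     = P-∅ _ , every-unlabelled s , every-unlabelled t
      every-unlabelled (case _ s rs ^ _) = P-∅ _ , every-unlabelled s , everya-unlabelled rs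
      everys-unlabelled []       = tt
      everys-unlabelled (s ∷ ss) = every-unlabelled s , everys-unlabelled ss
      everya-unlabelled []       = tt
      everya-unlabelled (r ∷ rs) = every-unlabelled r , everya-unlabelled rs

  body : Exp A n → Node A n
  body (e ^ _) = e

  mark : Label → E n → LExp n
  mark l s = body (unlabelled s) ^ l

  unlabelled≡mark : ∀ (s : E n) → unlabelled s ≡ mark ∅ s
  unlabelled≡mark (var _ ^ _)      = refl
  unlabelled≡mark (app _ _ ^ _)    = refl
  unlabelled≡mark (lam _ ^ _)      = refl
  unlabelled≡mark (letrec _ _ ^ _) = refl
  unlabelled≡mark (con _ _ _ ^ _)  = refl
  unlabelled≡mark (seq _ _ ^ _)    = refl
  unlabelled≡mark (case _ _ _ ^ _) = refl

  initial≡mark : ∀ (s : E n) → initial s ≡ mark T s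
  initial≡mark (var _ ^ _)      = refl
  initial≡mark (app _ _ ^ _)    = refl
  initial≡mark (lam _ ^ _)      = refl
  initial≡mark (letrec _ _ ^ _) = refl
  initial≡mark (con _ _ _ ^ _)  = refl
  initial≡mark (seq _ _ ^ _)    = refl
  initial≡mark (case _ _ _ ^ _) = refl

  -- Both fail rules display a variable labelled `S` inside a binding. Terms without such variables
  -- cannot fail, and this remains so while a label descends through frames.
  data NoVarS {n} : Node Label n → Label → Set where
    var    : ∀ {x l} → l ≢ S → NoVarS (var x) l
    app    : ∀ {s t l} → NoVarS (app s t) l
    lam    : ∀ {s l} → NoVarS (lam s) l
    letrec : ∀ {k} {bs : Vec _ (suc k)} {t l} → NoVarS (letrec bs t) l
    con    : ∀ {κ i ss l} → NoVarS (con κ i ss) l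
    seq    : ∀ {s t l} → NoVarS (seq s t) l
    case   : ∀ {κ s rs l} → NoVarS (case κ s rs) l

  -- No labelling rule and no fail rule looks at such a node.
  data Settled {n} : Node Label n → Label → Set where
    var    : ∀ {x l} → l ≢ S → Settled (var x) l
    app    : ∀ {s t l} → l ≢ S → l ≢ T → Settled (app s t) l
    lam    : ∀ {s l} → Settled (lam s) l
    letrec : ∀ {k} {bs : Vec _ (suc k)} {t l} → l ≢ T → Settled (letrec bs t) l
    con    : ∀ {κ i ss l} → Settled (con κ i ss) l
    seq    : ∀ {s t l} → l ≢ S → l ≢ T → Settled (seq s t) l
    case   : ∀ {κ s rs l} → l ≢ S → l ≢ T → Settled (case κ s rs) l

  module NV = Everywhere NoVarS
  module Q  = Everywhere Settled

  settled-∅ : ∀ (e : Node Label n) → Settled e ∅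
  settled-∅ (var _)      = var λ ()
  settled-∅ (app _ _)    = app (λ ()) λ ()
  settled-∅ (lam _)      = lam
  settled-∅ (letrec _ _) = letrec λ ()
  settled-∅ (con _ _ _)  = con
  settled-∅ (seq _ _)    = seq (λ ()) λ ()
  settled-∅ (case _ _ _) = case (λ ()) λ ()

  settled-unlabelled : ∀ (s : E n) → Q.every (unlabelled s)
  settled-unlabelled = Q.every-unlabelled settled-∅

  weaken : ∀ {e : Node Label n} {l} → Settled e l → NoVarS e l
  weaken (var h)    = var h
  weaken (app _ _)  = app
  weaken lam        = lam
  weaken (letrec _) = letrec
  weaken con        = con
  weaken (seq _ _)  = seq
  weaken (case _ _) = case

  module Implies {P P′ : ∀ {n} → Node Label n → Label → Set}
                 (h : ∀ {n} {e : Node Label n} {l} → Everywhere.every P (e ^ l) → P′ e l) where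
    private
      module P  = Everywhere P
      module P′ = Everywhere P′

    implies  : ∀ (e : LExp n) → P.every e → P′.every e
    impliess : ∀ (es : Vec (LExp n) k) → P.everys es → P′.everys es
    impliesa : ∀ {as : Vec ℕ k} (rs : Alts Label n as) → P.everya rs → P′.everya rs
    implies (var _ ^ _)       g               = h g
    implies (app s t ^ _)     g@(_ , g₁ , g₂) = h g , implies s g₁ , implies t g₂
    implies (lam s ^ _)       g@(_ , g₁)      = h g , implies s g₁
    implies (letrec bs t ^ _) g@(_ , g₁ , g₂) = h g , impliess bs g₁ , implies t g₂
    implies (con _ _ ss ^ _)  g@(_ , g₁)      = h g , impliess ss g₁
    implies (seq s t ^ _)     g@(_ , g₁ , g₂) = h g , implies s g₁ , implies t g₂
    implies (case _ s rs ^ _) g@(_ , g₁ , g₂) = h g , implies s g₁ , impliesa rs g₂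
    impliess []       _         = tt
    impliess (e ∷ es) (g , g′)  = implies e g , impliess es g′
    impliesa []       _         = tt
    impliesa (r ∷ rs) (g , g′)  = implies r g , impliesa rs g′

  Q⇒NoVarS : ∀ {e : Node Label n} {l} → Q.every (e ^ l) → NoVarS e l
  Q⇒NoVarS {e = e} h = weaken (Q.every-top e h)

  open Implies {Settled} {NoVarS} Q⇒NoVarS public
    renaming (implies to Q⇒NV; impliess to Qs⇒NV; impliesa to Qa⇒NV)

  ¬NV-varS : ∀ {x : Fin n} → ¬ NV.every (var x ^ S)
  ¬NV-varS (var h) = h refl

  -- An occurrence labelled `S` of a variable of the root scope. The fail rules mention an arbitrary
  -- context in an equation, which cannot be inverted by matching; `occ-hole` turns that context
  -- into a position that can be traced by recursion on the term.
  Occ  : Fin n → LExp n → Set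
  Occs : Fin n → Vec (LExp n) k → Set
  Occa : Fin n → {as : Vec ℕ k} → Alts Label n as → Set
  Occ x (var y ^ l)       = x ≡ y × l ≡ S
  Occ x (app s t ^ _)     = Occ x s ⊎ Occ x t
  Occ x (lam s ^ _)       = Occ (suc x) s
  Occ x (letrec {k} bs t ^ _) = Occs (suc k ↑ʳ x) bs ⊎ Occ (suc k ↑ʳ x) t
  Occ x (con _ _ ss ^ _)  = Occs x ss
  Occ x (seq s t ^ _)     = Occ x s ⊎ Occ x t
  Occ x (case _ s rs ^ _) = Occ x s ⊎ Occa x rs
  Occs x []       = ⊥
  Occs x (s ∷ ss) = Occ x s ⊎ Occs x ss
  Occa x []                   = ⊥
  Occa x (_∷_ {x = a} r rs) = Occ (a ↑ʳ x) r ⊎ Occa x rs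

  occ-hole  : ∀ (C : LCtx m n) x → Occ x (C ⟦ var (wk C x) ^ S ⟧)
  occs-hole : ∀ (C : VecCtx Label m n k) x → Occs x (plugs C (var (wkVec C x) ^ S))
  occa-hole : ∀ {as : Vec ℕ k} (C : AltsCtx Label m n as) x → Occa x (plugAlts C (var (wkAlts C x) ^ S))
  occ-hole [·]                x = refl , refl
  occ-hole (app₁ C _ ^ _)     x = inj₁ (occ-hole C x)
  occ-hole (app₂ _ C ^ _)     x = inj₂ (occ-hole C x)
  occ-hole (lam C ^ _)        x = occ-hole C (suc x)
  occ-hole (letrec-e {k = k} C _ ^ _) x = inj₁ (occs-hole C (suc k ↑ʳ x))
  occ-hole (letrec-i {k = k} _ C ^ _) x = inj₂ (occ-hole C (suc k ↑ʳ x))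
  occ-hole (con _ _ C ^ _)    x = occs-hole C x
  occ-hole (seq₁ C _ ^ _)     x = inj₁ (occ-hole C x)
  occ-hole (seq₂ _ C ^ _)     x = inj₂ (occ-hole C x)
  occ-hole (case _ C _ ^ _)   x = inj₁ (occ-hole C x)
  occ-hole (alt _ _ C ^ _)    x = inj₂ (occa-hole C x)
  occs-hole (here C _)  x = inj₁ (occ-hole C x)
  occs-hole (there _ C) x = inj₂ (occs-hole C x)
  occa-hole (here {a = a} C _) x = inj₁ (occ-hole C (a ↑ʳ x))
  occa-hole (there _ C) x = inj₂ (occa-hole C x)

  NV⇒¬Occ  : ∀ {x} (e : LExp n) → NV.every e → ¬ Occ x e
  NV⇒¬Occs : ∀ {x} (es : Vec (LExp n) k) → NV.everys es → ¬ Occs x es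
  NV⇒¬Occa : ∀ {x} {as : Vec ℕ k} (rs : Alts Label n as) → NV.everya rs → ¬ Occa x rs
  NV⇒¬Occ (var _ ^ _)       (var h)     (_ , o)  = h o
  NV⇒¬Occ (app s t ^ _)     (_ , h , _) (inj₁ o) = NV⇒¬Occ s h o
  NV⇒¬Occ (app s t ^ _)     (_ , _ , h) (inj₂ o) = NV⇒¬Occ t h o
  NV⇒¬Occ (lam s ^ _)       (_ , h)     o        = NV⇒¬Occ s h o
  NV⇒¬Occ (letrec bs t ^ _) (_ , h , _) (inj₁ o) = NV⇒¬Occs bs h o
  NV⇒¬Occ (letrec bs t ^ _) (_ , _ , h) (inj₂ o) = NV⇒¬Occ t h o
  NV⇒¬Occ (con _ _ ss ^ _)  (_ , h)     o        = NV⇒¬Occs ss h o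
  NV⇒¬Occ (seq s t ^ _)     (_ , h , _) (inj₁ o) = NV⇒¬Occ s h o
  NV⇒¬Occ (seq s t ^ _)     (_ , _ , h) (inj₂ o) = NV⇒¬Occ t h o
  NV⇒¬Occ (case _ s rs ^ _) (_ , h , _) (inj₁ o) = NV⇒¬Occ s h o
  NV⇒¬Occ (case _ s rs ^ _) (_ , _ , h) (inj₂ o) = NV⇒¬Occa rs h o
  NV⇒¬Occs (e ∷ es) (h , _) (inj₁ o) = NV⇒¬Occ e h o
  NV⇒¬Occs (e ∷ es) (_ , h) (inj₂ o) = NV⇒¬Occs es h o
  NV⇒¬Occa (r ∷ rs) (h , _) (inj₁ o) = NV⇒¬Occ r h o
  NV⇒¬Occa (r ∷ rs) (_ , h) (inj₂ o) = NV⇒¬Occa rs h o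

  NVs⇒¬FailRule : ∀ {bs : Vec (LExp (suc k + n)) (suc k)} {t l} → NV.everys bs → ¬ FailRule (letrec bs t ^ l)
  NVs⇒¬FailRule {bs = bs} h (visited C {y = y} _ _ _ eq) =
    ¬NV-varS (NV.every-hole C (subst NV.every eq (NV.everys-lookup bs y h)))
  NVs⇒¬FailRule {bs = bs} h (self C {x} eq) =
    ¬NV-varS (NV.every-hole C (subst NV.every eq (NV.everys-lookup bs x h)))

  NoFail : Node Label n → Label → Set
  NoFail e l = ¬ FailRule (e ^ l)

  module OK = Everywhere NoFail

  OK⇒¬Fails : ∀ {e : LExp n} → OK.every e → ¬ Fails e
  OK⇒¬Fails h (inside D {e ^ _} f) = OK.every-top e (OK.every-hole D h) f

  NV⇒NoFail : ∀ {e : Node Label n} {l} → NV.every (e ^ l) → NoFail e l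
  NV⇒NoFail {e = letrec bs t} (_ , h , _) f = NVs⇒¬FailRule h f

  open Implies {NoVarS} {NoFail} NV⇒NoFail public
    renaming (implies to NV⇒OK; impliess to NVs⇒OKs; impliesa to NVa⇒OKa)

  NV⇒¬Fails : ∀ {e : LExp n} → NV.every e → ¬ Fails e
  NV⇒¬Fails {e = e} h = OK⇒¬Fails (NV⇒OK e h)

  Q⇒¬▷ : ∀ {e e′ : LExp n} → Q.every e → ¬ e ▷ e′
  Q⇒¬▷ (letrec h , _)   letrec-T            = h refl
  Q⇒¬▷ (app h _ , _)    (app-ST (inj₁ eq))  = h eq
  Q⇒¬▷ (app _ h , _)    (app-ST (inj₂ eq))  = h eq
  Q⇒¬▷ (seq h _ , _)    (seq-ST (inj₁ eq))  = h eq
  Q⇒¬▷ (seq _ h , _)    (seq-ST (inj₂ eq))  = h eq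
  Q⇒¬▷ (case h _ , _)   (case-ST (inj₁ eq)) = h eq
  Q⇒¬▷ (case _ h , _)   (case-ST (inj₂ eq)) = h eq
  Q⇒¬▷ (_ , _ , h)      (var-in {bs = bs} C {x} eq) = ¬NV-varS (Q⇒NV _ (Q.every-hole C h))
  Q⇒¬▷ (_ , h , _)      (var-e {bs = bs} c {lab} {y = y} _ _ eq) =
    ¬NV-varS (Q⇒NV _ (Q.every-hole (c ^ lab) (subst Q.every eq (Q.everys-lookup bs y h))))
  Q⇒¬▷ (_ , h , _)      (var-var {bs = bs} {y = y} _ _ eq) =
    ¬NV-varS (Q⇒NV _ (subst Q.every eq (Q.everys-lookup bs y h)))

  Q⇒¬⇝ : ∀ {e e′ : LExp n} → Q.every e → ¬ e ⇝ e′
  Q⇒¬⇝ h (inside D st) = Q⇒¬▷ (Q.every-hole D h) st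

  Step : LExp n → LExp n → Set
  Step e e′ = ¬ Fails e × e ⇝ e′

  mapFrame : (A → A′) → Frame A n → Frame A′ n
  mapFrame f (app t)     = app (mapᵃ f t)
  mapFrame f (seq t)     = seq (mapᵃ f t)
  mapFrame f (case κ rs) = case κ (mapAltsᵃ f rs)

  frameᴸ : Frame ⊤ n → Frame Label n
  frameᴸ = mapFrame (λ _ → ∅)

  spineᴸ : Spine ⊤ n → Spine Label n
  spineᴸ []          = []
  spineᴸ (f ∙ _ ◂ X) = frameᴸ f ∙ V ◂ spineᴸ X

  spineᴸ-▹ : ∀ (X : Spine ⊤ n) f {l} → spineᴸ (X ▹ f ∙ l) ≡ spineᴸ X ▹ frameᴸ f ∙ V
  spineᴸ-▹ []          f = refl
  spineᴸ-▹ (g ∙ _ ◂ X) f = cong (frameᴸ g ∙ V ◂_) (spineᴸ-▹ X f)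

  mark-⊙ : ∀ (f : Frame ⊤ n) s {l l′} → mark l ((f ⊙ s) ^ l′) ≡ (frameᴸ f ⊙ unlabelled s) ^ l
  mark-⊙ (app _)    s = refl
  mark-⊙ (seq _)    s = refl
  mark-⊙ (case _ _) s = refl

  ⊙-▷ : ∀ (f : Frame ⊤ n) s {l} → l ≡ S ⊎ l ≡ T → (frameᴸ f ⊙ unlabelled s) ^ l ▷ (frameᴸ f ⊙ mark S s) ^ V
  ⊙-▷ f s {l} h = subst (λ e → (frameᴸ f ⊙ e) ^ l ▷ (frameᴸ f ⊙ mark S s) ^ V)
    (sym (unlabelled≡mark s)) (go f)
    where
    go : ∀ f → (frameᴸ f ⊙ mark ∅ s) ^ l ▷ (frameᴸ f ⊙ mark S s) ^ V
    go (app _)    = app-ST h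
    go (seq _)    = seq-ST h
    go (case _ _) = case-ST h

  ⊙-⇝ : ∀ (f : Frame Label n) {l s s′} → s ⇝ s′ → (f ⊙ s) ^ l ⇝ (f ⊙ s′) ^ l
  ⊙-⇝ (app t) {l}     (inside D st) = inside (app₁ D t ^ l) st
  ⊙-⇝ (seq t) {l}     (inside D st) = inside (seq₁ D t ^ l) st
  ⊙-⇝ (case κ rs) {l} (inside D st) = inside (case κ D rs ^ l) st

  every-⊙ : ∀ (P : ∀ {n} → Node Label n → Label → Set) (P-∅ : ∀ {n} (e : Node Label n) → P e ∅)
    (f : Frame ⊤ n) {s l} → (let open Everywhere P) →
            P (frameᴸ f ⊙ s) l → every s → every ((frameᴸ f ⊙ s) ^ l)
  every-⊙ P P-∅ (app t)     p h = p , h , Everywhere.every-unlabelled P P-∅ t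
  every-⊙ P P-∅ (seq t)     p h = p , h , Everywhere.every-unlabelled P P-∅ t
  every-⊙ P P-∅ (case _ rs) p h = p , h , Everywhere.everya-unlabelled P P-∅ rs

  Q-⊙ : ∀ (f : Frame ⊤ n) {s} → Q.every s → Q.every ((frameᴸ f ⊙ s) ^ V)
  Q-⊙ f = every-⊙ Settled settled-∅ f (go f)
    where
    go : ∀ f → Settled (frameᴸ f ⊙ _) V
    go (app _)    = app (λ ()) λ ()
    go (seq _)    = seq (λ ()) λ ()
    go (case _ _) = case (λ ()) λ ()

  Q-spine : ∀ (X : Spine ⊤ n) {s} → Q.every s → Q.every (toCtx (spineᴸ X) ⟦ s ⟧)
  Q-spine []          h = h
  Q-spine (f ∙ l ◂ X) {s} h =
    subst Q.every (sym (toCtx-◂ (frameᴸ f) (spineᴸ X) s)) (Q-⊙ f (Q-spine X h))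

  NV-∅ : ∀ (e : Node Label n) → NoVarS e ∅
  NV-∅ e = weaken (settled-∅ e)

  NV-⊙ : ∀ (f : Frame ⊤ n) {s l} → NV.every s → NV.every ((frameᴸ f ⊙ s) ^ l)
  NV-⊙ f = every-⊙ NoVarS NV-∅ f (go f)
    where
    go : ∀ f → NoVarS (frameᴸ f ⊙ _) _
    go (app _)    = app
    go (seq _)    = seq
    go (case _ _) = case

  NV-mark-⊙ : ∀ (f : Frame ⊤ n) s {l l′} → NV.every (mark l ((f ⊙ s) ^ l′))
  NV-mark-⊙ f s = subst NV.every (sym (mark-⊙ f s)) (NV-⊙ f (NV.every-unlabelled NV-∅ s))

  -- Absence of failure does not carry over to a surrounding `letrec`, which brings fail rules of
  -- its own. `NoVarS` does carry over, so runs recorded with it can be lifted into frames and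
  -- bindings.
  StepNV : LExp n → LExp n → Set
  StepNV e e′ = NV.every e × e ⇝ e′

  descend : ∀ (X : Spine ⊤ n) f s {l l′} → l ≡ S ⊎ l ≡ T →
            Star StepNV (mark l (toCtx X ⟦ (f ⊙ s) ^ l′ ⟧)) (toCtx (spineᴸ X) ⟦ (frameᴸ f ⊙ mark S s) ^ V ⟧)
  descend [] f s {l} {l′} h =
    (NV-mark-⊙ f s {l} {l′} ,
     inside [·] (subst (_▷ ((frameᴸ f ⊙ mark S s) ^ V)) (sym (mark-⊙ f s)) (⊙-▷ f s h))) ◅ ε
  descend (g ∙ l₀ ◂ X) f s {l} {l′} h =
    subst₂ (Star StepNV)
      (cong (mark l) (sym (toCtx-◂ g X _))) (sym (toCtx-◂ (frameᴸ g) (spineᴸ X) _))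
      ((NV-mark-⊙ g u {l} {tt} , inside [·] (subst (_▷ ((frameᴸ g ⊙ mark S u) ^ V)) (sym (mark-⊙ g u))
        (⊙-▷ g u h))) ◅
       gmap (λ e → (frameᴸ g ⊙ e) ^ V) (λ { (nv , st) → NV-⊙ g nv , ⊙-⇝ (frameᴸ g) st })
         (descend X f s (inj₁ refl)))
    where u = toCtx X ⟦ (f ⊙ s) ^ l′ ⟧

  atBinding : Vec (LExp n) k → Fin k → LCtx m n → VecCtx Label m n k
  atBinding (_ ∷ bs) zero    C = here C bs
  atBinding (b ∷ bs) (suc x) C = there b (atBinding bs x C)

  plugs-atBinding : ∀ (bs : Vec (LExp n) k) x (C : LCtx m n) u →
    plugs (atBinding bs x C) u ≡ bs [ x ]≔ (C ⟦ u ⟧)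
  plugs-atBinding (_ ∷ bs) zero    C u = refl
  plugs-atBinding (b ∷ bs) (suc x) C u = cong (b ∷_) (plugs-atBinding bs x C u)

  binding-⇝ : ∀ (bs : Vec (LExp (suc k + n)) (suc k)) x {t l e e′} → e ⇝ e′ →
              letrec (bs [ x ]≔ e) t ^ l ⇝ letrec (bs [ x ]≔ e′) t ^ l
  binding-⇝ bs x {t} {l} (inside D {e} {e′} st) =
    subst₂ _⇝_ (cong (λ bs → letrec bs t ^ l) (plugs-atBinding bs x D e))
               (cong (λ bs → letrec bs t ^ l) (plugs-atBinding bs x D e′))
               (inside (letrec-e (atBinding bs x D) t ^ l) st)

  body-⇝ : ∀ (bs : Vec (LExp (suc k + n)) (suc k)) {l e e′} → e ⇝ e′ → letrec bs e ^ l ⇝ letrec bs e′ ^ l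
  body-⇝ bs {l} (inside D st) = inside (letrec-i bs D ^ l) st

  everys-update : ∀ (P : ∀ {n} → Node Label n → Label → Set) → (let open Everywhere P) →
                  ∀ (bs : Vec (LExp n) k) x {e} → everys bs → every e → everys (bs [ x ]≔ e)
  everys-update P (_ ∷ _)  zero    (_ , h) g = g , h
  everys-update P (_ ∷ bs) (suc x) (h , h′) g = h , everys-update P bs x h′ g

  OK-spine : ∀ (X : Spine ⊤ n) {s} → OK.every s → OK.every (toCtx (spineᴸ X) ⟦ s ⟧)
  OK-spine []                   h = h
  OK-spine (app t ∙ _ ◂ X)     h = (λ ()) , OK-spine X h , NV⇒OK (unlabelled t) (NV.every-unlabelled NV-∅ t)
  OK-spine (seq t ∙ _ ◂ X)     h = (λ ()) , OK-spine X h , NV⇒OK (unlabelled t) (NV.every-unlabelled NV-∅ t)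
  OK-spine (case _ rs ∙ _ ◂ X) h = (λ ()) , OK-spine X h , NVa⇒OKa _ (NV.everya-unlabelled NV-∅ rs)

  Occ-spine : ∀ (X : Spine ⊤ n) {x z} → Occ x (toCtx (spineᴸ X) ⟦ var z ^ S ⟧) → x ≡ z
  Occ-spine []                  (h , _)  = h
  Occ-spine (app _ ∙ _ ◂ X)     (inj₁ o) = Occ-spine X o
  Occ-spine (app t ∙ _ ◂ X)     (inj₂ o) = ⊥-elim (NV⇒¬Occ (unlabelled t) (NV.every-unlabelled NV-∅ t) o)
  Occ-spine (seq _ ∙ _ ◂ X)     (inj₁ o) = Occ-spine X o
  Occ-spine (seq t ∙ _ ◂ X)     (inj₂ o) = ⊥-elim (NV⇒¬Occ (unlabelled t) (NV.every-unlabelled NV-∅ t) o)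
  Occ-spine (case _ _ ∙ _ ◂ X)  (inj₁ o) = Occ-spine X o
  Occ-spine (case _ rs ∙ _ ◂ X) (inj₂ o) = ⊥-elim (NV⇒¬Occa _ (NV.everya-unlabelled NV-∅ rs) o)

  -- The label that the demanded variable receives: W for a binding that is just a variable.
  passed : Spine A n → Label
  passed []          = W
  passed (_ ∙ _ ◂ _) = V

  passed≢S : ∀ (X : Spine A n) → passed X ≢ S
  passed≢S []          ()
  passed≢S (_ ∙ _ ◂ _) ()

  module _ {k n} (B : Vec (LExp (suc k + n)) (suc k)) {t : LExp (suc k + n)} (Q-B : Q.everys B)
    (Q-t : Q.every t)
           {y z} (z≢y : z ≢ y) {e : E (suc k + n)} (fresh : lookup B z ≡ unlabelled e) where

    -- At this moment `NoVarS` is violated: the binding `y` contains `z` labelled `S`. As this is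
    -- the only such occurrence, a fail rule would need either `z` to have been visited, contrary to
    -- `fresh`, or `z` to equal `y`.
    focus-¬FailRule : ∀ X → ¬ FailRule (letrec (B [ y ]≔ toCtx (spineᴸ X) ⟦ var (z ↑ˡ n) ^ S ⟧) t ^ V)
    focus-¬FailRule X f = go f
      where
      c = toCtx (spineᴸ X) ⟦ var (z ↑ˡ n) ^ S ⟧
      occ-z : ∀ x u → Occ (x ↑ˡ n) (lookup (B [ y ]≔ c) u) → x ≡ z × u ≡ y
      occ-z x u o with u ≟ y
      ... | yes refl = ↑ˡ-injective n x z (Occ-spine X (subst (Occ _) (lookup∘update y B c) o)) , refl
      ... | no u≢y   = ⊥-elim (NV⇒¬Occ (lookup B u) (Q⇒NV (lookup B u) (Q.everys-lookup B u Q-B))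
                         (subst (Occ _) (lookup∘update′ u≢y B c) o))
      go : ¬ FailRule (letrec (B [ y ]≔ c) t ^ V)
      go (visited C {x} {u} _ l eq eq′) with occ-z x u (subst (Occ _) (sym eq′) (occ-hole C (x ↑ˡ n)))
      ... | refl , refl with trans (sym eq) (trans (lookup∘update′ z≢y B c) (trans fresh (unlabelled≡mark e)))
      ...   | refl with l
      ...     | inj₁ ()
      ...     | inj₂ ()
      go (self C {x} eq) with occ-z x x (subst (Occ _) (sym eq) (occ-hole C (x ↑ˡ n)))
      ... | refl , refl = z≢y refl

    focus-¬Fails : ∀ X → ¬ Fails (letrec (B [ y ]≔ toCtx (spineᴸ X) ⟦ var (z ↑ˡ n) ^ S ⟧) t ^ V)
    focus-¬Fails X = OK⇒¬Fails (focus-¬FailRule X ,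
      everys-update NoFail B y (NVs⇒OKs B (Qs⇒NV B Q-B)) (OK-spine X λ ()) , NV⇒OK t (Q⇒NV t Q-t))

    focus-⇝ : ∀ X → letrec (B [ y ]≔ toCtx (spineᴸ X) ⟦ var (z ↑ˡ n) ^ S ⟧) t ^ V ⇝
                    letrec ((B [ y ]≔ toCtx (spineᴸ X) ⟦ var (z ↑ˡ n) ^ passed X ⟧) [ z ]≔ mark S e) t ^ V
    focus-⇝ X = inside [·] (subst (λ bs → letrec (B [ y ]≔ c) t ^ V ▷ letrec bs t ^ V) reorder (rule X))
      where
      c = toCtx (spineᴸ X) ⟦ var (z ↑ˡ n) ^ S ⟧
      c′ = toCtx (spineᴸ X) ⟦ var (z ↑ˡ n) ^ passed X ⟧
      -- The rule writes `z` before `y`; the result is arranged with the newly marked binding `z` as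
      -- the last update.
      reorder : (((B [ y ]≔ c) [ z ]≔ mark S e) [ y ]≔ c′) ≡ ((B [ y ]≔ c′) [ z ]≔ mark S e)
      reorder = trans ([]≔-commutes (B [ y ]≔ c) z y z≢y) (cong (_[ z ]≔ mark S e) ([]≔-idempotent B y))
      at-z : ∀ c → lookup (B [ y ]≔ c) z ≡ mark ∅ e
      at-z c = trans (lookup∘update′ z≢y B c) (trans fresh (unlabelled≡mark e))
      rule : ∀ X → let c = toCtx (spineᴸ X) ⟦ var (z ↑ˡ n) ^ S ⟧
                       c′ = toCtx (spineᴸ X) ⟦ var (z ↑ˡ n) ^ passed X ⟧ in
             letrec (B [ y ]≔ c) t ^ V ▷ letrec (((B [ y ]≔ c) [ z ]≔ mark S e) [ y ]≔ c′) t ^ V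
      rule [] = var-var z≢y (at-z _) (lookup∘update y B _)
      rule X@(f ∙ _ ◂ X′) = subst (λ w → let c = toCtx (spineᴸ X) ⟦ var (z ↑ˡ n) ^ S ⟧ in
          letrec (B [ y ]≔ c) t ^ V ▷ letrec (((B [ y ]≔ c) [ z ]≔ mark S e) [ y ]≔ toCtx
            (spineᴸ X) ⟦ var w ^ V ⟧) t ^ V)
        (wk-toCtx (spineᴸ X) (z ↑ˡ n))
        (var-e (frameCtx (frameᴸ f) (toCtx (spineᴸ X′))) z≢y (at-z _)
          (trans (lookup∘update y B _) (cong (λ w → toCtx (spineᴸ X) ⟦ var w ^ S ⟧)
            (sym (wk-toCtx (spineᴸ X) (z ↑ˡ n))))))

  Q-var : ∀ {x : Fin n} (X : Spine A n) → Q.every (var x ^ passed X)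
  Q-var X = var (passed≢S X)

  -- Call-by-need: adequacy

  weight-map  : ∀ (f : A → A′) (s : Exp A n) → weight (mapᵃ f s) ≡ weight s
  weights-map : ∀ (f : A → A′) (ss : Vec (Exp A n) k) → weights (mapsᵃ f ss) ≡ weights ss
  weight-map f (var _ ^ _)       = refl
  weight-map f (app s _ ^ _)     = cong (λ w → w + w) (weight-map f s)
  weight-map f (lam _ ^ _)       = refl
  weight-map f (letrec bs t ^ _) = cong suc (cong₂ _+_ (weights-map f bs) (weight-map f t))
  weight-map f (con _ _ _ ^ _)   = refl
  weight-map f (seq s _ ^ _)     = cong (λ w → w + w) (weight-map f s)
  weight-map f (case _ s _ ^ _)  = cong (λ w → w + w) (weight-map f s)
  weights-map f []       = refl
  weights-map f (s ∷ ss) = cong₂ _+_ (weight-map f s) (weights-map f ss)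

  weight-ren  : ∀ (f : Fin n → Fin m) (s : Exp A n) → weight (ren f s) ≡ weight s
  weights-ren : ∀ (f : Fin n → Fin m) (ss : Vec (Exp A n) k) → weights (rens f ss) ≡ weights ss
  weight-ren f (var _ ^ _)       = refl
  weight-ren f (app s _ ^ _)     = cong (λ w → w + w) (weight-ren f s)
  weight-ren f (lam _ ^ _)       = refl
  weight-ren f (letrec bs t ^ _) = cong suc (cong₂ _+_ (weights-ren _ bs) (weight-ren _ t))
  weight-ren f (con _ _ _ ^ _)   = refl
  weight-ren f (seq s _ ^ _)     = cong (λ w → w + w) (weight-ren f s)
  weight-ren f (case _ s _ ^ _)  = cong (λ w → w + w) (weight-ren f s)
  weights-ren f []       = refl
  weights-ren f (s ∷ ss) = cong₂ _+_ (weight-ren f s) (weights-ren f ss)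

  weights-++ : ∀ (ss : Vec (Exp A n) k) (ts : Vec (Exp A n) m) → weights (ss ++ᵛ ts) ≡ weights ss + weights ts
  weights-++ []       ts = refl
  weights-++ (s ∷ ss) ts = trans (cong (weight s +_) (weights-++ ss ts)) (sym (+-assoc (weight s) _ _))

  -- The surplus `d` is meant for llet-e, which moves the weight of the inner bindings out of the
  -- updated binding into the enclosing group.
  weights-update : ∀ (ss : Vec (Exp A n) k) x {e d} → d + weight e < weight (lookup ss x) →
                   d + weights (ss [ x ]≔ e) < weights ss
  weights-update (s ∷ ss) zero    {e} {d} h =
    ≤-trans (≤-reflexive (cong suc (sym (+-assoc d (weight e) _)))) (+-monoˡ-< (weights ss) h)
  weights-update (s ∷ ss) (suc x) {e} {d} h =
    ≤-trans (≤-reflexive (cong suc (trans (sym (+-assoc d (weight s) _))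
      (trans (cong (_+ weights (ss [ x ]≔ e)) (+-comm d (weight s))) (+-assoc (weight s) d _)))))
            (≤-trans (≤-reflexive (sym (+-suc (weight s) _)))
              (+-monoʳ-≤ (weight s) (weights-update ss x {e} {d} h)))

  module LRAdequacy where
    open Model 1 0
    open Local 1 0
    open Uncharged 1

    infix 4 _≻_

    _≻_ : LExp n → LExp n → Set₁
    e ≻ e′ = (∀ {ρ} → ⟪ e ⟫ ρ ↘[ 1 ] ⟪ e′ ⟫ ρ) ⊎ (∀ {ρ} → ⟪ e ⟫ ρ ⊆ ⟪ e′ ⟫ ρ) × weight e′ < weight e

    ≻-spine : ∀ (X : Spine Label n) {e e′} → e ≻ e′ → toCtx X ⟦ e ⟧ ≻ toCtx X ⟦ e′ ⟧
    ≻-spine X {e} {e′} (inj₁ d)       = inj₁ (spine-↘ X {e} {e′} (λ _ → id) d)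
    ≻-spine X {e} {e′} (inj₂ (d , w)) =
      inj₂ ((λ {ρ} → ↘⇒⊆ (toCtx X ⟦ e ⟧) (toCtx X ⟦ e′ ⟧) (spine-↘ X {e} {e′} (λ _ → id) (⊆⇒↘ {d′ = ⟪
        e′ ⟫ ρ} d))) , weight-spine X w)

    Decreases : LExp n → ℕ → LExp n → Set
    Decreases l p l′ = (∃ λ q → q < p × ⟪ l′ ⟫ none ⋆ q) ⊎ (⟪ l′ ⟫ none ⋆ p × weight l′ < weight l)

    Outcome : E n → ℕ → Set
    Outcome s p = AnswerLR s ⊎ ∃ λ s′ → s ⟶LR s′ × Smaller s p s′

    erased→ : ∀ (l : LExp n) {s} → erase l ≡ s → ∀ {ρ} → ⟪ s ⟫ ρ ⊆ ⟪ l ⟫ ρ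
    erased→ l refl = map← (λ _ → tt) l (λ _ → id)

    erased← : ∀ (l : LExp n) {s} → erase l ≡ s → ∀ {ρ} → ⟪ l ⟫ ρ ⊆ ⟪ s ⟫ ρ
    erased← l refl = map→ (λ _ → tt) l (λ _ → id)

    finish : ∀ {s : E n} {l l′ p} → Labelling s l → l ↦ l′ → Decreases l p l′ → Outcome s p
    finish {s = s} {l} {l′} lab st d = inj₂ (erase l′ , step lab st , go d)
      where
      go : Decreases l _ l′ → Smaller s _ (erase l′)
      go (inj₁ (q , q<p , h)) = inj₁ (q , q<p , erased← l′ refl h)
      go (inj₂ (h , w))       = inj₂ (erased← l′ refl h ,
        subst₂ _<_ (sym (weight-map _ l′)) (trans (sym (weight-map _ l))
          (cong weight (erase-Labelling lab))) w)

    decreases : ∀ (l l′ : LExp n) {p} → l ≻ l′ → ⟪ l ⟫ none ⋆ p → Decreases l p l′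
    decreases l l′ (inj₁ d)       h = let q , q<p , h′ = d h in inj₁ (q , q<p , h′)
    decreases l l′ (inj₂ (d , w)) h = inj₂ (d h , w)

    -- The shape of type that a frame requires of its head. It is remembered along the chain of
    -- aliases, so that a constructor found at the far end is known not to be applied and to belong
    -- to the scrutinised type.
    ⊙-wants : Frame ⊤ n → Type → Set
    ⊙-wants (app _)    τ = ∃ λ Δ → ∃ λ τ′ → ∃ λ r → τ ≡ fun Δ τ′ r
    ⊙-wants (seq _)    τ = ⊤
    ⊙-wants (case κ _) τ = ∃ λ i → ∃ λ Δ → τ ≡ con κ i Δ

    ⊙-wanted : ∀ (f : Frame ⊤ n) {l s ρ} → ⟪ (f ⊙ s) ^ l ⟫ ρ τ p → ∃ λ τ′ → ∃ λ q →
      ⊙-wants f τ′ × ⟪ s ⟫ ρ τ′ q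
    ⊙-wanted (app _)    (app f _ _)  = _ , _ , (_ , _ , _ , refl) , f
    ⊙-wanted (seq _)    (seq f _ _)  = _ , _ , tt , f
    ⊙-wanted (case _ _) (case f _ _) = _ , _ , (_ , _ , refl) , f

    passed-▹ : ∀ (X : Spine A n) f {l} → passed (X ▹ f ∙ l) ≡ V
    passed-▹ []          f = refl
    passed-▹ (_ ∙ _ ◂ _) f = refl

    contract : ∀ (f : Frame Label n) {h l ρ} → Head h → ⟪ (f ⊙ (h ^ S)) ^ l ⟫ ρ τ p → (∀ x → h ≢ var x) →
               ∃ λ e → (∀ {m} (C : LCtx n m) → C ⟦ (f ⊙ (h ^ S)) ^ l ⟧ ↦ C ⟦ e ⟧) × ((f ⊙ (h ^ S)) ^ l ≻ e)
    contract f var _ nv = ⊥-elim (nv _ refl)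
    contract (app t) {l = l} (lam {s}) _ _ = _ , (λ C → lbeta C) , inj₁ λ {ρ} →
      ↘-⊆ {d′ = ⟪ s ⟫ (ext (⟪ t ∷ [] ⟫s ρ) ρ)} (lam-app→ s t {S} {l}) (bind→ (t ∷ []) s)
    contract (seq t) {l = l} (lam {s}) _ _ = _ , (λ C → seq-c C lam) , inj₁ (seq→ (lam s ^ S) t {l})
    contract (case _ _) lam (case () _ _) _
    contract (app _) con (app () _ _) _
    contract (seq t) {l = l} (con {ss = ss}) _ _ = _ , (λ C → seq-c C con) ,
      inj₁ (seq→ (con _ _ ss ^ S) t {l})
    contract (case κ rs) {l = l} (con {i = i} {ss}) (case (con _) _ _) _ = _ , (λ C → case-c C) , inj₁ λ {ρ} →
      ↘-⊆ {d′ = ⟪ lookup⁺ rs i ⟫ (ext (⟪ ss ⟫s ρ) ρ)} (case-con→ ss rs {S} {l}) (bind→ ss (lookup⁺ rs i))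
    contract f@(app t) {l = l} (letrec {bs = bs} {s}) _ _ =
      _ , (λ C → lapp C) , inj₂ (float→ f bs s {S} {l} {∅} {∅} , weight-float (weights bs) (weight s))
    contract f@(seq t) {l = l} (letrec {bs = bs} {s}) _ _ =
      _ , (λ C → lseq C) , inj₂ (float→ f bs s {S} {l} {∅} {∅} , weight-float (weights bs) (weight s))
    contract f@(case κ rs) {l = l} (letrec {bs = bs} {s}) _ _ =
      _ , (λ C → lcase C) , inj₂ (float→ f bs s {S} {l} {∅} {∅} , weight-float (weights bs) (weight s))

    headᴸ : ∀ {h : Node ⊤ n} → Head h → Head (body (unlabelled (h ^ tt)))
    headᴸ var    = var
    headᴸ lam    = lam
    headᴸ con    = con
    headᴸ letrec = letrec

    var? : ∀ {h : Node ⊤ n} → Head h → (∃ λ x → h ≡ var x) ⊎ (∀ x → body (unlabelled (h ^ tt)) ≢ var x)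
      × Q.every (mark S (h ^ tt))
    var? var                 = inj₁ (_ , refl)
    var? (lam {s})           = inj₂ ((λ _ ()) , lam , settled-unlabelled s)
    var? (con {ss = ss})     = inj₂ ((λ _ ()) , con , Q.everys-unlabelled settled-∅ ss)
    var? (letrec {bs = bs} {t}) =
      inj₂ ((λ _ ()) , letrec (λ ()) , Q.everys-unlabelled settled-∅ bs , settled-unlabelled t)

    settled : ∀ {s : E n} {l} → Star Step (initial s) l → Q.every l → Labelling s l
    settled {l = l} sts h = sts , NV⇒¬Fails (Q⇒NV l h) , λ _ → Q⇒¬⇝ h

    NV-Step : ∀ {e e′ : LExp n} → StepNV e e′ → Step e e′
    NV-Step (nv , st) = NV⇒¬Fails nv , st

    labelling-framed : ∀ (X : Spine ⊤ n) f s {l} → Q.every (mark S s) →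
                       Labelling (toCtx X ⟦ (f ⊙ s) ^ l ⟧) (toCtx (spineᴸ X) ⟦ (frameᴸ f ⊙ mark S s) ^ V ⟧)
    labelling-framed X f s {l} q = settled
      (subst (λ i → Star Step i _) (sym (initial≡mark (toCtx X ⟦ (f ⊙ s) ^ l ⟧)))
        (gmap id NV-Step (descend X f s (inj₂ refl))))
      (Q-spine X (Q-⊙ f q))

    contract-spine : ∀ (X : Spine ⊤ n) f {h ρ} → Head h → (∀ x → body (unlabelled (h ^ tt)) ≢ var x) →
                     let l = toCtx (spineᴸ X) ⟦ (frameᴸ f ⊙ mark S (h ^ tt)) ^ V ⟧ in ⟪ l ⟫ ρ τ p →
                     ∃ λ e → (∀ {m} (C : LCtx n m) → C ⟦ (frameᴸ f ⊙ mark S (h ^ tt)) ^ V ⟧ ↦ C ⟦ e ⟧) ×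
                             (l ≻ toCtx (spineᴸ X) ⟦ e ⟧)
    contract-spine X f {h} {ρ} hd nv t =
      let _ , _ , t′ = spine-typed (spineᴸ X) {(frameᴸ f ⊙ mark S (h ^ tt)) ^ V} {ρ} t
          e , st , d = contract (frameᴸ f) {l = V} {ρ} (headᴸ hd) t′ nv
      in  e , st , ≻-spine (spineᴸ X) d

    progress-framed : ∀ {s : E n} → Framed s → ⟪ s ⟫ none ⋆ p → Outcome s p
    progress-framed (framed X f {h} {l′ = l′} hd) t with var? hd
    ... | inj₁ (x , refl) with spine-typed X {(f ⊙ _) ^ _} {none} t
    ...   | _ , _ , t′ with ⊙-typed f {s = var x ^ _} {none} t′
    ...     | _ , _ , up-to () _
    progress-framed (framed X f {h} {l′ = l′} hd) t | inj₂ (nv , q) =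
      let l  = toCtx (spineᴸ X) ⟦ (frameᴸ f ⊙ mark S (h ^ tt)) ^ V ⟧
          lab = labelling-framed X f (h ^ tt) {l′} q
          t′ = erased→ l (erase-Labelling lab) t
          e , st , d = contract-spine X f hd nv t′
      in  finish lab (st (toCtx (spineᴸ X))) (decreases l (toCtx (spineᴸ X) ⟦ e ⟧) d t′)

    rens-spine : (Fin n → Fin m) → Spine A n → Spine A m
    rens-spine g []          = []
    rens-spine g (f ∙ l ◂ X) = renFrame g f ∙ l ◂ rens-spine g X

    ren-⊙ : ∀ (g : Fin n → Fin m) (f : Frame A n) s l → ren g ((f ⊙ s) ^ l) ≡ (renFrame g f ⊙ ren g s) ^ l
    ren-⊙ g (app _)    s l = refl
    ren-⊙ g (seq _)    s l = refl
    ren-⊙ g (case _ _) s l = refl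

    ren-toCtx : ∀ (g : Fin n → Fin m) (X : Spine A n) s →
      ren g (toCtx X ⟦ s ⟧) ≡ toCtx (rens-spine g X) ⟦ ren g s ⟧
    ren-toCtx g []          s = refl
    ren-toCtx g (f ∙ l ◂ X) s =
      trans (cong (ren g) (toCtx-◂ f X s)) (trans (ren-⊙ g f (toCtx X ⟦ s ⟧) l)
        (trans (cong (λ s → (renFrame g f ⊙ s) ^ l) (ren-toCtx g X s))
          (sym (toCtx-◂ (renFrame g f) (rens-spine g X) (ren g s)))))

    at-wk : ∀ (X : Spine A n) {e : Exp A n} (u : Fin n → Exp A n) x → e ≡ toCtx X ⟦ u x ⟧ →
            e ≡ toCtx X ⟦ u (wk (toCtx X) x) ⟧
    at-wk X u x eq = trans eq (cong (λ x → toCtx X ⟦ u x ⟧) (sym (wk-toCtx X x)))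

    erase-var : ∀ (e : LExp n) {x} → erase e ≡ var x ^ tt → ∃ λ l → e ≡ var x ^ l
    erase-var (var _ ^ l) refl = l , refl

    chain-first : ∀ {P : Fin k → Set} {bs : Vec (Exp A (k + n)) k} {x y} → Chain P bs x y → P x
    chain-first (start p)     = p
    chain-first (link ch _ _) = chain-first ch

    copy-⊆ : ∀ (X : Spine Label (suc k + n)) {bs : Vec (LExp (suc k + n)) (suc k)} {x s y P ρ} →
             lookup bs y ≡ lam s ^ S → Chain P bs y x →
             ⟪ toCtx X ⟦ var (wk (toCtx X) (x ↑ˡ n)) ^ V ⟧ ⟫ (heap bs ρ) ⊆
             ⟪ toCtx X ⟦ ren (wk (toCtx X)) (lam s ^ ∅) ⟧ ⟫ (heap bs ρ)
    copy-⊆ {n = n} X {bs} {x} {s} {ρ = ρ} eq ch =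
      ↘⇒⊆ (toCtx X ⟦ v ⟧) (toCtx X ⟦ v′ ⟧) (spine-↘ X {v} {v′} (λ _ → id) (⊆⇒↘ {d′ = ⟪ v′ ⟫ (heap bs ρ)} go))
      where
      v  = var (wk (toCtx X) (x ↑ˡ n)) ^ V
      v′ = ren (wk (toCtx X)) (lam s ^ ∅)
      go : ⟪ v ⟫ (heap bs ρ) ⊆ ⟪ v′ ⟫ (heap bs ρ)
      go (up-to z le) = ren→ (lam s ^ ∅) (wk (toCtx X)) (λ z → ⊆-≡ (cong (heap bs ρ) (sym (wk-toCtx X z))))
        (up (lam s ^ ∅) (chain-value← {bs = bs} eq ch (⊆-≡ (cong (heap bs ρ) (wk-toCtx X (x ↑ˡ n))) z)) le)

    Up-↘ : ∀ {d d′} → d ↘[ k ] d′ → Up d ↘[ k ] Up d′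
    Up-↘ {k = k} h (up-to v le) with h v
    ... | q , le′ , v′ = q , ≤-trans le′ le , up-to v′ ≤-refl

    -- Demand paths in a program with a top-level `letrec`

    module LetrecProgram {k n} (bs₀ : Vec (E (suc k + n)) (suc k)) (t₀ : E (suc k + n)) where
      s₀ : E n
      s₀ = letrec bs₀ t₀ ^ tt

      φ₀ : Env (suc k)
      φ₀ = rec bs₀ none

      bound : Fin (suc k) → Fin (suc k + n)
      bound z = z ↑ˡ n

      infix 4 _◁_ _◁⁺_

      -- Evaluating the binding y demands the variable z.
      _◁_ : Fin (suc k) → Fin (suc k) → Set
      z ◁ y = ∃ λ X → lookup bs₀ y ≡ toCtx X ⟦ var (bound z) ^ tt ⟧

      _◁⁺_ : Fin (suc k) → Fin (suc k) → Set
      _◁⁺_ = TransClosure _◁_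

      var-heap : ∀ (φ : Env (suc k)) z {ρ : Env n} → ⟪ var (bound z) ^ tt ⟫ (ext φ ρ) ⊆ Up (φ z)
      var-heap φ z {ρ} = Up-mono (⊆-≡ (ext-↑ˡ φ ρ z))

      -- A typing of `y` is folded from entries in `Δ`, and the variable in evaluation position must
      -- take its type from there. Its derivation is a proper part of that of `y`, so demands are
      -- well-founded wherever there is a type.
      φ₀-acc : ∀ y → φ₀ y τ p → Acc _◁_ y
      φ₀-acc y (fold Δ f g _) = acc λ { {z} (X , eq) →
        let _ , _ , h = spine-typed X {var (bound z) ^ tt} {ext ⟨ Δ ⟩ none}
                (at-≡ _ eq (⊆-≡ (⟪⟫s-lookup bs₀ _ y) g))
            up-to v _ = var-heap ⟨ Δ ⟩ z h
        in  φ₀-acc z (f z v) }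

      acc⁺ : ∀ {y} → Acc _◁_ y → Acc _◁⁺_ y
      acc⁺ a = acc (below a)
        where
        below : ∀ {y z} → Acc _◁_ y → z ◁⁺ y → Acc _◁⁺_ z
        below (acc rs) [ h ]    = acc⁺ (rs h)
        below a        (h ∷ hs) with below a hs
        ... | acc rs = rs [ h ]

      irrefl : ∀ {y} → Acc _◁_ y → ¬ (y ◁⁺ y)
      irrefl a h = acc⇒asym (acc⁺ a) h h

      -- If evaluating t₀ demands u, then a cheaper u makes t₀ cheaper.
      Reach : Fin (suc k) → Set₁
      Reach u = ∀ {φ} → φ₀ ⊑ φ → (∀ i → (⟪ lookup bs₀ i ⟫ (ext φ none) ⊆ φ i) ⊎ (φ₀ i ↘[ 1 ] φ i)) →
                φ₀ u ↘[ 1 ] φ u → ⟪ t₀ ⟫ (heap bs₀ none) ↘[ 1 ] ⟪ t₀ ⟫ (ext φ none)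

      demand-↘ : ∀ X z {e φ} → e ≡ toCtx X ⟦ var (bound z) ^ tt ⟧ → φ₀ ⊑ φ → φ₀ z ↘[ 1 ] φ z →
                 ⟪ e ⟫ (heap bs₀ none) ↘[ 1 ] ⟪ e ⟫ (ext φ none)
      demand-↘ X z {φ = φ} refl h d = spine-↘ X {v} {v} (ext-mono h (λ _ → id)) var-↘
        where
        v = var (bound z) ^ tt
        var-↘ : ⟪ v ⟫ (heap bs₀ none) ↘[ 1 ] ⟪ v ⟫ (ext φ none)
        var-↘ x with Up-↘ d (var-heap φ₀ z x)
        ... | q , le , up-to y le′ = q , le , up-to (⊆-≡ (sym (ext-↑ˡ φ none z)) y) le′

      -- The binding `y` reads `z` in evaluation position, so a drop at `z` becomes a drop at `y`:
      -- either `φ` grants it outright, or the cheaper typing of the right-hand side is absorbed by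
      -- `φ`.
      reach-◁ : ∀ {y z} → z ◁ y → Reach y → Reach z
      reach-◁ {y} {z} (X , eq) R {φ} h hs d = R h hs (go (hs y))
        where
        go : (⟪ lookup bs₀ y ⟫ (ext φ none) ⊆ φ y) ⊎ (φ₀ y ↘[ 1 ] φ y) → φ₀ y ↘[ 1 ] φ y
        go (inj₂ d′) = d′
        go (inj₁ c) x with demand-↘ X z eq h d (unfold→ bs₀ y x)
        ... | q , le , x′ = q , le , c x′

      -- Where the most recent variable with the label V is; the chain leads from y to that variable.
      data Last (B : Vec (LExp (suc k + n)) (suc k)) (t : LExp (suc k + n)) (y : Fin (suc k))
        (τ : Type) : Set₁ where
        top     : ∀ {x} → Chain (λ _ → ⊤) bs₀ y x → t ≡ var (bound x) ^ V → Last B t y τ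
        in-body : ∀ {x} X f → Chain (λ _ → ⊤) bs₀ y x → ⊙-wants f τ →
                  t ≡ toCtx (spineᴸ X) ⟦ (frameᴸ f ⊙ (var (bound x) ^ V)) ^ V ⟧ → Last B t y τ
        in-rec  : ∀ {x} u X f → Chain (_≢ u) bs₀ y x → ⊙-wants f τ → y ◁⁺ u → Reach u →
                  lookup B u ≡ toCtx (spineᴸ X) ⟦ (frameᴸ f ⊙ (var (bound x) ^ V)) ^ V ⟧ → Last B t y τ

      -- The labelling has just marked the right-hand side of y, which has the type τ.
      record State (y : Fin (suc k)) (τ : Type) : Set₁ where
        field
          B     : Vec (LExp (suc k + n)) (suc k)
          t     : LExp (suc k + n)
          Q-B   : Q.everys B
          Q-t   : Q.every t
          -- Apart from the focus, only bindings that demand `y`, directly or through others, may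
          -- have been changed in `B`; acyclicity then yields that the next demanded binding is
          -- unvisited.
          fresh : ∀ v → ¬ (y ◁⁺ v) → lookup B v ≡ unlabelled (lookup bs₀ v)
          run   : Star Step (initial s₀) (letrec (B [ y ]≔ mark S (lookup bs₀ y)) t ^ V)
          last  : Last B t y τ
          reach : Reach y

      module Final {bs : Vec (LExp (suc k + n)) (suc k)} {t : LExp (suc k + n)}
        (lab : Labelling s₀ (letrec bs t ^ V)) where
        l₀ : LExp n
        l₀ = letrec bs t ^ V

        erase-bs : ∀ i → erase (lookup bs i) ≡ lookup bs₀ i
        erase-bs i = go (erase-Labelling lab)
          where
          go : erase l₀ ≡ s₀ → erase (lookup bs i) ≡ lookup bs₀ i
          go refl = sym (lookup-maps (λ _ → tt) bs i)

        erase-t : erase t ≡ t₀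
        erase-t = go (erase-Labelling lab)
          where
          go : erase l₀ ≡ s₀ → erase t ≡ t₀
          go refl = refl

        φ₀⊑ : φ₀ ⊑ rec bs none
        φ₀⊑ = rec-⊑ bs₀ bs λ i → erased→ (lookup bs i) (erase-bs i)

        chain : ∀ {P y x} → Chain P bs₀ y x → Chain P bs y x
        chain = chain-map id λ {i} _ eq → erase-var (lookup bs i) (trans (erase-bs i) eq)

        typed : ⟪ s₀ ⟫ none ⋆ p → ⟪ l₀ ⟫ none ⋆ p
        typed = erased→ l₀ {s₀} (erase-Labelling {s = s₀} lab)

        rec-update-⊑ : ∀ u {e} → ⟪ lookup bs u ⟫ (heap (bs [ u ]≔ e) none) ⊆ ⟪ e ⟫ (heap (bs [ u ]≔ e) none) →
                       rec bs none ⊑ rec (bs [ u ]≔ e) none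
        rec-update-⊑ u {e} h = rec-⊑ bs (bs [ u ]≔ e)
          (update-elim bs u (λ i e′ → ⟪ lookup bs i ⟫ (heap (bs [ u ]≔ e) none) ⊆ ⟪ e′ ⟫
            (heap (bs [ u ]≔ e) none))
            h (λ _ _ → id))

        binding-⊆ : ∀ u {e} → ⟪ lookup bs u ⟫ (heap (bs [ u ]≔ e) none) ⊆ ⟪ e ⟫ (heap (bs [ u ]≔ e) none) →
                    ⟪ l₀ ⟫ none ⊆ ⟪ letrec (bs [ u ]≔ e) t ^ V ⟫ none
        binding-⊆ u {e} h = mono t (heap-⊑ bs (bs [ u ]≔ e) (rec-update-⊑ u h))

        binding-weight : ∀ u {e} → weight e < weight (lookup bs u) →
          weight (letrec (bs [ u ]≔ e) t ^ V) < weight l₀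
        binding-weight u {e} w = s≤s (+-monoˡ-< (weight t) (weights-update bs u {e} {0} w))

        -- `Reach` is applied to the heap after the step: the changed binding `u` satisfies the
        -- alternative that drops, every other binding the alternative that is closed under its
        -- right-hand side.
        binding-↘ : ∀ u {e} → Reach u → (∀ {ρ} → ⟪ lookup bs u ⟫ ρ ↘[ 1 ] ⟪ e ⟫ ρ) → ⟪ s₀ ⟫ none ⋆ p →
                    ∃ λ q → q < p × ⟪ letrec (bs [ u ]≔ e) t ^ V ⟫ none ⋆ q
        binding-↘ u {e} R d h with R φ⊑ hs d-u h
          where
          bs′ = bs [ u ]≔ e
          φ⊑′ : rec bs none ⊑ rec bs′ none
          φ⊑′ = rec-update-⊑ u (↘⇒⊆ (lookup bs u) e d)
          φ⊑ : φ₀ ⊑ rec bs′ none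
          φ⊑ i x = φ⊑′ i (φ₀⊑ i x)
          d-u : φ₀ u ↘[ 1 ] rec bs′ none u
          d-u x with d (unfold→ bs u (φ₀⊑ u x))
          ... | q , le , x′ = q , le , fold← bs′ u
            (at-≡ _ (sym (lookup∘update u bs e)) (mono e (heap-⊑ bs bs′ φ⊑′) x′))
          hs : ∀ i → (⟪ lookup bs₀ i ⟫ (heap bs′ none) ⊆ rec bs′ none i) ⊎ (φ₀ i ↘[ 1 ] rec bs′ none i)
          hs i with i ≟ u
          ... | yes refl = inj₂ d-u
          ... | no i≢u   = inj₁ λ x → fold← bs′ i
            (at-≡ _ (sym (lookup∘update′ i≢u bs e)) (erased→ (lookup bs i) (erase-bs i) x))
        ... | q , le , h′ = q , le , erased→ t erase-t h′

        binding-≻ : ∀ u {e} → Reach u → lookup bs u ≻ e → ⟪ s₀ ⟫ none ⋆ p →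
          Decreases l₀ p (letrec (bs [ u ]≔ e) t ^ V)
        binding-≻ u R (inj₁ d)       h = inj₁ (binding-↘ u R d h)
        binding-≻ u R (inj₂ (d , w)) h = inj₂ (binding-⊆ u d (typed h) , binding-weight u w)

        body-≻ : ∀ {t′} → t ≻ t′ → ⟪ s₀ ⟫ none ⋆ p → Decreases l₀ p (letrec bs t′ ^ V)
        body-≻ {t′ = t′} (inj₁ d)       h = let q , le , h′ = d (typed h) in inj₁ (q , le , h′)
        body-≻ (inj₂ (d , w)) h = inj₂ (d (typed h) , s≤s (+-monoʳ-< (weights bs) w))

        copy-body : ∀ (X : Spine Label (suc k + n)) {x s y P} → lookup bs y ≡ lam s ^ S → Chain P bs y x →
                    t ≡ toCtx X ⟦ var (bound x) ^ V ⟧ → ⟪ s₀ ⟫ none ⋆ p → Outcome s₀ p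
        copy-body X {x} {s} eq ch eq-t h = finish lab
          (subst (λ t → letrec bs t ^ V ↦ _) (sym (at-wk X (λ x → var x ^ V) (bound x) eq-t))
            (cp-in (toCtx X) eq (chain-map {bs′ = bs} (λ _ → tt) (λ _ eq → _ , eq) ch)))
          (inj₂ (copy-⊆ X {bs} eq ch (at-≡ _ (at-wk X (λ x → var x ^ V) (bound x) eq-t) (typed h)) ,
                 s≤s (+-monoʳ-< (weights bs) (subst (λ t → _ < weight t) (sym eq-t)
                   (weight-spine X (s≤s z≤n))))))

        copy-rec : ∀ (X : Spine Label (suc k + n)) u {x s y} → lookup bs y ≡ lam s ^ S → Chain (_≢ u) bs y x →
                   lookup bs u ≡ toCtx X ⟦ var (bound x) ^ V ⟧ → ⟪ s₀ ⟫ none ⋆ p → Outcome s₀ p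
        copy-rec X u {x} {s} {y} eq ch eq-u h =
          finish lab (cp-e (toCtx X) eq ch (at-wk X (λ x → var x ^ V) (bound x) eq-u))
          (inj₂ (binding-⊆ u copied (typed h) ,
                 binding-weight u (subst (λ t → _ < weight t) (sym eq-u) (weight-spine X (s≤s z≤n)))))
          where
          e = toCtx X ⟦ ren (wk (toCtx X)) (lam s ^ ∅) ⟧
          bs′ = bs [ u ]≔ e
          copied : ⟪ lookup bs u ⟫ (heap bs′ none) ⊆ ⟪ e ⟫ (heap bs′ none)
          copied z = copy-⊆ X {bs′} (trans (lookup∘update′ (chain-first ch) bs e) eq)
            (chain-map id (λ i≢u eq → _ , trans (lookup∘update′ i≢u bs e) eq) ch)
            (at-≡ _ (at-wk X (λ x → var x ^ V) (bound x) eq-u) z)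

        seq-body : ∀ (X : Spine Label (suc k + n)) {x y κ i ss s} → lookup bs y ≡ con κ i ss ^ S →
          Chain (λ _ → ⊤) bs y x →
                   t ≡ toCtx X ⟦ seq (var (bound x) ^ V) s ^ V ⟧ → ⟪ s₀ ⟫ none ⋆ p → Outcome s₀ p
        seq-body X {x} {s = s} eq ch eq-t h = finish lab
          (subst (λ t → letrec bs t ^ V ↦ _) (sym (at-wk X (λ x → seq (var x ^ V) s ^ V) (bound x) eq-t))
            (seq-in (toCtx X) eq ch))
          (body-≻ {t′ = toCtx X ⟦ s ⟧} (subst (_≻ toCtx X ⟦ s ⟧) (sym eq-t)
            (≻-spine X (inj₁ (seq→ (var (bound x) ^ V) s {V})))) h)

        seq-rec : ∀ (X : Spine Label (suc k + n)) u {x y κ i ss s} → lookup bs y ≡ con κ i ss ^ S →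
          Chain (_≢ u) bs y x →
                  lookup bs u ≡ toCtx X ⟦ seq (var (bound x) ^ V) s ^ V ⟧ → Reach u → ⟪ s₀ ⟫ none ⋆ p →
                    Outcome s₀ p
        seq-rec X u {x} {s = s} eq ch eq-u R h = finish lab
          (seq-e (toCtx X) eq ch (at-wk X (λ x → seq (var x ^ V) s ^ V) (bound x) eq-u))
          (binding-≻ u R (subst (_≻ toCtx X ⟦ s ⟧) (sym eq-u)
            (≻-spine X (inj₁ (seq→ (var (bound x) ^ V) s {V})))) h)

        module Shared {x y : Fin (suc k)} {κ i ss} (X : Spine Label (suc k + n))
          (rs : Alts Label (suc k + n) (ar κ))
                      (eq : lookup bs y ≡ con κ i ss ^ S) where
          redex : LExp (suc k + n)
          redex = toCtx X ⟦ case κ (var (bound x) ^ V) rs ^ V ⟧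

          α : ℕ
          α = lookup (ar κ) i

          w : Fin (suc k + n) → Fin ((suc k + α) + n)
          w = outer (suc k) α

          v : Fin α → Fin ((suc k + α) + n)
          v = added (suc k) α

          X′ : Spine Label ((suc k + α) + n)
          X′ = rens-spine w X

          C : LCtx ((suc k + α) + n) ((suc k + α) + n)
          C = toCtx X′

          reduct : LExp ((suc k + α) + n)
          reduct = C ⟦ bind (vars (wk C ∘ v)) (lookup⁺ (renAlts w rs) i) ⟧

          opened : LExp ((suc k + α) + n)
          opened = C ⟦ case κ (var (wk C (w (bound x))) ^ V) (renAlts w rs) ^ V ⟧

          ren-redex : ∀ {e} → e ≡ redex → ren w e ≡ opened
          ren-redex refl = at-wk X′ (λ x → case κ (var x ^ V) (renAlts w rs) ^ V) (w (bound x))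
            (ren-toCtx w X _)

          B₁ : Vec (LExp ((suc k + α) + n)) (suc k)
          B₁ = rens w bs [ y ]≔ con κ i (vars v) ^ ∅

          module _ (B : Vec (LExp ((suc k + α) + n)) (suc k)) where
            open Share bs ss eq B (none {n}) hiding (w; y; α)

            open-↘ : Chain (λ _ → ⊤) bs′ (y ↑ˡ α) (x ↑ˡ α) → lookup B y ≡ con κ i (vars v) ^ ∅ →
                     ⟪ opened ⟫ (heap bs′ none) ↘[ 1 ] ⟪ reduct ⟫ (heap bs′ none)
            open-↘ ch eq′ = spine-↘ X′ {case κ (var (wk C (w (bound x))) ^ V) (renAlts w rs) ^ V}
              {bind (vars (wk C ∘ v)) (lookup⁺ (renAlts w rs) i)} (λ _ → id)
              (hole→ {x = x} (wk C) (renAlts w rs) {V} {V} eq′ ch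
                (λ z → cong (heap bs′ none) (wk-toCtx X′ z)))

        share-body : ∀ (X : Spine Label (suc k + n)) {x y κ i ss rs} → lookup bs y ≡ con κ i ss ^ S →
                     Chain (λ _ → ⊤) bs y x → t ≡ toCtx X ⟦ case κ (var (bound x) ^ V) rs ^ V ⟧ →
                     ⟪ s₀ ⟫ none ⋆ p → Outcome s₀ p
        share-body X {x} {y} {κ} {i} {ss} {rs} eq ch eq-t h with typed h
        ... | h′ = finish lab (case-in C eq ch (ren-redex eq-t))
          (inj₁ (reduce (at-≡ _ (ren-redex eq-t) (ren-w→ t (mono t (ext-mono φ⊑ (λ _ → id)) h′)))))
          where
          open Shared {x = x} X rs eq
          open Share bs ss eq B₁ (none {n}) using (bs′; ψ; ψ₁; ren-w→; con-y→; rec→; chain-bs′)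
          φ⊑ : rec bs none ⊑ ψ ∘ (_↑ˡ α)
          φ⊑ = rec→ (update-elim (rens w bs) y (λ i e → ⟪ lookup bs i ⟫ ψ₁ ⊆ ⟪ e ⟫ (heap bs′ none)) con-y→
            (λ i _ x → at-≡ _ (sym (lookup-rens w bs i)) (ren-w→ (lookup bs i) x)))
          reduce : ⟪ opened ⟫ (heap bs′ none) ↘[ 1 ] ⟪ reduct ⟫ (heap bs′ none)
          reduce = open-↘ B₁ (chain-bs′ (λ {z} _ z≢y →
            trans (lookup∘update′ z≢y (rens w bs) _) (lookup-rens w bs z)) ch)
            (lookup∘update y (rens w bs) _)

        share-rec : ∀ (X : Spine Label (suc k + n)) u {x y κ i ss rs} → lookup bs y ≡ con κ i ss ^ S →
                    Chain (_≢ u) bs y x → lookup bs u ≡ toCtx X ⟦ case κ (var (bound x) ^ V) rs ^ V ⟧ →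
                      Reach u →
                    ⟪ s₀ ⟫ none ⋆ p → Outcome s₀ p
        -- The new heap has additional variables for the constructor arguments. `Reach` is
        -- instantiated with its restriction to the old variables.
        share-rec X u {x} {y} {κ} {i} {ss} {rs} eq ch eq-u R h with R φ₀⊑ψ hs d-u h
          where
          open Shared {x = x} X rs eq
          B₂ : Vec (LExp ((suc k + α) + n)) (suc k)
          B₂ = B₁ [ u ]≔ reduct
          open Share bs ss eq B₂ (none {n}) using (bs′; ψ; ψ₁; ren-w→; con-y→; rec→; chain-bs′)
          y≢u : y ≢ u
          y≢u = chain-first ch
          kept : ∀ {z} → z ≢ u → z ≢ y → lookup B₂ z ≡ ren w (lookup bs z)
          kept {z} z≢u z≢y = trans (lookup∘update′ z≢u B₁ _)
            (trans (lookup∘update′ z≢y (rens w bs) _) (lookup-rens w bs z))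
          reduce : ⟪ opened ⟫ (heap bs′ none) ↘[ 1 ] ⟪ reduct ⟫ (heap bs′ none)
          reduce = open-↘ B₂ (chain-bs′ kept ch)
            (trans (lookup∘update′ y≢u B₁ _) (lookup∘update y (rens w bs) _))
          opens : ⟪ lookup bs u ⟫ ψ₁ ⊆ ⟪ opened ⟫ (heap bs′ none)
          opens z = at-≡ _ (ren-redex eq-u) (ren-w→ (lookup bs u) z)
          keeps : ∀ i → i ≢ u → ⟪ lookup bs i ⟫ ψ₁ ⊆ ⟪ lookup B₂ i ⟫ (heap bs′ none)
          keeps i i≢u with i ≟ y
          ... | yes refl = λ z → at-≡ _ (sym (trans (lookup∘update′ y≢u B₁ _)
            (lookup∘update y (rens w bs) _))) (con-y→ z)
          ... | no i≢y   = λ z → at-≡ _ (sym (kept i≢u i≢y)) (ren-w→ (lookup bs i) z)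
          φ⊑ψ : rec bs none ⊑ ψ ∘ (_↑ˡ α)
          φ⊑ψ = rec→ all
            where
            all : ∀ i → ⟪ lookup bs i ⟫ ψ₁ ⊆ ⟪ lookup B₂ i ⟫ (heap bs′ none)
            all i with i ≟ u
            ... | yes refl = λ z → at-≡ _ (sym (lookup∘update u B₁ _)) (↘⇒⊆ opened reduct reduce (opens z))
            ... | no i≢u   = keeps i i≢u
          φ₀⊑ψ : φ₀ ⊑ ψ ∘ (_↑ˡ α)
          φ₀⊑ψ i z = φ⊑ψ i (φ₀⊑ i z)
          store : ∀ i → ⟪ lookup B₂ i ⟫ (heap bs′ none) ⊆ ψ (i ↑ˡ α)
          store i z = fold← bs′ (i ↑ˡ α) (at-≡ _ (sym (lookup-++ˡ B₂ (rens w ss) i)) z)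
          d-u : φ₀ u ↘[ 1 ] ψ (u ↑ˡ α)
          d-u z with reduce (opens (mono (lookup bs u) (ext-mono φ⊑ψ (λ _ → id)) (unfold→ bs u (φ₀⊑ u z))))
          ... | q , le , z′ = q , le , store u (at-≡ _ (sym (lookup∘update u B₁ _)) z′)
          -- Only `u` becomes cheaper. All other bindings keep their types and costs, including `y`,
          -- whose constructor now refers to its shared arguments.
          hs : ∀ i → (⟪ lookup bs₀ i ⟫ ψ₁ ⊆ ψ (i ↑ˡ α)) ⊎ (φ₀ i ↘[ 1 ] ψ (i ↑ˡ α))
          hs i with i ≟ u
          ... | yes refl = inj₂ d-u
          ... | no i≢u   = inj₁ λ z → store i (keeps i i≢u (erased→ (lookup bs i) (erase-bs i) z))
        ... | q , le , h′ = finish lab (case-e C eq ch (ren-redex eq-u))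
          (inj₁ (q , le , ren-w→ t (erased→ t erase-t h′)))
          where
          open Shared {x = x} X rs eq
          open Share bs ss eq (B₁ [ u ]≔ reduct) (none {n}) using (ren-w→)

        merge-body : ∀ {a} {bs₂ : Vec (LExp (suc a + (suc k + n))) (suc a)} {s} → t ≡ letrec bs₂ s ^ S →
                     ⟪ s₀ ⟫ none ⋆ p → Outcome s₀ p
        merge-body {a = a} {bs₂} {s} eq h = finish lab (subst (λ t → letrec bs t ^ V ↦ l′) (sym eq) llet-in)
          (inj₂ (body→ s (mono (letrec bs₂ s ^ S) (ext-mono φ⊑ (λ _ → id)) (at-≡ _ eq (typed h))) ,
                 subst (λ t → weight l′ < suc (weights bs + weight t)) (sym eq) lighter))
          where
          open Merge bs bs₂ (rens (outer (suc k) (suc a)) bs) (none {n})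
          l′ : LExp n
          l′ = letrec bs′ (ren v s) ^ V
          φ⊑ : rec bs none ⊑ ψ ∘ (_↑ˡ suc a)
          φ⊑ = rec→ λ i z → at-≡ _ (sym (lookup-rens w bs i)) (ren-w→ (lookup bs i) z)
          lighter : weight l′ < suc (weights bs + suc (weights bs₂ + weight s))
          lighter rewrite weights-++ (rens w bs) (rens v bs₂) | weights-ren w bs | weights-ren v bs₂
            | weight-ren v s
                        | +-suc (weights bs) (weights bs₂ + weight s) | +-assoc (weights bs)
                          (weights bs₂) (weight s) = ≤-refl

        merge-rec : ∀ u {a} {bs₂ : Vec (LExp (suc a + (suc k + n))) (suc a)} {s} →
          lookup bs u ≡ letrec bs₂ s ^ S →
                    ⟪ s₀ ⟫ none ⋆ p → Outcome s₀ p
        merge-rec u {a} {bs₂} {s} eq h = finish lab (llet-e eq)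
          (inj₂ (ren-w→ t (mono t (ext-mono φ⊑ (λ _ → id)) (typed h)) , lighter))
          where
          B : Vec (LExp ((suc k + suc a) + n)) (suc k)
          B = rens (outer (suc k) (suc a)) bs [ u ]≔ ren (inner (suc k) (suc a)) s
          open Merge bs bs₂ B (none {n})
          φ⊑ : rec bs none ⊑ ψ ∘ (_↑ˡ suc a)
          φ⊑ = rec→ (update-elim (rens w bs) u (λ i e → ⟪ lookup bs i ⟫ ψ₁ ⊆ ⟪ e ⟫ (heap bs′ none))
            (λ z → body→ s (at-≡ _ eq z))
            (λ i _ z → at-≡ _ (sym (lookup-rens w bs i)) (ren-w→ (lookup bs i) z)))
          -- The weight of `bs₂` merely changes place; the strict decrease is the unit of the inner
          -- `letrec` that disappears.
          moved : weights bs₂ + weights B < weights bs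
          moved = subst (weights bs₂ + weights B <_) (weights-ren w bs)
            (weights-update (rens w bs) u {ren v s} {weights bs₂}
              (subst (weights bs₂ + weight (ren v s) <_)
                (sym (trans (cong weight (lookup-rens w bs u))
                  (trans (weight-ren w (lookup bs u)) (cong weight eq))))
                (s≤s (≤-reflexive (cong (weights bs₂ +_) (weight-ren v s))))))
          lighter : weight (letrec bs′ (ren w t) ^ V) < weight l₀
          lighter rewrite weights-++ B (rens v bs₂) | weights-ren v bs₂ | weight-ren w t | +-comm
            (weights B) (weights bs₂) =
            s≤s (+-monoˡ-< (weight t) moved)

      QNV-Step : ∀ (B : Vec (LExp (suc k + n)) (suc k)) y {t e e′} → Q.everys B → Q.every t → StepNV e e′ →
                 Step (letrec (B [ y ]≔ e) t ^ V) (letrec (B [ y ]≔ e′) t ^ V)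
      QNV-Step B y {t} Q-B Q-t (nv , st) =
        NV⇒¬Fails (letrec , everys-update NoVarS B y (Qs⇒NV B Q-B) nv , Q⇒NV t Q-t) , binding-⇝ B y st

      Bᵘ : Vec (LExp (suc k + n)) (suc k)
      Bᵘ = mapsᵃ (λ _ → ∅) bs₀

      Q-Bᵘ : Q.everys Bᵘ
      Q-Bᵘ = Q.everys-unlabelled settled-∅ bs₀

      start-run : Star Step (initial s₀) (letrec Bᵘ (mark S t₀) ^ V)
      start-run = subst (λ i → Star Step i (letrec Bᵘ (mark S t₀) ^ V)) (sym (initial≡mark s₀))
        ((NV⇒¬Fails (letrec , NV.everys-unlabelled NV-∅ bs₀ , NV.every-unlabelled NV-∅ t₀) ,
          inside [·] (subst (λ t → letrec Bᵘ t ^ T ▷ letrec Bᵘ (mark S t₀) ^ V)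
            (sym (unlabelled≡mark t₀)) letrec-T)) ◅ ε)

      -- The labelling walks along aliases from the used variable towards the value, so the chain
      -- has to grow at its source, the end opposite to `link`.
      chain-extend : ∀ {P : Fin (suc k) → Set} {y z x} → P z → lookup bs₀ y ≡ var (bound z) ^ tt →
        Chain P bs₀ y x → Chain P bs₀ z x
      chain-extend p eq (start p′)       = link (start p) p′ eq
      chain-extend p eq (link ch p′ eq′) = link (chain-extend p eq ch) p′ eq′

      module _ {y τ} (a : Acc _◁_ y) (st : State y τ) where
        open State st

        run-to : ∀ {e} → Star StepNV (mark S (lookup bs₀ y)) e →
          Star Step (initial s₀) (letrec (B [ y ]≔ e) t ^ V)
        run-to sts = run ◅◅ gmap (λ e → letrec (B [ y ]≔ e) t ^ V) (QNV-Step B y Q-B Q-t) sts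

        settle : ∀ {e} → Star StepNV (mark S (lookup bs₀ y)) e → Q.every e →
          Labelling s₀ (letrec (B [ y ]≔ e) t ^ V)
        settle sts q = settled {s = s₀} (run-to sts) (letrec (λ ()) , everys-update Settled B y Q-B q , Q-t)

        at-u : ∀ {u e} → y ◁⁺ u → lookup (B [ y ]≔ e) u ≡ lookup B u
        at-u {u} h = lookup∘update′ (λ { refl → irrefl a h }) B _

        -- Passing the focus from `y` to `z` relies on acyclicity twice: `z` differs from `y`, and
        -- `z` has not been visited, because otherwise the path of demands would close up.
        move : ∀ X z {τ′} → lookup bs₀ y ≡ toCtx X ⟦ var (bound z) ^ tt ⟧ →
               Star StepNV (mark S (lookup bs₀ y)) (toCtx (spineᴸ X) ⟦ var (bound z) ^ S ⟧) →
               Last (B [ y ]≔ toCtx (spineᴸ X) ⟦ var (bound z) ^ passed X ⟧) t z τ′ → State z τ′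
        move X z eq sts last′ = record
          { B     = B′
          ; t     = t
          ; Q-B   = everys-update Settled B y Q-B (Q-spine X (Q-var X))
          ; Q-t   = Q-t
          ; fresh = λ v ¬z◁⁺v → trans (lookup∘update′ (λ { refl → ¬z◁⁺v [ z◁y ] }) B _)
            (fresh v (¬z◁⁺v ∘ (z◁y ∷_)))
          ; run   = run-to sts ◅◅ ((focus-¬Fails B Q-B Q-t z≢y z-fresh X ,
            focus-⇝ B Q-B Q-t z≢y z-fresh X) ◅ ε)
          ; last  = last′
          ; reach = reach-◁ z◁y reach
          }
          where
          B′ = B [ y ]≔ toCtx (spineᴸ X) ⟦ var (bound z) ^ passed X ⟧
          z◁y : z ◁ y
          z◁y = X , eq
          z≢y : z ≢ y
          z≢y refl = irrefl a [ z◁y ]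
          z-fresh : lookup B z ≡ unlabelled (lookup bs₀ z)
          z-fresh = fresh z λ y◁⁺z → irrefl a (y◁⁺z ∷ʳ z◁y)

        finish-lam : ∀ {s} → lookup bs₀ y ≡ lam s ^ tt → ⟪ s₀ ⟫ none ⋆ p → Outcome s₀ p
        finish-lam {s = s} eq = go last
          where
          e : LExp (suc k + n)
          e = lam (unlabelled s) ^ S
          lab : Labelling s₀ (letrec (B [ y ]≔ e) t ^ V)
          lab = settle (subst (λ b → Star StepNV (mark S b) e) (sym eq) ε) (lam , settled-unlabelled s)
          open Final lab
          at-y : lookup (B [ y ]≔ e) y ≡ e
          at-y = lookup∘update y B e
          go : Last B t y τ → ⟪ s₀ ⟫ none ⋆ p → Outcome s₀ p
          go (top ch eq-t) = copy-body [] at-y (chain ch) eq-t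
          go (in-body X f ch _ eq-t) =
            copy-body (spineᴸ X ▹ frameᴸ f ∙ V) at-y (chain ch)
              (trans eq-t (sym (toCtx-▹ (spineᴸ X) (frameᴸ f) V _)))
          go (in-rec u X f ch _ h _ eq-u) =
            copy-rec (spineᴸ X ▹ frameᴸ f ∙ V) u at-y (chain ch)
              (trans (at-u h) (trans eq-u (sym (toCtx-▹ (spineᴸ X) (frameᴸ f) V _))))

        finish-con : ∀ {κ i ss} → lookup bs₀ y ≡ con κ i ss ^ tt → φ₀ y τ q → ⟪ s₀ ⟫ none ⋆ p → Outcome s₀ p
        finish-con {κ = κ} {i} {ss} eq ty h = go last (at-≡ _ eq (unfold→ bs₀ y ty))
          where
          e : LExp (suc k + n)
          e = con κ i (mapsᵃ (λ _ → ∅) ss) ^ S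
          lab : Labelling s₀ (letrec (B [ y ]≔ e) t ^ V)
          lab = settle (subst (λ b → Star StepNV (mark S b) e) (sym eq) ε)
            (con , Q.everys-unlabelled settled-∅ ss)
          open Final lab
          at-y : lookup (B [ y ]≔ e) y ≡ e
          at-y = lookup∘update y B e
          go : Last B t y τ → Con κ i (⟪ ss ⟫s (heap bs₀ none)) τ q → Outcome s₀ _
          -- No frame waits for the constructor, so the program is already an answer; erasing the
          -- labels exhibits it in the original bindings.
          go (top ch eq-t) _ = inj₁ (subst (λ t → AnswerLR (letrec bs₀ t ^ tt))
            (trans (cong erase (sym eq-t)) erase-t) (letrec-con eq ch))
          go (in-body X (app _) ch (_ , _ , _ , refl) eq-t) ()
          go (in-body X (seq _) ch _ eq-t) _ = seq-body (spineᴸ X) at-y (chain ch) eq-t h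
          go (in-body X (case _ _) ch (_ , _ , refl) eq-t) (con _) =
            share-body (spineᴸ X) at-y (chain ch) eq-t h
          go (in-rec u X (app _) ch (_ , _ , _ , refl) _ _ _) ()
          go (in-rec u X (seq _) ch _ g R eq-u) _ =
            seq-rec (spineᴸ X) u at-y (chain ch) (trans (at-u g) eq-u) R h
          go (in-rec u X (case _ _) ch (_ , _ , refl) g R eq-u) (con _) =
            share-rec (spineᴸ X) u at-y (chain ch) (trans (at-u g) eq-u) R h

        finish-letrec : ∀ {a} {bs : Vec (E (suc a + (suc k + n))) (suc a)} {s} →
          lookup bs₀ y ≡ letrec bs s ^ tt →
                        ⟪ s₀ ⟫ none ⋆ p → Outcome s₀ p
        finish-letrec {bs = bs} {s} eq = merge-rec y (lookup∘update y B e)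
          where
          e : LExp (suc k + n)
          e = letrec (mapsᵃ (λ _ → ∅) bs) (unlabelled s) ^ S
          lab : Labelling s₀ (letrec (B [ y ]≔ e) t ^ V)
          lab = settle (subst (λ b → Star StepNV (mark S b) e) (sym eq) ε)
            (letrec (λ ()) , Q.everys-unlabelled settled-∅ bs , settled-unlabelled s)
          open Final lab

        -- The redex lies within the focused binding itself, so `reach` for `y` makes its drop count
        -- for the whole program.
        finish-framed : ∀ X f {h} → Head h → (∀ x → body (unlabelled (h ^ tt)) ≢ var x) →
          Q.every (mark S (h ^ tt)) →
                        lookup bs₀ y ≡ toCtx X ⟦ (f ⊙ (h ^ tt)) ^ tt ⟧ → φ₀ y τ q → ⟪ s₀ ⟫ none ⋆ p →
                          Outcome s₀ p
        finish-framed X f {h} hd nv q eq ty typ =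
          let e′ , st , d = contract-spine X f {ρ = heap bs₀ none} hd nv
                              (erased→ e (trans (cong erase (sym at-y)) (erase-bs y)) (unfold→ bs₀ y ty))
          in  finish lab
                (subst₂ _↦_ (plugs-at e₀) (plugs-at e′)
                  (st (letrec-e (atBinding B y (toCtx (spineᴸ X))) t ^ V)))
                (subst (Decreases l₀ _) (cong (λ bs → letrec bs t ^ V) ([]≔-idempotent B y))
                  (binding-≻ y reach (subst (_≻ toCtx (spineᴸ X) ⟦ e′ ⟧) (sym at-y) d) typ))
          where
          e₀ : LExp (suc k + n)
          e₀ = (frameᴸ f ⊙ mark S (h ^ tt)) ^ V
          e : LExp (suc k + n)
          e = toCtx (spineᴸ X) ⟦ e₀ ⟧
          lab : Labelling s₀ (letrec (B [ y ]≔ e) t ^ V)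
          lab = settle (subst (λ b → Star StepNV (mark S b) e) (sym eq) (descend X f (h ^ tt) (inj₁ refl)))
                       (Q-spine X (Q-⊙ f q))
          open Final lab
          at-y : lookup (B [ y ]≔ e) y ≡ e
          at-y = lookup∘update y B e
          plugs-at : ∀ u → letrec (plugs (atBinding B y (toCtx (spineᴸ X))) u) t ^ V ≡
                           letrec (B [ y ]≔ toCtx (spineᴸ X) ⟦ u ⟧) t ^ V
          plugs-at u = cong (λ bs → letrec bs t ^ V) (plugs-atBinding B y (toCtx (spineᴸ X)) u)

      -- Recursion on the accessibility of the focus under demand. A bare variable lengthens the
      -- current chain and leaves its user in place; a variable under a frame starts a new chain,
      -- used in `y`.
      binding-progress : ∀ {y} → Acc _◁_ y → State y τ → φ₀ y τ q → ⟪ s₀ ⟫ none ⋆ p → Outcome s₀ p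
      binding-progress {y = y} a st ty h = go a (view (lookup bs₀ y)) refl
        where
        open State st
        go : ∀ {b} → Acc _◁_ y → View b → lookup bs₀ y ≡ b → Outcome s₀ _
        go _ (bare lam)    eq = finish-lam a st eq h
        go _ (bare con)    eq = finish-con a st eq ty h
        go _ (bare letrec) eq = finish-letrec a st eq h
        go (acc rs) (bare (var {x})) eq with splitAt (suc k) x in split
        ... | inj₁ z with splitAt⁻¹-↑ˡ {suc k} {n} {x} {z} split
        ...   | refl with var-heap φ₀ z (at-≡ _ eq (unfold→ bs₀ y ty))
        ...     | up-to ty′ _ = binding-progress (rs z◁y) st′ ty′ h
          where
          z◁y : z ◁ y
          z◁y = [] , eq
          w : LExp (suc k + n)
          w = var (bound z) ^ W
          move-last : Last B t y _ → Last (B [ y ]≔ w) t z _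
          move-last (top ch eq-t)                = top (chain-extend tt eq ch) eq-t
          move-last (in-body X f ch want eq-t)   = in-body X f (chain-extend tt eq ch) want eq-t
          -- The longer chain still avoids `u`: if `z` were `u`, the demands would form a cycle
          -- through `y`.
          move-last (in-rec u X f ch want g R eq-u) =
            in-rec u X f (chain-extend (λ { refl → irrefl (rs z◁y) (z◁y ∷ g) }) eq ch) want (z◁y ∷ g) R
              (trans (at-u a st g) eq-u)
          st′ : State z _
          st′ = move a st [] z eq (subst (λ b → Star StepNV (mark S b) (var (bound z) ^ S)) (sym eq) ε)
            (move-last last)
        go (acc rs) (bare (var {x})) eq | inj₂ v with splitAt⁻¹-↑ʳ {suc k} {n} {x} {v} split
        ...   | refl with at-≡ (heap bs₀ none) eq (unfold→ bs₀ y ty)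
        ...     | up-to free _ = ⊥-elim (⊆-≡ (ext-↑ʳ φ₀ none v) free)
        go (acc rs) (framed (framed X f {h = hd} head)) eq with var? head
        ... | inj₂ (nv , q) = finish-framed a st X f head nv q eq ty h
        ... | inj₁ (x , refl) with spine-typed X {(f ⊙ (var x ^ tt)) ^ tt} {heap bs₀ none}
          (at-≡ _ eq (unfold→ bs₀ y ty))
        ...   | _ , _ , ty₁ with ⊙-wanted f {s = var x ^ tt} {heap bs₀ none} ty₁
        ...     | _ , _ , want , up-to ty₂ _ with splitAt (suc k) x in split
        ...       | inj₂ _ = ⊥-elim ty₂
        ...       | inj₁ z with splitAt⁻¹-↑ˡ {suc k} {n} {x} {z} split
        ...         | refl = binding-progress (rs z◁y) st′ ty₂ h
          where
          Y : Spine ⊤ (suc k + n)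
          Y = X ▹ f ∙ tt
          eq′ : lookup bs₀ y ≡ toCtx Y ⟦ var (bound z) ^ tt ⟧
          eq′ = trans eq (sym (toCtx-▹ X f tt _))
          z◁y : z ◁ y
          z◁y = Y , eq′
          st′ : State z _
          st′ = move a st Y z eq′
            (subst₂ (Star StepNV) (cong (mark S) (sym eq)) (sym (labelled S))
              (descend X f (var (bound z) ^ tt) (inj₁ refl)))
            (in-rec y X f (start λ { refl → irrefl a [ z◁y ] }) want [ z◁y ] reach
              (trans (lookup∘update y B _) (trans
                (cong (λ l → toCtx (spineᴸ Y) ⟦ var (bound z) ^ l ⟧) passed-Y) (labelled V))))
            where
            labelled : ∀ l → toCtx (spineᴸ Y) ⟦ var (bound z) ^ l ⟧ ≡ toCtx
              (spineᴸ X) ⟦ (frameᴸ f ⊙ (var (bound z) ^ l)) ^ V ⟧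
            labelled l = trans (cong (λ Y → toCtx Y ⟦ var (bound z) ^ l ⟧) (spineᴸ-▹ X f))
              (toCtx-▹ (spineᴸ X) (frameᴸ f) V _)
            passed-Y : passed Y ≡ V
            passed-Y = passed-▹ X f

      body-step : ∀ {e e′} → StepNV e e′ → Step (letrec Bᵘ e ^ V) (letrec Bᵘ e′ ^ V)
      body-step (nv , st) = NV⇒¬Fails (letrec , NV.everys-unlabelled NV-∅ bs₀ , nv) , body-⇝ Bᵘ st

      body-run : ∀ {e} → Star StepNV (mark S t₀) e → Star Step (initial s₀) (letrec Bᵘ e ^ V)
      body-run sts = start-run ◅◅ gmap (λ e → letrec Bᵘ e ^ V) body-step sts

      settle-body : ∀ {e} → Star StepNV (mark S t₀) e → Q.every e → Labelling s₀ (letrec Bᵘ e ^ V)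
      settle-body sts q = settled {s = s₀} (body-run sts) (letrec (λ ()) , Q-Bᵘ , q)

      enter : ∀ X z {τ} → t₀ ≡ toCtx X ⟦ var (bound z) ^ tt ⟧ →
              Star StepNV (mark S t₀) (toCtx (spineᴸ X) ⟦ var (bound z) ^ S ⟧) →
              Last Bᵘ (toCtx (spineᴸ X) ⟦ var (bound z) ^ V ⟧) z τ → State z τ
      enter X z eq sts last = record
        { B     = Bᵘ
        ; t     = toCtx (spineᴸ X) ⟦ var (bound z) ^ V ⟧
        ; Q-B   = Q-Bᵘ
        ; Q-t   = Q-spine X (var λ ())
        ; fresh = λ v _ → lookup-maps _ bs₀ v
        ; run   = body-run sts ◅◅ ((no-fail , inside [·] rule) ◅ ε)
        ; last  = last
        ; reach = λ h hs d → demand-↘ X z eq h d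
        }
        where
        no-fail : ¬ Fails (letrec Bᵘ (toCtx (spineᴸ X) ⟦ var (bound z) ^ S ⟧) ^ V)
        no-fail = OK⇒¬Fails (NVs⇒¬FailRule (Qs⇒NV Bᵘ Q-Bᵘ) , NVs⇒OKs Bᵘ (Qs⇒NV Bᵘ Q-Bᵘ) , OK-spine X λ ())
        rule : letrec Bᵘ (toCtx (spineᴸ X) ⟦ var (bound z) ^ S ⟧) ^ V ▷
               letrec (Bᵘ [ z ]≔ mark S (lookup bs₀ z)) (toCtx (spineᴸ X) ⟦ var (bound z) ^ V ⟧) ^ V
        rule = subst (λ w → letrec Bᵘ (toCtx (spineᴸ X) ⟦ var w ^ S ⟧) ^ V ▷
                            letrec (Bᵘ [ z ]≔ mark S (lookup bs₀ z)) (toCtx (spineᴸ X) ⟦ var w ^ V ⟧) ^ V)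
          (wk-toCtx (spineᴸ X) (bound z))
          (var-in (toCtx (spineᴸ X)) (trans (lookup-maps _ bs₀ z) (unlabelled≡mark (lookup bs₀ z))))

      letrec-progress : ⟪ s₀ ⟫ none ⋆ p → Outcome s₀ p
      letrec-progress {p} h = go (view t₀) refl h
        where
        go : ∀ {b} → View b → t₀ ≡ b → ⟪ b ⟫ (heap bs₀ none) ⋆ p → Outcome s₀ p
        go (bare lam) refl _ = inj₁ (letrec-val lam)
        go (bare con) refl _ = inj₁ (letrec-val con)
        go (bare (letrec {bs = bs} {s})) refl _ = Final.merge-body
          (settle-body ε (letrec (λ ()) , Q.everys-unlabelled settled-∅ bs , settled-unlabelled s)) refl h
        go (bare (var {x})) eq (up-to ty _) with splitAt (suc k) x in split
        ... | inj₂ _ = ⊥-elim ty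
        ... | inj₁ z with splitAt⁻¹-↑ˡ {suc k} {n} {x} {z} split
        ...   | refl = binding-progress (φ₀-acc z ty)
          (enter [] z eq (subst (λ t → Star StepNV (mark S t) (var (bound z) ^ S)) (sym eq) ε)
          (top (start tt) refl)) ty h
        go (framed (framed X f {h = hd} head)) eq ty with var? head
        ... | inj₂ (nv , q) =
          let lab = settle-body (subst (λ t → Star StepNV (mark S t) _) (sym eq)
                  (descend X f (hd ^ tt) (inj₁ refl))) (Q-spine X (Q-⊙ f q))
              e = toCtx (spineᴸ X) ⟦ (frameᴸ f ⊙ mark S (hd ^ tt)) ^ V ⟧
              e′ , st , d = contract-spine X f {ρ = heap bs₀ none} head nv (erased→ e (Final.erase-t lab) h)
          in  finish lab (st (letrec-i Bᵘ (toCtx (spineᴸ X)) ^ V)) (Final.body-≻ lab {t′ = toCtx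
                (spineᴸ X) ⟦ e′ ⟧} d h)
        ... | inj₁ (x , refl) with spine-typed X {(f ⊙ (var x ^ tt)) ^ tt} {heap bs₀ none} ty
        ...   | _ , _ , ty₁ with ⊙-wanted f {s = var x ^ tt} {heap bs₀ none} ty₁
        ...     | _ , _ , want , up-to ty₂ _ with splitAt (suc k) x in split
        ...       | inj₂ _ = ⊥-elim ty₂
        ...       | inj₁ z with splitAt⁻¹-↑ˡ {suc k} {n} {x} {z} split
        ...         | refl = binding-progress (φ₀-acc z ty₂)
          (enter (X ▹ f ∙ tt) z (trans eq (sym (toCtx-▹ X f tt _)))
            (subst₂ (Star StepNV) (cong (mark S) (sym eq)) (sym (labelled S))
              (descend X f (var (bound z) ^ tt) (inj₁ refl)))
            (in-body X f (start tt) want (labelled V))) ty₂ h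
          where
          labelled : ∀ l → toCtx (spineᴸ (X ▹ f ∙ tt)) ⟦ var (bound z) ^ l ⟧ ≡ toCtx
            (spineᴸ X) ⟦ (frameᴸ f ⊙ (var (bound z) ^ l)) ^ V ⟧
          labelled l = trans (cong (λ Y → toCtx Y ⟦ var (bound z) ^ l ⟧) (spineᴸ-▹ X f))
            (toCtx-▹ (spineᴸ X) (frameᴸ f) V _)

    LR-progress : ∀ {s : E n} {p} → ⟪ s ⟫ none ⋆ p → Outcome s p
    LR-progress {s = var _ ^ _} (up-to () _)
    LR-progress {s = app s t ^ l}     h = progress-framed (view-⊙ (app t) l (view s)) h
    LR-progress {s = lam _ ^ _}       h = inj₁ (value lam)
    LR-progress {s = letrec bs t ^ _} h = LetrecProgram.letrec-progress bs t h
    LR-progress {s = con _ _ _ ^ _}   h = inj₁ (value con)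
    LR-progress {s = seq s t ^ l}     h = progress-framed (view-⊙ (seq t) l (view s)) h
    LR-progress {s = case κ s rs ^ l} h = progress-framed (view-⊙ (case κ rs) l (view s)) h

    LR-adequate : ∀ (s : E n) → ⟪ s ⟫ none ⋆ p → s ↓LR
    LR-adequate = terminates LR-progress

  open Equivalence using (to; from)

  private
    module M₀ = Model 0 0

  ↓LR⇔⋆ : ∀ {s : E n} → (s ↓LR) ⇔ M₀.⟪ s ⟫ none ⋆ 0
  ↓LR⇔⋆ {s = s} = mk⇔ LRSoundness.↓LR⇒⋆ λ h → LRAdequacy.LR-adequate s (proj₂ (Recharge.recharge 1 0 s h))

  ↓name⇔⋆ : ∀ {s : E n} → (s ↓name) ⇔ M₀.⟪ s ⟫ none ⋆ 0
  ↓name⇔⋆ {s = s} = mk⇔ NameSoundness.↓name⇒⋆ λ h →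
    NameAdequacy.name-adequate s (proj₂ (Recharge.recharge 1 1 s h))

  ↓LR⇒↓name : ∀ (s : E n) → s ↓LR → s ↓name
  ↓LR⇒↓name s h = from ↓name⇔⋆ (to ↓LR⇔⋆ h)

  ↓name⇒↓LR : ∀ (s : E n) → s ↓name → s ↓LR
  ↓name⇒↓LR s h = from ↓LR⇔⋆ (to ↓name⇔⋆ h)

  -- The translation fixes contexts too, so both preorders test the same filled contexts, and
  -- convergence equivalence is applied to each of these.
  ≤LR⇒≤name : ∀ (s t : E n) → s ≤LR t → s ≤name t
  ≤LR⇒≤name _ _ h ρ inj C c = ↓LR⇒↓name _ (h ρ inj C (↓name⇒↓LR _ c))

  ≤name⇒≤LR : ∀ (s t : E n) → s ≤name t → s ≤LR t
  ≤name⇒≤LR _ _ h ρ inj C c = ↓name⇒↓LR _ (h ρ inj C (↓LR⇒↓name _ c))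

corollary5p32 : (Sig : Signature) → let open Calculus Sig in
    (∀ (n : ℕ) (s : E n) → (s ↓LR) ⇔ (W⟦ s ⟧ ↓name))
    × (∀ (n : ℕ) (s t : E n) → (s ≤LR t) ⇔ (W⟦ s ⟧ ≤name W⟦ t ⟧))
corollary5p32 Sig =
  (λ n s → mk⇔ (↓LR⇒↓name s) (↓name⇒↓LR s)) , (λ n s t → mk⇔ (≤LR⇒≤name s t) (≤name⇒≤LR s t))
  where open Convergence Sig
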